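{- Let $k$ and $n\ge2$ be integers such that $n$ is odd or $k$ is odd. Then \[ \mathrm{roots}_k^{D_n}=\sum_{C\in\mathrm{Conj}(D_n):\,C^k=\{1\}}\psi_{D_n}^C, \] where $\mathrm{Conj}(D_n)$ is the set of conjugacy classes of $D_n$ and $C^k=\{x^k:x\in C\}$.
   Context: $\mathrm{roots}_k^G(g)=|\{h\in G:h^k=g\}|$. $B_n$ is the group of bijections $w$ of $\{\pm1,\dots,\pm n\}$ with $w(-i)=-w(i)$; $D_n$ is the subgroup of $w\in B_n$ with an even number of $1\le i\le n$ such that $w(i)<0$. Cycles: if $c=(a_1,\dots,a_\ell)$ is a cycle of $w$ on $\{\pm1,\dots,\pm n\}$ so is $\bar c=(-a_1,\dots,-a_\ell)$; if $c\ne\bar c$, $c\bar c$ is a cycle of length $\ell$ and $\mathbb Z_2$-class $+1$; if $c=\bar c$, a cycle of length $\ell/2$ and class $-1$. For $x\in B_n$ with $a_{i,\varepsilon}$ cycles of length $i$ and class $\varepsilon$, $Z_{B_n}(x)\cong\prod_{i,\varepsilon}G_{i,\varepsilon}\wr S_{a_{i,\varepsilon}}$, where $G_{i,+}\cong\mathbb Z_2\times\mathbb Z_i$ is the centralizer in $B_i$ of one cycle of length $i$ and class $+1$ ($\mathbb Z_2$ generated by $[-1,\dots,-i]$, $\mathbb Z_i$ by the cycle) and $G_{i,- }\cong\mathbb Z_{2i}$ is generated by one cycle of class $-1$. $\omega_{i,+}$ is the linear character of $G_{i,+}\wr S_a$ equal on the base group to the product over factors of (trivial on $\mathbb Z_2$)$\times$(faithful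 linear character of $\mathbb Z_i$), trivial on the complement $S_a$; $\omega_{i,- }$ is the product over base factors of a faithful linear character of $\mathbb Z_{2i}$, trivial on $S_a$; $\omega^x=\bigotimes\omega_{i,\varepsilon}$. For a conjugacy class $C$ of $D_n$ and $x\in C$, $\psi_{D_n}^C:=\mathrm{Ind}_{Z_{D_n}(x)}^{D_n}\big(\omega^x|_{Z_{D_n}(x)}\big)$ (independent of $x\in C$). -}

module Defs where

open import Level using (Level; _⊔_) renaming (suc to lsuc)
open import Data.Bool using (Bool; true; false; not; _∧_; _∨_; _xor_; if_then_else_)
import Data.Bool as Bool
open import Data.Nat using (ℕ; zero; suc; _≤_; _<_; _≤ᵇ_; _≡ᵇ_; _%_; ⌊_/2⌋)
open import Data.Integer using (ℤ; +_; -[1+_]; ∣_∣)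
open import Data.Fin using (Fin; toℕ)
import Data.Fin as Fin
import Data.Nat as ℕ
open import Data.Vec using (Vec; []; _∷_; lookup; tabulate; toList)
import Data.Vec.Properties as VecP
import Data.Product.Properties as ProdP
open import Data.List using (List; []; _∷_; map; filterᵇ; allFin; upTo; head; length; foldr; cartesianProduct; cartesianProductWith)
open import Data.Bool.ListAction using (any; all)
open import Data.Maybe using (Maybe; just; nothing)
open import Data.Product using (_×_; _,_; proj₁; proj₂)
open import Relation.Nullary using (¬_)
open import Relation.Nullary.Decidable using (isYes)
open import Relation.Binary.PropositionalEquality using (_≡_)
open import Algebra.Bundles using (CommutativeRing)

-- Signed permutations.
-- A signed point of {±1,…,±n} is (b , i) : Bool × Fin n, standing for
-- -(i+1) if b = true and +(i+1) if b = false.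
-- An element w of B_n is stored as the vector of values w(1),…,w(n);
-- it acts on signed points by w(-i) = -w(i).

Pt : ℕ → Set
Pt n = Bool × Fin n

SP : ℕ → Set
SP n = Vec (Pt n) n

negP : ∀ {n} → Pt n → Pt n
negP (b , i) = (not b , i)

eqFin : ∀ {n} → Fin n → Fin n → Bool
eqFin i j = isYes (i Fin.≟ j)

eqPt : ∀ {n} → Pt n → Pt n → Bool
eqPt p q = isYes (ProdP.≡-dec Bool._≟_ Fin._≟_ p q)

eqSP : ∀ {n} → SP n → SP n → Bool
eqSP v w = isYes (VecP.≡-dec (ProdP.≡-dec Bool._≟_ Fin._≟_) v w)

app : ∀ {n} → SP n → Pt n → Pt n
app w (b , i) with lookup w i
... | (c , j) = (b xor c , j)

comp : ∀ {n} → SP n → SP n → SP n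
comp w v = tabulate (λ i → app w (lookup v i))

idSP : ∀ {n} → SP n
idSP = tabulate (λ i → (false , i))

preim : ∀ {n} → SP n → Fin n → Pt n
preim {n} w j with head (filterᵇ (λ i → eqFin (proj₂ (lookup w i)) j) (allFin n))
... | just i  = (proj₁ (lookup w i) , i)
... | nothing = (false , j)

inv : ∀ {n} → SP n → SP n
inv w = tabulate (preim w)

powℕ : ∀ {n} → SP n → ℕ → SP n
powℕ w zero    = idSP
powℕ w (suc m) = comp w (powℕ w m)

powℤ : ∀ {n} → SP n → ℤ → SP n
powℤ w (+ m)    = powℕ w m
powℤ w -[1+ m ] = powℕ (inv w) (suc m)

allVecs : ∀ {A : Set} → List A → (m : ℕ) → List (Vec A m)
allVecs xs zero    = [] ∷ []
allVecs xs (suc m) = cartesianProductWith _∷_ xs (allVecs xs m)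

allPts : (n : ℕ) → List (Pt n)
allPts n = cartesianProduct (true ∷ false ∷ []) (allFin n)

distinct : ∀ {n} → List (Fin n) → Bool
distinct []       = true
distinct (x ∷ xs) = not (any (eqFin x) xs) ∧ distinct xs

Bn : (n : ℕ) → List (SP n)
Bn n = filterᵇ (λ w → distinct (map proj₂ (toList w))) (allVecs (allPts n) n)

negCount : ∀ {n} → SP n → ℕ
negCount w = length (filterᵇ proj₁ (toList w))

Dn : (n : ℕ) → List (SP n)
Dn n = filterᵇ (λ w → (negCount w % 2) ≡ᵇ 0) (Bn n)

memb : ∀ {n} → SP n → List (SP n) → Bool
memb x xs = any (eqSP x) xs

rootsD : (n : ℕ) → ℤ → SP n → ℕ
rootsD n k g = length (filterᵇ (λ h → eqSP (powℤ h k) g) (Dn n))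

-- Conjugacy classes of D_n, via canonical representatives.
-- The class of x is {t x t⁻¹ : t ∈ D_n}.  Elements are totally ordered by
-- an injective code in ℕ; each class is represented by its unique element
-- of least code.

encPt : ∀ {n} → Pt n → ℕ
encPt (b , i) = 2 ℕ.* toℕ i ℕ.+ (if b then 1 else 0)

code : ∀ {n} → SP n → ℕ
code {n} w = foldr (λ p acc → encPt p ℕ.+ (2 ℕ.* n) ℕ.* acc) 0 (toList w)

conjBy : ∀ {n} → SP n → SP n → SP n
conjBy t x = comp t (comp x (inv t))

isClassRep : (n : ℕ) → SP n → Bool
isClassRep n x = all (λ t → code x ≤ᵇ code (conjBy t x)) (Dn n)

classReps : (n : ℕ) → List (SP n)
classReps n = filterᵇ (isClassRep n) (Dn n)

classPowTrivial : (n : ℕ) → ℤ → SP n → Bool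
classPowTrivial n k x = all (λ t → eqSP (powℤ (conjBy t x) k) idSP) (Dn n)

centD : (n : ℕ) → SP n → List (SP n)
centD n x = filterᵇ (λ z → eqSP (comp z x) (comp x z)) (Dn n)

iterP : ∀ {n} → SP n → ℕ → Pt n → Pt n
iterP x zero    p = p
iterP x (suc r) p = app x (iterP x r p)

-- the orbit of p under x (its length is at most 2n)
orbit : ∀ {n} → SP n → Pt n → List (Pt n)
orbit {n} x p = map (λ r → iterP x r p) (upTo (2 ℕ.* n))

inOrbit : ∀ {n} → SP n → Pt n → Pt n → Bool
inOrbit x p q = any (eqPt q) (orbit x p)

firstℕ : (ℕ → Bool) → List ℕ → ℕ
firstℕ P rs with head (filterᵇ P rs)
... | just r  = r
... | nothing = 0

orbitLen : ∀ {n} → SP n → Pt n → ℕ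
orbitLen {n} x p = firstℕ (λ r → eqPt (iterP x r p) p) (map suc (upTo (2 ℕ.* n)))

baseIdx : ∀ {n} → SP n → Pt n → Fin n
baseIdx {n} x p with head (filterᵇ (λ j → inOrbit x p (false , j) ∨ inOrbit x p (true , j)) (allFin n))
... | just j  = j
... | nothing = proj₂ p

isBase : ∀ {n} → SP n → Fin n → Bool
isBase x i = toℕ (baseIdx x (false , i)) ≡ᵇ toℕ i

-- the cycle through +i has Z2-class -1 (c = c̄)
isMinus : ∀ {n} → SP n → Fin n → Bool
isMinus x i = inOrbit x (false , i) (true , i)

-- the length of the cycle of x with base point i (as in the paper:
-- ℓ for class +1, ℓ/2 for class -1, ℓ the length on 2n points)
cycLen : ∀ {n} → SP n → Fin n → ℕ
cycLen x i = if isMinus x i then ⌊ orbitLen x (false , i) /2⌋ else orbitLen x (false , i)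

-- For z ∈ Z(x) and a cycle with base point a = +i: z(a) lies in the cycle
-- with base point a' ; r is the least r ≥ 0 with z(a) = x^r(a') (class -1),
-- resp. z(a) = ± x^r(a') (class +1).  This is the Z_{2i}-, resp.
-- Z_i-component of the base-group coordinate of z in the wreath product
-- decomposition of Z_{B_n}(x) defined by the base points.
shiftR : ∀ {n} → SP n → SP n → Fin n → ℕ
shiftR {n} x z i =
  let q  = app z (false , i)
      a' = (false , baseIdx x q)
  in if isMinus x i
     then firstℕ (λ r → eqPt (iterP x r a') q) (upTo (2 ℕ.* n))
     else firstℕ (λ r → eqPt (iterP x r a') q ∨ eqPt (iterP x r a') (negP q)) (upTo (2 ℕ.* n))

record Field' (c ℓ : Level) : Set (lsuc (c ⊔ ℓ)) where
  field
    commutativeRing : CommutativeRing c ℓ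
  open CommutativeRing commutativeRing public
  field
    _⁻¹        : Carrier → Carrier
    ⁻¹-inverse : ∀ x → ¬ (x ≈ 0#) → x * (x ⁻¹) ≈ 1#
    nontrivial : ¬ (1# ≈ 0#)

module FieldOps {c ℓ} (F : Field' c ℓ) where
  open Field' F

  fromℕ : ℕ → Carrier
  fromℕ zero    = 0#
  fromℕ (suc m) = 1# + fromℕ m

  powK : Carrier → ℕ → Carrier
  powK a zero    = 1#
  powK a (suc m) = a * powK a m

  sumK : List Carrier → Carrier
  sumK = foldr _+_ 0#

  prodK : List Carrier → Carrier
  prodK = foldr _*_ 1#

  CharZero : Set ℓ
  CharZero = ∀ m → ¬ (fromℕ (suc m) ≈ 0#)

  PrimRoot : ℕ → Carrier → Set ℓ
  PrimRoot m a = (powK a m ≈ 1#) × (∀ d → 1 ≤ d → d < m → ¬ (powK a d ≈ 1#))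

-- The characters.  α i is the image of the generating cycle under the
-- chosen faithful linear character of Z_i (a primitive i-th root of
-- unity), β i that of the generator of Z_{2i} (a primitive 2i-th root).

module Chars {c ℓ} (F : Field' c ℓ) (α β : ℕ → Field'.Carrier F) where
  open Field' F
  open FieldOps F

  omega : ∀ {n} → SP n → SP n → Carrier
  omega {n} x z =
    prodK (map (λ i → if isMinus x i
                      then powK (β (cycLen x i)) (shiftR x z i)
                      else powK (α (cycLen x i)) (shiftR x z i))
               (filterᵇ (isBase x) (allFin n)))

  -- ψ^C_{D_n}(g) = Ind_{Z_{D_n}(x)}^{D_n}(ω^x|_{Z_{D_n}(x)})(g)
  --             = |Z|⁻¹ Σ_{t ∈ D_n, t⁻¹gt ∈ Z} ω^x(t⁻¹ g t)
  psi : (n : ℕ) → SP n → SP n → Carrier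
  psi n x g =
    (fromℕ (length (centD n x))) ⁻¹ *
    sumK (map (λ t → let y = comp (inv t) (comp g t) in
                     if memb y (centD n x) then omega x y else 0#)
              (Dn n))

  rhs : (n : ℕ) → ℤ → SP n → Carrier
  rhs n k g = sumK (map (λ x → psi n x g) (filterᵇ (classPowTrivial n k) (classReps n)))

OddN : ℕ → Set
OddN m = m % 2 ≡ 1

OddZ : ℤ → Set
OddZ k = ∣ k ∣ % 2 ≡ 1

{-# OPTIONS --safe #-}

-- Unfolding the induced characters turns the right-hand side into the sum of ω^y(g) over the y ∈ D_n with
-- y^k = 1 that commute with g.  ω^y(g) is a product over the blocks, i.e. the orbits of ⟨y, g⟩ on {1,…,n}.
--
-- Both sides are thus sums over the centralizer of g in B_n of products over blocks, and they are compared one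
-- block at a time: multiply w by the powers of g restricted to a single g-cycle c of the block.  If d is the
-- first time at which w returns to c, this moves the exponent σ of w^d = ±g^σ on c through all residues modulo
-- the order o of g on c.  Only k = d l contributes; there h^k = g says l σ ≡ 1 (mod o), and y^k = 1 says
-- l σ ≡ 0 (mod o).  On the gcd(o,l) solutions of the latter the factor of ω takes distinct values among the
-- gcd(o,l)-th roots of unity, so these sum to 0 unless gcd(o,l) = 1, when both sides contribute 1.
--
-- For k odd all terms lie in D_n.  For k even and n odd one also needs the sums twisted by the sign character
-- with kernel D_n.  The one over roots vanishes under h ↦ -h.  In the other one, -g ∉ D_n forces every y to have
-- a block on which -g is odd, and averaging over this block gives 0.
module Submission where

open import Defs
open import Level using (Level)
open import Data.Nat using (ℕ; _≤_)
open import Data.Integer using (ℤ)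
open import Data.Sum using (_⊎_)
open import Data.Product using (_×_)
open import Data.List.Membership.Propositional using (_∈_)

-- ω^y(g) is read along the `y`-cycles: it records where `g` first re-enters a `y`-cycle (`expG`,
-- `expW`). The moves act on the other description, where `y` first re-enters a `g`-cycle (`d`,
-- `σ`). That distinct exponents give distinct factors therefore needs a dictionary between the two.
-- Signs complicate it: ω ignores the sign of a point on a positive cycle but not on a negative one,
-- so comparisons of points carry the class of the cycle (`Sim`), and -1 may or may not be a power
-- of `g` on the cycle.
--
-- The moves preserve blocks, so exchanging one factor leaves the others fixed; taking the mean over
-- the moves uses characteristic zero.
--
-- As a parity, the sign of -g on a block is d (m + 1) or d m, according to whether its `g`-cycles,
-- of length m, are negative or positive. An odd sign thus means that d is odd and that some move
-- changes the sign of w: `g` on a negative cycle of even length, -1 on a positive cycle of odd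
-- length. As k = d l is even, l is then even, and this makes both twisted averages vanish.

-- Finite sums and products over lists in a commutative monoid.

module BigOperators where
  open import Algebra.Bundles using (CommutativeMonoid)
  open import Function using (_∘_; id; mk⇔)
  open import Data.Bool using (Bool; true; false; if_then_else_; T?)
  open import Data.Bool.Properties using (T-≡)
  open import Data.Nat using (zero; suc)
  open import Data.Product using (_,_; ∃)
  open import Data.List using (List; []; _∷_; map; foldr; filterᵇ; upTo; applyUpTo; _∷ʳ_; _++_)
  open import Data.List.Properties using (applyUpTo-∷ʳ)
  open import Data.List.Membership.Propositional.Properties using (∈-map⁺; ∈-map⁻; ∈-filter⁺; ∈-filter⁻)
  open import Data.List.Membership.Propositional.Properties.WithK using (unique∧set⇒bag)
  open import Data.List.Relation.Unary.Any using (here; there)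
  open import Data.List.Relation.Unary.All using (All; []; _∷_)
  import Data.List.Relation.Unary.All as All
  open import Data.List.Relation.Unary.AllPairs using ([]; _∷_)
  open import Data.List.Relation.Unary.Unique.Propositional using (Unique)
  open import Data.List.Relation.Binary.BagAndSetEquality using (∼bag⇒↭)
  import Data.List.Relation.Binary.Permutation.Propositional as Perm↭
  open Perm↭ using (_↭_)
  open import Relation.Binary.PropositionalEquality hiding (setoid)
  open import Relation.Nullary using (contradiction; ¬_)
  import Relation.Binary.Reasoning.Setoid as SetoidReasoning
  import Algebra.Properties.CommutativeSemigroup as CSProps
  open import Function.Bundles using (module Equivalence)

  module _ {A : Set} where

    ∈-filterᵇ⁺ : (p : A → Bool) {xs : List A} {x : A} → x ∈ xs → p x ≡ true → x ∈ filterᵇ p xs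
    ∈-filterᵇ⁺ p x∈ px = ∈-filter⁺ (T? ∘ p) x∈ (Equivalence.from T-≡ px)

    ∈-filterᵇ⁻ : (p : A → Bool) {xs : List A} {x : A} → x ∈ filterᵇ p xs → x ∈ xs × p x ≡ true
    ∈-filterᵇ⁻ p {xs} x∈ with ∈-filter⁻ (T? ∘ p) {xs = xs} x∈
    ... | x∈xs , px = x∈xs , Equivalence.to T-≡ px

    Unique-map : {B : Set} (f : A → B) {xs : List A} → (∀ {x y} → x ∈ xs → y ∈ xs → f x ≡ f y → x ≡ y) →
                 Unique xs → Unique (map f xs)
    Unique-map f inj [] = []
    Unique-map f {x ∷ xs} inj (x∉ ∷ u) =
      All.tabulate (λ {z} z∈ → λ { refl → let (y , y∈ , e) = ∈-map⁻ f z∈ in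
        All.lookup x∉ y∈ (inj (here refl) (there y∈) e) })
      ∷ Unique-map f (λ a b → inj (there a) (there b)) u

  true≢false : ∀ {b} → b ≡ true → ¬ (b ≡ false)
  true≢false refl ()

  ¬true⇒false : ∀ {b} → ¬ (b ≡ true) → b ≡ false
  ¬true⇒false {true} h = contradiction refl h
  ¬true⇒false {false} h = refl

  bool-ext : ∀ {a b} → (a ≡ true → b ≡ true) → (b ≡ true → a ≡ true) → a ≡ b
  bool-ext {true} f g = sym (f refl)
  bool-ext {false} {true} f g = g refl
  bool-ext {false} {false} f g = refl

  module Big {c ℓ} (M : CommutativeMonoid c ℓ) where
    open CommutativeMonoid M renaming (refl to ≈-refl; sym to ≈-sym; trans to ≈-trans; reflexive to ≈-reflexive)
    open SetoidReasoning setoid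
    open CSProps commutativeSemigroup using (interchange; x∙yz≈y∙xz)

    big : ∀ {a} {A : Set a} → List A → (A → Carrier) → Carrier
    big xs f = foldr _∙_ ε (map f xs)

    module _ {a} {A : Set a} where

      big-cong : (xs : List A) {f g : A → Carrier} → (∀ x → x ∈ xs → f x ≈ g x) → big xs f ≈ big xs g
      big-cong [] h = ≈-refl
      big-cong (x ∷ xs) h = ∙-cong (h x (here refl)) (big-cong xs (λ y y∈ → h y (there y∈)))

      big-∙ : (xs : List A) (f g : A → Carrier) → big xs (λ x → f x ∙ g x) ≈ big xs f ∙ big xs g
      big-∙ [] f g = ≈-sym (identityˡ ε)
      big-∙ (x ∷ xs) f g = ≈-trans (∙-congˡ (big-∙ xs f g)) (interchange _ _ _ _)

      big-ε : (xs : List A) {f : A → Carrier} → (∀ x → x ∈ xs → f x ≈ ε) → big xs f ≈ ε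
      big-ε [] h = ≈-refl
      big-ε (x ∷ xs) h = ≈-trans (∙-cong (h x (here refl)) (big-ε xs (λ y y∈ → h y (there y∈)))) (identityˡ ε)

      big-filter : (p : A → Bool) (xs : List A) (f : A → Carrier) →
                   big (filterᵇ p xs) f ≈ big xs (λ x → if p x then f x else ε)
      big-filter p [] f = ≈-refl
      big-filter p (x ∷ xs) f with p x
      ... | true = ∙-congˡ (big-filter p xs f)
      ... | false = ≈-trans (big-filter p xs f) (≈-sym (identityˡ _))

      big-↭ : {xs ys : List A} (f : A → Carrier) → xs ↭ ys → big xs f ≈ big ys f
      big-↭ f Perm↭.refl = ≈-refl
      big-↭ f (Perm↭.prep x p) = ∙-congˡ (big-↭ f p)
      big-↭ f (Perm↭.swap x y p) = ≈-trans (∙-congˡ (∙-congˡ (big-↭ f p))) (x∙yz≈y∙xz _ _ _)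
      big-↭ f (Perm↭.trans p q) = ≈-trans (big-↭ f p) (big-↭ f q)

    big-swap : ∀ {a b} {A : Set a} {B : Set b} (xs : List A) (ys : List B) (f : A → B → Carrier) →
               big xs (λ x → big ys (f x)) ≈ big ys (λ y → big xs (λ x → f x y))
    big-swap [] ys f = ≈-sym (big-ε ys (λ _ _ → ≈-refl))
    big-swap (x ∷ xs) ys f = ≈-trans (∙-congˡ (big-swap xs ys f)) (≈-sym (big-∙ ys _ _))

    big-map : ∀ {a b} {A : Set a} {B : Set b} (h : A → B) (xs : List A) (F : B → Carrier) →
      big (map h xs) F ≡ big xs (F ∘ h)
    big-map h [] F = refl
    big-map h (x ∷ xs) F = cong (F (h x) ∙_) (big-map h xs F)

    -- A bijection between duplicate-free lists makes `map h xs` and `ys` equal as sets, hence as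
    -- bags, hence permutations of each other.
    big-reindex : {A B : Set} {xs : List A} {ys : List B} (h : A → B) (F : B → Carrier) →
      Unique xs → Unique ys → (∀ {x} → x ∈ xs → h x ∈ ys) →
      (∀ {x y} → x ∈ xs → y ∈ xs → h x ≡ h y → x ≡ y) →
      (∀ {y} → y ∈ ys → ∃ λ x → x ∈ xs × h x ≡ y) →
      big ys F ≈ big xs (F ∘ h)
    big-reindex {xs = xs} {ys} h F ux uy to inj surj = begin
      big ys F          ≈⟨ big-↭ F (Perm↭.↭-sym perm) ⟩
      big (map h xs) F  ≡⟨ big-map h xs F ⟩
      big xs (F ∘ h)    ∎
      where
      into : ∀ {z} → z ∈ map h xs → z ∈ ys
      into z∈ with ∈-map⁻ h z∈
      ... | x , x∈ , refl = to x∈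
      outof : ∀ {z} → z ∈ ys → z ∈ map h xs
      outof z∈ with surj z∈
      ... | x , x∈ , refl = ∈-map⁺ h x∈
      perm : map h xs ↭ ys
      perm = ∼bag⇒↭ (unique∧set⇒bag (Unique-map h inj ux) uy (mk⇔ into outof))

    big-select : {A : Set} {xs : List A} {a : A} (p : A → Bool) (f : A → Carrier) → Unique xs → a ∈ xs →
      p a ≡ true → (∀ {x} → x ∈ xs → p x ≡ true → x ≡ a) →
      big xs (λ x → if p x then f x else ε) ≈ f a
    big-select {xs = x ∷ xs} p f (x∉ ∷ u) (here refl) pa only rewrite pa =
      ≈-trans (∙-congˡ (big-ε xs rest)) (identityʳ _)
      where
      rest : ∀ y → y ∈ xs → (if p y then f y else ε) ≈ ε
      rest y y∈ with p y in eq
      ... | true = contradiction (sym (only (there y∈) eq)) (All.lookup x∉ y∈)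
      ... | false = ≈-refl
    big-select {xs = x ∷ xs} p f (x∉ ∷ u) (there a∈) pa only with p x in eq
    ... | true = contradiction (only (here refl) eq) (All.lookup x∉ a∈)
    ... | false = ≈-trans (identityˡ _) (big-select p f u a∈ pa (only ∘ there))

    -- The fibre over `y` is cut out by a test `q y` instead of a comparison of `h x` with `y`. For
    -- `g`-cycles the test is membership in the cycle, a form that `onCyc-sum` can evaluate.
    big-fibre : {A B : Set} {xs : List A} {ys : List B} (q : B → A → Bool) (h : A → B) (f : A → Carrier) → Unique ys →
      (∀ {x} → x ∈ xs → h x ∈ ys) → (∀ {x} → x ∈ xs → q (h x) x ≡ true) →
      (∀ {x y} → x ∈ xs → y ∈ ys → q y x ≡ true → y ≡ h x) →
      big xs f ≈ big ys (λ y → big xs (λ x → if q y x then f x else ε))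
    big-fibre {xs = xs} {ys} q h f uy to qh only = begin
      big xs f
        ≈⟨ big-cong xs (λ x x∈ → big-select (λ y → q y x) (λ _ → f x) uy (to x∈) (qh x∈) (only x∈)) ⟨
      big xs (λ x → big ys (λ y → if q y x then f x else ε))
        ≈⟨ big-swap xs ys _ ⟩
      big ys (λ y → big xs (λ x → if q y x then f x else ε)) ∎

    big-++ : ∀ {a} {A : Set a} (xs ys : List A) (f : A → Carrier) → big (xs ++ ys) f ≈ big xs f ∙ big ys f
    big-++ [] ys f = ≈-sym (identityˡ _)
    big-++ (x ∷ xs) ys f = ≈-trans (∙-congˡ (big-++ xs ys f)) (≈-sym (assoc _ _ _))

    big-applyUpTo : ∀ {a} {A : Set a} (g : ℕ → A) (f : A → Carrier) (m : ℕ) →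
      big (applyUpTo g m) f ≈ big (upTo m) (f ∘ g)
    big-applyUpTo g f zero = ≈-refl
    big-applyUpTo g f (suc m) = ∙-congˡ (≈-trans (big-applyUpTo (g ∘ suc) f m) (≈-sym (big-applyUpTo suc (f ∘ g) m)))

    big-upTo-first : ∀ m (f : ℕ → Carrier) → big (upTo (suc m)) f ≈ f 0 ∙ big (upTo m) (f ∘ suc)
    big-upTo-first m f = ∙-congˡ (big-applyUpTo suc f m)

    big-upTo-last : ∀ m (f : ℕ → Carrier) → big (upTo (suc m)) f ≈ big (upTo m) f ∙ f m
    big-upTo-last m f = begin
      big (upTo (suc m)) f       ≡⟨ cong (λ l → big l f) (applyUpTo-∷ʳ id m) ⟨
      big (upTo m ∷ʳ m) f        ≈⟨ big-++ (upTo m) (m ∷ []) f ⟩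
      big (upTo m) f ∙ (f m ∙ ε) ≈⟨ ∙-congˡ (identityʳ _) ⟩
      big (upTo m) f ∙ f m       ∎

open BigOperators

-- Signed permutations as maps on signed points.

module SignedPermutations where
  open import Function using (_∘_)
  open import Data.Bool using (Bool; true; false; not; _∧_; _∨_; _xor_; T?)
  import Data.Bool as Bool
  open import Data.Bool.Properties using (xor-assoc; xor-comm; xor-same; xor-identityʳ; ∨-zeroʳ; not-involutive; not-¬)
  open import Data.Bool.ListAction using (any; all)
  open import Data.Nat using (zero; suc; _+_; _*_; _∸_)
  open import Data.Nat.Properties using (+-comm; m+[n∸m]≡n; m∸n≤m; ≤-trans; ≤-refl; <⇒≤; m<n⇒0<n∸m; +-suc; ≤-pred)
  open import Data.Fin using (Fin; toℕ) renaming (zero to fzero; suc to fsuc)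
  import Data.Fin as Fin
  open import Data.Fin.Properties using (pigeonhole; toℕ<n)
  open import Data.Product using (_,_; proj₁; proj₂; ∃)
  open import Data.Sum using (inj₁; inj₂)
  open import Data.Maybe using (just; nothing)
  open import Data.Vec using (Vec; []; _∷_; lookup; tabulate; toList)
  open import Data.Vec.Properties using (lookup∘tabulate; tabulate∘lookup; tabulate-cong; ∷-injective)
  open import Data.List using (List; []; _∷_; map; filterᵇ; allFin; head)
  open import Data.List.Membership.Propositional.Properties using (∈-cartesianProductWith⁺; ∈-cartesianProduct⁺; ∈-allFin)
  open import Data.List.Relation.Unary.Any using (here; there)
  open import Data.List.Relation.Unary.All using ([]; _∷_)
  open import Data.List.Relation.Unary.AllPairs using ([]; _∷_)
  open import Data.List.Relation.Unary.Unique.Propositional using (Unique)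
  import Data.List.Relation.Unary.Unique.Propositional.Properties as UniqueP
  open import Relation.Binary.PropositionalEquality hiding (setoid)
  open import Relation.Nullary using (contradiction; ¬_; Dec; yes; no)
  open import Relation.Nullary.Decidable using (isYes)

  isYes⁻ : ∀ {p} {P : Set p} (d : Dec P) → isYes d ≡ true → P
  isYes⁻ (yes p) _ = p

  isYes⁺ : ∀ {p} {P : Set p} (d : Dec P) → P → isYes d ≡ true
  isYes⁺ (yes _) _ = refl
  isYes⁺ (no ¬p) p = contradiction p ¬p

  ∧⁻ : ∀ {a b} → a ∧ b ≡ true → a ≡ true × b ≡ true
  ∧⁻ {true} {true} _ = refl , refl

  ∨⁻ : ∀ {a b} → a ∨ b ≡ true → a ≡ true ⊎ b ≡ true
  ∨⁻ {true} _ = inj₁ refl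
  ∨⁻ {false} h = inj₂ h

  module _ {A : Set} where

    any⁺ : (p : A → Bool) {xs : List A} {x : A} → x ∈ xs → p x ≡ true → any p xs ≡ true
    any⁺ p (here refl) px rewrite px = refl
    any⁺ p {y ∷ xs} (there x∈) px = trans (cong (p y ∨_) (any⁺ p x∈ px)) (∨-zeroʳ _)

    any⁻ : (p : A → Bool) (xs : List A) → any p xs ≡ true → ∃ λ x → x ∈ xs × p x ≡ true
    any⁻ p (y ∷ xs) h with p y in eq
    ... | true = y , here refl , eq
    ... | false = let (x , x∈ , px) = any⁻ p xs h in x , there x∈ , px

    all⁻ : (p : A → Bool) {xs : List A} {x : A} → all p xs ≡ true → x ∈ xs → p x ≡ true
    all⁻ p h (here refl) = proj₁ (∧⁻ h)
    all⁻ p {y ∷ xs} h (there x∈) = all⁻ p (proj₂ (∧⁻ {p y} h)) x∈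

    all⁺ : (p : A → Bool) (xs : List A) → (∀ x → x ∈ xs → p x ≡ true) → all p xs ≡ true
    all⁺ p [] h = refl
    all⁺ p (x ∷ xs) h rewrite h x (here refl) = all⁺ p xs (λ y y∈ → h y (there y∈))

    filterᵇ-cong : {p q : A → Bool} → (∀ x → p x ≡ q x) → (xs : List A) → filterᵇ p xs ≡ filterᵇ q xs
    filterᵇ-cong h [] = refl
    filterᵇ-cong {p} {q} h (x ∷ xs) with p x | q x | h x
    ... | true | _ | refl = cong (x ∷_) (filterᵇ-cong h xs)
    ... | false | _ | refl = filterᵇ-cong h xs

    head-filterᵇ-just : (p : A → Bool) (xs : List A) {x : A} → head (filterᵇ p xs) ≡ just x → p x ≡ true
    head-filterᵇ-just p (y ∷ xs) e with p y in eq
    head-filterᵇ-just p (y ∷ xs) refl | true = eq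
    ... | false = head-filterᵇ-just p xs e

    head-filterᵇ-nothing : (p : A → Bool) (xs : List A) → head (filterᵇ p xs) ≡ nothing → ∀ {x} → x ∈ xs → p x ≡ false
    head-filterᵇ-nothing p (y ∷ xs) e x∈ with p y in eq
    head-filterᵇ-nothing p (y ∷ xs) e (here refl) | false = eq
    head-filterᵇ-nothing p (y ∷ xs) e (there x∈) | false = head-filterᵇ-nothing p xs e x∈

  ix : ∀ {n} → Pt n → Fin n
  ix = proj₂

  pos : ∀ {n} → Fin n → Pt n
  pos i = (false , i)

  sg : ∀ {n} → Bool → Pt n → Pt n
  sg b (c , i) = (b xor c , i)

  module _ {n : ℕ} where

    eqFin⁻ : {i j : Fin n} → eqFin i j ≡ true → i ≡ j
    eqFin⁻ = isYes⁻ _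

    eqFin⁺ : {i j : Fin n} → i ≡ j → eqFin i j ≡ true
    eqFin⁺ = isYes⁺ _

    eqPt⁻ : {p q : Pt n} → eqPt p q ≡ true → p ≡ q
    eqPt⁻ = isYes⁻ _

    eqPt⁺ : {p q : Pt n} → p ≡ q → eqPt p q ≡ true
    eqPt⁺ = isYes⁺ _

    eqSP⁻ : {v w : SP n} → eqSP v w ≡ true → v ≡ w
    eqSP⁻ = isYes⁻ _

    eqSP⁺ : {v w : SP n} → v ≡ w → eqSP v w ≡ true
    eqSP⁺ = isYes⁺ _

    sg-sg : ∀ a b (p : Pt n) → sg a (sg b p) ≡ sg (a xor b) p
    sg-sg a b (c , i) = cong (_, i) (sym (xor-assoc a b c))

    sg-comm : ∀ a b (p : Pt n) → sg a (sg b p) ≡ sg b (sg a p)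
    sg-comm a b p = trans (sg-sg a b p) (trans (cong (λ c → sg c p) (xor-comm a b)) (sym (sg-sg b a p)))

    sg-invol : ∀ a (p : Pt n) → sg a (sg a p) ≡ p
    sg-invol a p = trans (sg-sg a a p) (cong (λ c → sg c p) (xor-same a))

    sg-inj : ∀ a {p q : Pt n} → sg a p ≡ sg a q → p ≡ q
    sg-inj a {p} {q} e = trans (sym (sg-invol a p)) (trans (cong (sg a) e) (sg-invol a q))

    sg-fix : ∀ {a} {p : Pt n} → sg a p ≡ p → a ≡ false
    sg-fix {false} e = refl
    sg-fix {true} {c , i} e = contradiction (sym (cong proj₁ e)) (not-¬ refl)

    ix≡⇒sg : {p q : Pt n} → ix p ≡ ix q → ∃ λ b → p ≡ sg b q
    ix≡⇒sg {a , i} {b , .i} refl = a xor b , cong (_, i)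
      (sym (trans (xor-assoc a b b) (trans (cong (a xor_) (xor-same b)) (xor-identityʳ a))))

    pos-ix : (p : Pt n) → p ≡ sg (proj₁ p) (pos (ix p))
    pos-ix (a , i) = cong (_, i) (sym (xor-identityʳ a))

    opaque
      act : SP n → Pt n → Pt n
      act = app

      act≡app : ∀ w p → act w p ≡ app w p
      act≡app w p = refl

      act-sg : ∀ (w : SP n) b p → act w (sg b p) ≡ sg b (act w p)
      act-sg w b (c , i) = cong (_, proj₂ (lookup w i)) (xor-assoc b c _)

      act-ix : ∀ (w : SP n) {p q} → ix p ≡ ix q → ix (act w p) ≡ ix (act w q)
      act-ix w refl = refl

      act-comp : ∀ (w v : SP n) p → act (comp w v) p ≡ act w (act v p)
      act-comp w v (b , i) = trans (cong (sg b) (lookup∘tabulate (λ i → app w (lookup v i)) i))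
        (cong (_, proj₂ (lookup w (proj₂ (lookup v i)))) (sym (xor-assoc b _ _)))

      act-tabulate : ∀ (f : Fin n → Pt n) p → act (tabulate f) p ≡ sg (proj₁ p) (f (ix p))
      act-tabulate f (b , i) = cong (sg b) (lookup∘tabulate f i)

      act-pos : ∀ (w : SP n) i → act w (pos i) ≡ lookup w i
      act-pos w i = refl

    act-id : ∀ (p : Pt n) → act idSP p ≡ p
    act-id (b , i) = trans (act-tabulate pos (b , i)) (cong (_, i) (xor-identityʳ b))

    it : SP n → ℕ → Pt n → Pt n
    it w zero p = p
    it w (suc a) p = act w (it w a p)

    iterP≡it : ∀ w a p → iterP w a p ≡ it w a p
    iterP≡it w zero p = refl
    iterP≡it w (suc a) p = trans (sym (act≡app w _)) (cong (act w) (iterP≡it w a p))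

    SP-ext : {w v : SP n} → (∀ p → act w p ≡ act v p) → w ≡ v
    SP-ext {w} {v} h = trans (sym (tabulate∘lookup w))
      (trans (tabulate-cong (λ i → trans (sym (act-pos w i)) (trans (h (pos i)) (act-pos v i)))) (tabulate∘lookup v))

    -- An `SP n` is an arbitrary vector of points; this is its membership in B_n. Since the action
    -- commutes with signs, injectivity on signed points amounts to distinct absolute values
    -- (`∈-Bn⁺`, `∈-Bn⁻`).
    Perm : SP n → Set
    Perm w = ∀ {p q} → act w p ≡ act w q → p ≡ q

    Comm : SP n → SP n → Set
    Comm w v = ∀ p → act w (act v p) ≡ act v (act w p)

    Comm-sym : ∀ {w v} → Comm w v → Comm v w
    Comm-sym c p = sym (c p)

    ix-inj : ∀ {w} → Perm w → ∀ {p q} → ix (act w p) ≡ ix (act w q) → ix p ≡ ix q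
    ix-inj {w} inj {p} {q} e with ix≡⇒sg e
    ... | b , e′ = cong ix (inj (trans e′ (sym (act-sg w b q))))

    it-+ : ∀ (w : SP n) a b p → it w (a + b) p ≡ it w a (it w b p)
    it-+ w zero b p = refl
    it-+ w (suc a) b p = cong (act w) (it-+ w a b p)

    it-sucʳ : ∀ (w : SP n) a p → it w (suc a) p ≡ it w a (act w p)
    it-sucʳ w a p = trans (cong (λ m → it w m p) (sym (trans (+-suc a 0) (cong suc (trans (+-comm a 0) refl)))))
      (it-+ w a 1 p)

    it-+′ : ∀ (w : SP n) a b p → it w (a + b) p ≡ it w b (it w a p)
    it-+′ w a b p = trans (cong (λ m → it w m p) (+-comm a b)) (it-+ w b a p)

    it-sg : ∀ (w : SP n) a b p → it w a (sg b p) ≡ sg b (it w a p)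
    it-sg w zero b p = refl
    it-sg w (suc a) b p = trans (cong (act w) (it-sg w a b p)) (act-sg w b _)

    it-ix : ∀ (w : SP n) a {p q} → ix p ≡ ix q → ix (it w a p) ≡ ix (it w a q)
    it-ix w zero e = e
    it-ix w (suc a) e = act-ix w (it-ix w a e)

    it-app : ∀ {w v : SP n} → Comm w v → ∀ a p → it w a (act v p) ≡ act v (it w a p)
    it-app c zero p = refl
    it-app {w} c (suc a) p = trans (cong (act w) (it-app c a p)) (c _)

    it-it : ∀ {w v : SP n} → Comm w v → ∀ a b p → it w a (it v b p) ≡ it v b (it w a p)
    it-it c a zero p = refl
    it-it {v = v} c a (suc b) p = trans (it-app c a _) (cong (act v) (it-it c a b p))

    it-inj : ∀ {w} → Perm w → ∀ a {p q} → it w a p ≡ it w a q → p ≡ q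
    it-inj h zero e = e
    it-inj h (suc a) e = it-inj h a (h e)

    it-ix-inj : ∀ {w} → Perm w → ∀ a {p q} → ix (it w a p) ≡ ix (it w a q) → ix p ≡ ix q
    it-ix-inj h zero e = e
    it-ix-inj {w} h (suc a) e = it-ix-inj h a (ix-inj {w} h e)

    it-mul : ∀ (w : SP n) {a p} → it w a p ≡ p → ∀ u → it w (u * a) p ≡ p
    it-mul w e zero = refl
    it-mul w {a} {p} e (suc u) = trans (it-+ w a (u * a) p) (trans (cong (it w a) (it-mul w {a} e u)) e)

    powℕ-act : ∀ (w : SP n) k p → act (powℕ w k) p ≡ it w k p
    powℕ-act w zero p = act-id p
    powℕ-act w (suc k) p = trans (act-comp w (powℕ w k) p) (cong (act w) (powℕ-act w k p))

    -- Among the `n + 1` absolute values of `p`, `w p`, ..., `w^n p` two coincide, and injectivity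
    -- cancels the smaller exponent. This bound makes every later search finite.
    ix-return : ∀ {w} → Perm w → (p : Pt n) → ∃ λ h → suc h ≤ n × ix (it w (suc h) p) ≡ ix p
    ix-return {w} hw p with pigeonhole ≤-refl (λ (i : Fin (suc n)) → ix (it w (toℕ i) p))
    ... | i , j , i<j , e = go (toℕ j ∸ toℕ i) (m<n⇒0<n∸m i<j) (≤-trans (m∸n≤m (toℕ j) (toℕ i)) (≤-pred (toℕ<n j)))
                              (it-ix-inj hw (toℕ i) (trans (cong ix (sym (it-+ w (toℕ i) _ p)))
                                (trans (cong (λ m → ix (it w m p)) (m+[n∸m]≡n (<⇒≤ i<j))) (sym e))))
      where
      go : ∀ m → 1 ≤ m → m ≤ n → ix (it w m p) ≡ ix p → ∃ λ h → suc h ≤ n × ix (it w (suc h) p) ≡ ix p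
      go (suc m) _ le e = m , le , e

    preim-spec : ∀ {w} → Perm w → ∀ j → act w (preim w j) ≡ pos j
    preim-spec {w} hw j with head (filterᵇ (λ i → eqFin (proj₂ (lookup w i)) j) (allFin n)) in eq
    ... | just i = trans (cong (act w) (pos-ix _))
      (trans (act-sg w (proj₁ (lookup w i)) (pos i)) (trans (cong (sg (proj₁ (lookup w i))) (act-pos w i))
          (cong₂ _,_ (xor-same (proj₁ (lookup w i))) (eqFin⁻ (head-filterᵇ-just _ (allFin n) eq)))))
    -- The search cannot fail: if `w^(h+1)` returns `j` to itself up to sign, then `w^h j` is a
    -- preimage of `j` up to sign.
    ... | nothing with ix-return hw (pos j)
    ... | h , _ , e = contradiction (head-filterᵇ-nothing _ (allFin n) eq (∈-allFin (ix (it w h (pos j)))))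
            (true≢false (eqFin⁺ (trans (cong ix (sym (act-pos w _))) (trans (act-ix w refl) e))))

    inv-spec : ∀ {w} → Perm w → ∀ p → act w (act (inv w) p) ≡ p
    inv-spec {w} hw p =
      trans (cong (act w) (act-tabulate (preim w) p))
        (trans (act-sg w (proj₁ p) (preim w (ix p))) (trans (cong (sg (proj₁ p)) (preim-spec hw (ix p)))
          (sym (pos-ix p))))

    Perm-inv : ∀ {w} → Perm w → Perm (inv w)
    Perm-inv {w} hw {p} {q} e = trans (sym (inv-spec hw p)) (trans (cong (act w) e) (inv-spec hw q))

    inv-specˡ : ∀ {w} → Perm w → ∀ p → act (inv w) (act w p) ≡ p
    inv-specˡ hw p = hw (inv-spec hw _)

    Perm-comp : ∀ {w v} → Perm w → Perm v → Perm (comp w v)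
    Perm-comp {w} {v} hw hv {p} {q} e = hv (hw (trans (sym (act-comp w v p)) (trans e (act-comp w v q))))

    Perm-id : Perm idSP
    Perm-id {p} {q} e = trans (sym (act-id p)) (trans e (act-id q))

  toList-distinct⁻ : ∀ {n m} (v : Vec (Pt n) m) → distinct (map proj₂ (toList v)) ≡ true →
    ∀ i j → proj₂ (lookup v i) ≡ proj₂ (lookup v j) → i ≡ j
  toList-distinct⁻ (x ∷ v) d fzero fzero e = refl
  toList-distinct⁻ {n} (x ∷ v) d (fsuc i) (fsuc j) e = cong fsuc
    (toList-distinct⁻ v (proj₂ (∧⁻ {not (any (eqFin (proj₂ x)) (map proj₂ (toList v)))} d)) i j e)
  toList-distinct⁻ {n} (x ∷ v) d fzero (fsuc j) e = contradiction
    (proj₁ (∧⁻ {not (any (eqFin (proj₂ x)) (map proj₂ (toList v)))} d))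
    (λ q → true≢false (lem v j e) (trans (sym (not-involutive _)) (cong not q)))
    where
    lem : ∀ {m} (v : Vec (Pt n) m) j → proj₂ x ≡ proj₂ (lookup v j) →
      any (eqFin (proj₂ x)) (map proj₂ (toList v)) ≡ true
    lem (y ∷ v) fzero e rewrite eqFin⁺ e = refl
    lem (y ∷ v) (fsuc j) e = trans (cong (eqFin (proj₂ x) (proj₂ y) ∨_) (lem v j e)) (∨-zeroʳ _)
  toList-distinct⁻ (x ∷ v) d (fsuc i) fzero e = sym (toList-distinct⁻ (x ∷ v) d fzero (fsuc i) (sym e))

  toList-distinct⁺ : ∀ {n m} (v : Vec (Pt n) m) →
    (∀ i j → proj₂ (lookup v i) ≡ proj₂ (lookup v j) → i ≡ j) → distinct (map proj₂ (toList v)) ≡ true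
  toList-distinct⁺ [] inj = refl
  toList-distinct⁺ {n} (x ∷ v) inj = cong₂ (λ a b → not a ∧ b) (¬true⇒false none)
      (toList-distinct⁺ v (λ i j e → fsuc-inj (inj (fsuc i) (fsuc j) e)))
    where
    fsuc-inj : ∀ {m} {i j : Fin m} → fsuc i ≡ fsuc j → i ≡ j
    fsuc-inj refl = refl
    find : ∀ {m} (v : Vec (Pt n) m) → any (eqFin (proj₂ x)) (map proj₂ (toList v)) ≡ true → ∃ λ j →
      proj₂ x ≡ proj₂ (lookup v j)
    find (y ∷ v) h with eqFin (proj₂ x) (proj₂ y) in eq
    ... | true = fzero , eqFin⁻ eq
    ... | false = let (j , e) = find v h in fsuc j , e
    none : ¬ (any (eqFin (proj₂ x)) (map proj₂ (toList v)) ≡ true)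
    none h with find v h
    ... | j , e with () ← inj fzero (fsuc j) e

  module _ {n : ℕ} where

    ∈-allVecs : ∀ {A : Set} {xs : List A} → (∀ a → a ∈ xs) → ∀ {m} (v : Vec A m) → v ∈ allVecs xs m
    ∈-allVecs h [] = here refl
    ∈-allVecs h (x ∷ v) = ∈-cartesianProductWith⁺ _∷_ (h x) (∈-allVecs h v)

    ∈-allPts : (p : Pt n) → p ∈ allPts n
    ∈-allPts (true , i) = ∈-cartesianProduct⁺ {xs = true ∷ false ∷ []} (here refl) (∈-allFin i)
    ∈-allPts (false , i) = ∈-cartesianProduct⁺ {xs = true ∷ false ∷ []} (there (here refl)) (∈-allFin i)

    allVecs-unique : ∀ {A : Set} {xs : List A} → Unique xs → ∀ m → Unique (allVecs xs m)
    allVecs-unique u zero = [] ∷ []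
    allVecs-unique u (suc m) = UniqueP.cartesianProductWith⁺ _∷_ ∷-injective u (allVecs-unique u m)

    Bn-unique : Unique (Bn n)
    Bn-unique = UniqueP.filter⁺ (T? ∘ _) {xs = allVecs (allPts n) n}
      (allVecs-unique {xs = allPts n} (UniqueP.cartesianProduct⁺ {xs = true ∷ false ∷ []} (((λ ()) ∷ []) ∷ [] ∷ [])
      (UniqueP.allFin⁺ n)) n)

    Dn-unique : Unique (Dn n)
    Dn-unique = UniqueP.filter⁺ (T? ∘ _) {xs = Bn n} Bn-unique

    ∈-Bn⁺ : {w : SP n} → Perm w → w ∈ Bn n
    ∈-Bn⁺ {w} hw = ∈-filterᵇ⁺ _ (∈-allVecs ∈-allPts w)
      (toList-distinct⁺ w (λ i j e → ix-inj hw {pos i} {pos j}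
        (trans (cong ix (act-pos w i)) (trans e (cong ix (sym (act-pos w j)))))))

    -- Distinct absolute values give `p = ± q` when the images agree; the sign must be trivial, as
    -- it also fixes the common image.
    ∈-Bn⁻ : {w : SP n} → w ∈ Bn n → Perm w
    ∈-Bn⁻ {w} w∈ {p} {q} e = go (ix≡⇒sg {p = p} {q = q}
      (toList-distinct⁻ w (proj₂ (∈-filterᵇ⁻ _ {allVecs (allPts n) n} w∈)) (ix p) (ix q) same))
      where
      same : ix (lookup w (ix p)) ≡ ix (lookup w (ix q))
      same = trans (cong ix (sym (act-pos w (ix p))))
        (trans (act-ix w refl) (trans (cong ix e) (trans (act-ix w refl) (cong ix (act-pos w (ix q))))))
      go : (∃ λ b → p ≡ sg b q) → p ≡ q
      go (b , refl) with sg-fix {a = b} {p = act w q} (trans (sym (act-sg w b q)) e)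
      ... | refl = refl

open SignedPermutations

-- Periods of orbits, and of returns to an orbit.

module Periods where
  open import Function using (_∘_; id)
  open import Data.Bool using (Bool; true; false; not; _∧_; _xor_)
  open import Data.Bool.Properties using (xor-same; xor-identityʳ; ∧-zeroʳ; not-involutive)
  open import Data.Nat using (zero; suc; _+_; _*_; _<_; z≤n; s≤s; _%_; _/_; _≡ᵇ_; >-nonZero)
  open import Data.Nat.Properties
  open import Data.Nat.Divisibility
  open import Data.Nat.DivMod using (m≡m%n+[m/n]*n; m%n<n; [m+kn]%n≡m%n)
  open import Data.Fin using (Fin)
  open import Data.Product using (_,_; proj₁; proj₂; ∃)
  open import Data.List using (_∷_; filterᵇ; head; applyUpTo)
  open import Data.Maybe using (just; nothing; maybe′)
  open import Relation.Binary.PropositionalEquality hiding (setoid)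
  open import Relation.Nullary using (contradiction; ¬_; Dec; yes; no)
  import Data.Fin as Fin

  par : ℕ → Bool
  par zero = false
  par (suc a) = not (par a)

  not-xor : ∀ a b → not (a xor b) ≡ not a xor b
  not-xor true b = not-involutive b
  not-xor false b = refl

  par-+ : ∀ a b → par (a + b) ≡ par a xor par b
  par-+ zero b = refl
  par-+ (suc a) b = trans (cong not (par-+ a b)) (not-xor (par a) (par b))

  xor-∧-step : ∀ x y → y xor (x ∧ y) ≡ not x ∧ y
  xor-∧-step true y = xor-same y
  xor-∧-step false y = xor-identityʳ y

  par-* : ∀ a b → par (a * b) ≡ par a ∧ par b
  par-* zero b = refl
  par-* (suc a) b = trans (par-+ b (a * b)) (trans (cong (par b xor_) (par-* a b)) (xor-∧-step (par a) (par b)))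

  par-%2 : ∀ a → par a ≡ (a % 2 ≡ᵇ 1)
  par-%2 zero = refl
  par-%2 (suc zero) = refl
  par-%2 (suc (suc a)) = trans (not-involutive (par a))
    (trans (par-%2 a) (cong (_≡ᵇ 1) (sym (trans (cong (_% 2) (+-comm 2 a)) ([m+kn]%n≡m%n a 1 2)))))

  2∣⇒even : ∀ {a} → 2 ∣ a → par a ≡ false
  2∣⇒even (divides q refl) = trans (par-* q 2) (∧-zeroʳ (par q))

  even⇒2∣ : ∀ a → par a ≡ false → 2 ∣ a
  even⇒2∣ zero _ = 2 ∣0
  even⇒2∣ (suc (suc a)) e = ∣m∣n⇒∣m+n (∣-refl {2}) (even⇒2∣ a (trans (sym (not-involutive (par a))) e))

  -- `P` is the trace on ℕ of the subgroup of ℤ generated by `e`. Statements about return times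
  -- become divisibilities.
  record Per (P : ℕ → Set) (e : ℕ) : Set where
    field
      positive : 0 < e
      to : ∀ {a} → P a → e ∣ a
      from : ∀ {a} → e ∣ a → P a
  open Per public

  Per-unique : ∀ {P e e′} → Per P e → Per P e′ → e ≡ e′
  Per-unique p q = ∣-antisym (to p (from q ∣-refl)) (to q (from p ∣-refl))

  least : {Q : ℕ → Set} → (∀ a → Dec (Q a)) → ∀ N → Q N → ∃ λ e → e ≤ N × Q e × (∀ {a} → a < e → ¬ Q a)
  least Q? zero q = 0 , z≤n , q , λ ()
  least Q? (suc N) q with Q? 0
  ... | yes q₀ = 0 , z≤n , q₀ , λ ()
  ... | no ¬q₀ with least (Q? ∘ suc) N q
  ... | e , e≤ , qe , min = suc e , s≤s e≤ , qe , λ { {zero} _ → ¬q₀ ; {suc a} (s≤s lt) → min lt }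

  -- The least positive element generates: closure under addition gives its multiples, and
  -- cancelling a multiple shows that the remainder of any element satisfies `P`, so it is 0 by
  -- minimality.
  period : {P : ℕ → Set} → (∀ a → Dec (P a)) → P 0 → (∀ {a b} → P a → P b → P (a + b)) →
    (∀ {a b} → P (a + b) → P a → P b) →
           ∀ {N} → P (suc N) → ∃ λ e → Per P e × e ≤ suc N
  period {P} P? p₀ add sub {N} pN with least (P? ∘ suc) N pN
  ... | e , e≤ , pe , min = suc e , record { positive = s≤s z≤n ; to = to′ ; from = λ { (divides q refl) → mul q } } ,
    s≤s e≤
    where
    mul : ∀ q → P (q * suc e)
    mul zero = p₀
    mul (suc q) = add pe (mul q)
    to′ : ∀ {a} → P a → suc e ∣ a
    to′ {a} pa with a % suc e in eq | m%n<n a (suc e) | sub {(a / suc e) * suc e} {a % suc e}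
      (subst P (trans (m≡m%n+[m/n]*n a (suc e)) (+-comm (a % suc e) _)) pa) (mul (a / suc e))
    ... | zero | _ | _ = m%n≡0⇒n∣m a (suc e) eq
    ... | suc r | s≤s r<e | pr = contradiction pr (min r<e)

  -- Recognizes as generator the number found by a search for the least positive element; that a
  -- generator exists at all is supplied by the last argument.
  Per-via : {P : ℕ → Set} → ∀ {e} → 0 < e → P e → (∀ {a} → 0 < a → a < e → ¬ P a) →
    (∃ λ e′ → Per P e′) → Per P e
  Per-via {P} {e} e>0 pe min (e′ , per) = subst (Per P)
    (≤-antisym (∣⇒≤ {{>-nonZero e>0}} (to per pe)) (≮⇒≥ (λ lt → min (positive per) lt (from per ∣-refl)))) per

  firstℕ-maybe : ∀ P xs → firstℕ P xs ≡ maybe′ id 0 (head (filterᵇ P xs))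
  firstℕ-maybe P xs with head (filterᵇ P xs)
  ... | just r = refl
  ... | nothing = refl

  firstℕ-take : ∀ P {x} xs → P x ≡ true → firstℕ P (x ∷ xs) ≡ x
  firstℕ-take P {x} xs e rewrite firstℕ-maybe P (x ∷ xs) | e = refl

  firstℕ-skip : ∀ P {x} xs → P x ≡ false → firstℕ P (x ∷ xs) ≡ firstℕ P xs
  firstℕ-skip P {x} xs e rewrite firstℕ-maybe P (x ∷ xs) | firstℕ-maybe P xs | e = refl

  firstℕ-spec : (P : ℕ → Bool) (f : ℕ → ℕ) → ∀ N {r} → r < N → P (f r) ≡ true →
    ∃ λ s → s < N × firstℕ P (applyUpTo f N) ≡ f s × P (f s) ≡ true × (∀ {t} → t < s → P (f t) ≡ false)
  firstℕ-spec P f (suc N) {r} r<N pr = go r r<N pr (P (f 0)) refl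
    where
    go : ∀ r → r < suc N → P (f r) ≡ true → ∀ b → P (f 0) ≡ b → ∃ λ s → s < suc N ×
         firstℕ P (applyUpTo f (suc N)) ≡ f s × P (f s) ≡ true × (∀ {t} → t < s → P (f t) ≡ false)
    go r r<N pr true eq = 0 , s≤s z≤n , firstℕ-take P _ eq , eq , λ ()
    go zero r<N pr false eq = contradiction eq (true≢false pr)
    go (suc r) (s≤s r<N) pr false eq with firstℕ-spec P (f ∘ suc) N r<N pr
    ... | s , s<N , e , ps , min = suc s , s≤s s<N , trans (firstℕ-skip P _ eq) e , ps ,
            λ { {zero} _ → eq ; {suc t} (s≤s lt) → min lt }

  firstℕ-cong : {P Q : ℕ → Bool} → (∀ r → P r ≡ Q r) → ∀ xs → firstℕ P xs ≡ firstℕ Q xs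
  firstℕ-cong {P} {Q} h xs = trans (firstℕ-maybe P xs)
    (trans (cong (maybe′ id 0 ∘ head) (filterᵇ-cong h xs)) (sym (firstℕ-maybe Q xs)))

  module _ {n : ℕ} where

    -- Commutation lets `y^(u d)` pass through `g^σ`, so every return multiplies by the same `ε` and
    -- the same power of `g`.
    it-power : ∀ {y g : SP n} → Comm y g → ∀ {d σ ε p} → it y d p ≡ sg ε (it g σ p) → ∀ u →
               it y (u * d) p ≡ sg (par u ∧ ε) (it g (u * σ) p)
    it-power c e zero = refl
    it-power {y} {g} c {d} {σ} {ε} {p} e (suc u) = begin
      it y (d + u * d) p                            ≡⟨ it-+′ y d (u * d) p ⟩
      it y (u * d) (it y d p)                       ≡⟨ cong (it y (u * d)) e ⟩
      it y (u * d) (sg ε (it g σ p))                ≡⟨ it-sg y (u * d) ε (it g σ p) ⟩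
      sg ε (it y (u * d) (it g σ p))                ≡⟨ cong (sg ε) (it-it c (u * d) σ p) ⟩
      sg ε (it g σ (it y (u * d) p))
        ≡⟨ cong (λ q → sg ε (it g σ q)) (it-power {y} {g} c {d} {σ} {ε} {p} e u) ⟩
      sg ε (it g σ (sg (par u ∧ ε) (it g (u * σ) p))) ≡⟨ cong (sg ε) (it-sg g σ (par u ∧ ε) (it g (u * σ) p)) ⟩
      sg ε (sg (par u ∧ ε) (it g σ (it g (u * σ) p))) ≡⟨ sg-sg ε (par u ∧ ε) (it g σ (it g (u * σ) p)) ⟩
      sg (ε xor (par u ∧ ε)) (it g σ (it g (u * σ) p)) ≡⟨ cong₂ sg (xor-∧-step (par u) ε) (sym (it-+ g σ (u * σ) p)) ⟩
      sg (not (par u) ∧ ε) (it g (σ + u * σ) p)     ∎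
      where
      open ≡-Reasoning

    it-power-ix : ∀ {y g : SP n} → Comm y g → ∀ {d σ p} → ix (it y d p) ≡ ix (it g σ p) → ∀ u →
                  ix (it y (u * d) p) ≡ ix (it g (u * σ) p)
    it-power-ix {y} {g} c {d} {σ} {p} e u with ix≡⇒sg {p = it y d p} {q = it g σ p} e
    ... | b , e′ = cong ix (it-power c {ε = b} e′ u)

    -- The equality of points that ω can see. In class -1 (`true`) a point and its negative are told
    -- apart; in class +1 the factor Z_2 lies in the kernel of ω, so only absolute values count.
    Sim : Bool → Pt n → Pt n → Set
    Sim true p q = p ≡ q
    Sim false p q = ix p ≡ ix q

    Sim-reflexive : ∀ b {p q} → p ≡ q → Sim b p q
    Sim-reflexive true e = e
    Sim-reflexive false e = cong ix e

    Sim-sym : ∀ b {p q} → Sim b p q → Sim b q p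
    Sim-sym true = sym
    Sim-sym false = sym

    Sim-trans : ∀ b {p q r} → Sim b p q → Sim b q r → Sim b p r
    Sim-trans true = trans
    Sim-trans false = trans

    Sim⇒ix : ∀ b {p q} → Sim b p q → ix p ≡ ix q
    Sim⇒ix true = cong ix
    Sim⇒ix false e = e

    Sim-it : ∀ b (w : SP n) a {p q} → Sim b p q → Sim b (it w a p) (it w a q)
    Sim-it true w a = cong (it w a)
    Sim-it false w a = it-ix w a

    Sim-it-inj : ∀ b {w : SP n} → Perm w → ∀ a {p q} → Sim b (it w a p) (it w a q) → Sim b p q
    Sim-it-inj true hw a = it-inj hw a
    Sim-it-inj false hw a = it-ix-inj hw a

    Sim-power : ∀ b {y g : SP n} → Comm y g → ∀ {d σ p} → Sim b (it y d p) (it g σ p) → ∀ u →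
      Sim b (it y (u * d) p) (it g (u * σ) p)
    Sim-power true {y} {g} c {d} {σ} {p} e u = trans (it-power c {d} {σ} {false} {p} e u)
      (cong (λ b → sg b (it g (u * σ) p)) (∧-zeroʳ (par u)))
    Sim-power false c e u = it-power-ix c e u

    it-mul-ix : ∀ (w : SP n) {a p} → ix (it w a p) ≡ ix p → ∀ u → ix (it w (u * a) p) ≡ ix p
    it-mul-ix w {a} {p} e zero = refl
    it-mul-ix w {a} {p} e (suc u) = trans (cong ix (it-+ w a (u * a) p)) (trans (it-ix w a (it-mul-ix w {a} e u)) e)

    Comm-self : (w : SP n) → Comm w w
    Comm-self w p = refl

    ix? : (p q : Pt n) → Dec (ix p ≡ ix q)
    ix? p q = ix p Fin.≟ ix q

    opaque
      ix-period : ∀ {w : SP n} → Perm w → ∀ p → ∃ λ h → Per (λ a → ix (it w a p) ≡ ix p) h × h ≤ n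
      ix-period {w} hw p with ix-return hw p
      ... | N , N≤n , e with period {λ a → ix (it w a p) ≡ ix p} (λ a → ix? (it w a p) p) refl
            (λ {a} {b} ea eb → trans (cong ix (it-+ w a b p)) (trans (it-ix w a eb) ea))
            (λ {a} {b} eab ea → it-ix-inj hw a (trans (cong ix (sym (it-+ w a b p))) (trans eab (sym ea)))) {N} e
      ... | h , per , h≤ = h , per , ≤-trans h≤ N≤n

    opaque
      pt-period : ∀ {w : SP n} → Perm w → ∀ p → ∃ λ h → Per (λ a → it w a p ≡ p) h × h ≤ 2 * n
      pt-period {w} hw p with ix-return hw p
      ... | N , N≤n , e with ix≡⇒sg {p = it w (suc N) p} {q = p} e
      ... | b , e′ with period {λ a → it w a p ≡ p} (λ a → dec (it w a p)) refl
            (λ {a} {b} ea eb → trans (it-+ w a b p) (trans (cong (it w a) eb) ea))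
            (λ {a} {b} eab ea → it-inj hw a (trans (sym (it-+ w a b p)) (trans eab (sym ea))))
            -- `suc (N + suc N)` is twice the return time `suc N` on absolute values; the sign
            -- picked up by one return cancels after two.
            {N + suc N} (trans (it-+ w (suc N) (suc N) p)
              (trans (cong (it w (suc N)) e′) (trans (it-sg w (suc N) b p) (trans (cong (sg b) e′) (sg-invol b p)))))
        where
        dec : ∀ q → Dec (q ≡ p)
        dec q with eqPt q p in eq
        ... | true = yes (eqPt⁻ eq)
        ... | false = no (λ e → true≢false (eqPt⁺ e) eq)
      ... | h , per , h≤ = h , per , ≤-trans h≤ (≤-trans (+-mono-≤ N≤n N≤n)
        (≤-reflexive (cong (n +_) (sym (+-identityʳ n)))))

    opaque
      reduce : ∀ {w : SP n} {p h} → Per (λ a → it w a p ≡ p) h → ∀ r → ∃ λ s → s < h × it w s p ≡ it w r p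
      reduce {w} {p} {suc h} per r = r % suc h , m%n<n r (suc h) ,
        sym (trans (cong (λ m → it w m p) (m≡m%n+[m/n]*n r (suc h)))
          (trans (it-+ w (r % suc h) _ p) (cong (it w (r % suc h)) (from per (divides (r / suc h) refl)))))
      reduce {h = zero} per with () ← positive per

    opaque
      reduce-ix : ∀ {w : SP n} {p h} → Per (λ a → ix (it w a p) ≡ ix p) h → ∀ r → ∃ λ s →
        s < h × ix (it w s p) ≡ ix (it w r p)
      reduce-ix {w} {p} {suc h} per r = r % suc h , m%n<n r (suc h) ,
        sym (trans (cong (λ m → ix (it w m p)) (m≡m%n+[m/n]*n r (suc h)))
          (trans (cong ix (it-+ w (r % suc h) _ p)) (it-ix w (r % suc h) (from per (divides (r / suc h) refl)))))
      reduce-ix {h = zero} per with () ← positive per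

    -- The return times of `x` to the `y`-cycle of `p`, up to sign. Both orders of the two
    -- permutations occur: `Link g w` for `expG`, and `Link w g` for the first return `d` of a
    -- `Member`.
    record Link (x y : SP n) (p : Pt n) (a : ℕ) : Set where
      constructor link
      field
        steps : ℕ
        meets : ix (it x a p) ≡ ix (it y steps p)

    module LinkPeriod {x y : SP n} (hx : Perm x) (hy : Perm y) (c : Comm x y) (p : Pt n) where
      open ≡-Reasoning

      link? : ∀ {h} → Per (λ a → ix (it y a p) ≡ ix p) h → ∀ a → Dec (Link x y p a)
      link? {h} per a with anyUpTo? (λ b → ix? (it x a p) (it y b p)) h
      ... | yes (b , _ , eb) = yes (link b eb)
      ... | no ¬b = no λ { (link b eb) → let (s , s< , es) = reduce-ix per b in ¬b (s , s< , trans eb (sym es)) }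

      link-+ : ∀ {a a′} → Link x y p a → Link x y p a′ → Link x y p (a + a′)
      link-+ {a} {a′} (link b eb) (link b′ eb′) = link (b′ + b) (begin
        ix (it x (a + a′) p)          ≡⟨ cong ix (it-+ x a a′ p) ⟩
        ix (it x a (it x a′ p))       ≡⟨ it-ix x a eb′ ⟩
        ix (it x a (it y b′ p))       ≡⟨ cong ix (it-it c a b′ p) ⟩
        ix (it y b′ (it x a p))       ≡⟨ it-ix y b′ eb ⟩
        ix (it y b′ (it y b p))       ≡⟨ cong ix (it-+ y b′ b p) ⟨
        ix (it y (b′ + b) p)          ∎)

      -- The inverse of `y^b′` is replaced by `y^(h * b′)`: as `suc h` is a return time at `y^b p`,
      -- the `b′ + h * b′ = b′ * suc h` steps together bring this point back up to sign.
      link-cancel : ∀ a a′ b b′ h → ix (it x (a + a′) p) ≡ ix (it y b p) → ix (it x a p) ≡ ix (it y b′ p) →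
                    ix (it y (suc h) (it y b p)) ≡ ix (it y b p) → ix (it x a′ p) ≡ ix (it y (h * b′ + b) p)
      link-cancel a a′ b b′ h eb eb′ eh = it-ix-inj hy b′ (begin
        ix (it y b′ (it x a′ p))             ≡⟨ cong ix (it-it (Comm-sym {w = x} {v = y} c) b′ a′ p) ⟩
        ix (it x a′ (it y b′ p))             ≡⟨ it-ix x a′ eb′ ⟨
        ix (it x a′ (it x a p))              ≡⟨ cong ix (it-+′ x a a′ p) ⟨
        ix (it x (a + a′) p)                 ≡⟨ eb ⟩
        ix (it y b p)                        ≡⟨ it-mul-ix y {suc h} {it y b p} eh b′ ⟨
        ix (it y (b′ * suc h) (it y b p))    ≡⟨ cong (λ m → ix (it y m (it y b p))) (*-comm b′ (suc h)) ⟩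
        ix (it y (b′ + h * b′) (it y b p))   ≡⟨ cong ix (it-+ y b′ (h * b′) (it y b p)) ⟩
        ix (it y b′ (it y (h * b′) (it y b p))) ≡⟨ it-ix y b′ (cong ix (it-+ y (h * b′) b p)) ⟨
        ix (it y b′ (it y (h * b′ + b) p))   ∎)

      link-sub : ∀ {a a′} → Link x y p (a + a′) → Link x y p a → Link x y p a′
      link-sub {a} {a′} (link b eb) (link b′ eb′) = let (h , _ , eh) = ix-return hy (it y b p) in
        link (h * b′ + b) (link-cancel a a′ b b′ h eb eb′ eh)

      opaque
        link-period : ∃ λ e → Per (Link x y p) e × e ≤ n
        link-period = let (N , N≤n , e) = ix-return hx p
                          (e′ , per , e≤) = period {Link x y p} (link? (proj₁ (proj₂ (ix-period hy p)))) (link 0 refl)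
                                              (λ {a} {a′} → link-+ {a} {a′}) (λ {a} {a′} → link-sub {a} {a′}) {N}
                                                (link 0 e)
                      in e′ , per , ≤-trans e≤ N≤n

    open LinkPeriod using (link-period) public

open Periods

-- Length, class and return exponents of a cycle.

module Cycles where
  open import Function using (id)
  open import Data.Bool using (Bool; true; false; _∧_; if_then_else_)
  open import Data.Bool.Properties using (xor-comm; ∧-identityʳ)
  open import Data.Bool.ListAction using (any)
  open import Data.Nat using (zero; suc; _+_; _*_; z≤n; s≤s; ⌊_/2⌋)
  open import Data.Nat.Properties
  open import Data.Nat.Divisibility
  open import Data.Fin using (Fin)
  open import Data.Product using (_,_; proj₁; proj₂; ∃)
  open import Data.List using (upTo; applyUpTo)
  open import Data.List.Properties using (map-upTo)
  open import Data.List.Membership.Propositional.Properties using (∈-upTo⁺; ∈-map⁺; ∈-map⁻)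
  open import Relation.Binary.PropositionalEquality hiding (setoid)
  open import Relation.Nullary using (¬_)
  import Data.Fin as Fin

  module _ {n : ℕ} where

    inOrbit⁺ : {w : SP n} → Perm w → ∀ {p q} r → it w r p ≡ q → inOrbit w p q ≡ true
    inOrbit⁺ {w} hw {p} {q} r e =
      let (h , per , h≤) = pt-period hw p
          (s , s<h , es) = reduce per r
      in any⁺ (eqPt q) {xs = orbit w p} {x = iterP w s p}
        (∈-map⁺ (λ r → iterP w r p) {x = s} {xs = upTo (2 * n)} (∈-upTo⁺ {n = 2 * n} {i = s} (<-≤-trans s<h h≤)))
        (eqPt⁺ {p = q} {q = iterP w s p} (sym (trans (iterP≡it w s p) (trans es e))))

    inOrbit⁻ : {w : SP n} → ∀ {p q} → inOrbit w p q ≡ true → ∃ λ r → it w r p ≡ q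
    inOrbit⁻ {w} {p} {q} h with any⁻ (eqPt q) (orbit w p) h
    ... | z , z∈ , e with ∈-map⁻ (λ r → iterP w r p) z∈
    ... | r , _ , e′ = r , trans (sym (iterP≡it w r p)) (trans (sym e′) (sym (eqPt⁻ e)))

    -- The search through 1, ..., 2n succeeds because the period on signed points is at most
    -- `2 * n`.
    orbitLen-Per : {w : SP n} → Perm w → ∀ p → Per (λ a → it w a p ≡ p) (orbitLen w p)
    orbitLen-Per {w} hw p = go (pt-period hw p)
      where
      test : ℕ → Bool
      test r = eqPt (iterP w r p) p
      go : (∃ λ h → Per (λ a → it w a p ≡ p) h × h ≤ 2 * n) → Per (λ a → it w a p ≡ p) (orbitLen w p)
      go (zero , per , _) with () ← positive per
      go (suc h , per , h≤) with firstℕ-spec test suc (2 * n) {h} h≤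
        (eqPt⁺ (trans (iterP≡it w (suc h) p) (from per ∣-refl)))
      ... | s , _ , e , t , min = subst (Per (λ a → it w a p ≡ p))
        (sym (trans (cong (firstℕ test) (map-upTo suc (2 * n))) e))
            (Per-via (s≤s z≤n) (trans (sym (iterP≡it w (suc s) p)) (eqPt⁻ t))
              (λ { {suc a} _ (s≤s a<s) ea → true≢false (eqPt⁺ (trans (iterP≡it w (suc a) p) ea)) (min a<s) })
                (suc h , per))

    opaque
      minus : SP n → Fin n → Bool
      minus = isMinus

      minus≡isMinus : ∀ w i → minus w i ≡ isMinus w i
      minus≡isMinus w i = refl

      clen : SP n → Fin n → ℕ
      clen = cycLen

      clen≡cycLen : ∀ w i → clen w i ≡ cycLen w i
      clen≡cycLen w i = refl

      clen-minus : ∀ w i {m} → minus w i ≡ m → clen w i ≡ (if m then ⌊ orbitLen w (pos i) /2⌋ else orbitLen w (pos i))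
      clen-minus w i e = cong (λ m → if m then ⌊ orbitLen w (pos i) /2⌋ else orbitLen w (pos i)) e

    module _ {w : SP n} (hw : Perm w) (i : Fin n) where

      minus⁺ : ∀ r → it w r (pos i) ≡ sg true (pos i) → minus w i ≡ true
      minus⁺ r e = trans (minus≡isMinus w i) (inOrbit⁺ hw r e)

      minus⁻ : minus w i ≡ true → ∃ λ r → it w r (pos i) ≡ sg true (pos i)
      minus⁻ e = inOrbit⁻ (trans (sym (minus≡isMinus w i)) e)

      private
        CycleData : ℕ → Set
        CycleData h = Per (λ a → ix (it w a (pos i)) ≡ i) h × h ≤ n × it w h (pos i) ≡ sg (minus w i) (pos i)

        opaque
          -- Both classes at once: `h` is the period on absolute values and `b` the sign with which
          -- `w^h` returns. The period on signed points is then `h` or `2 * h`, which is the reason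
          -- for the halving in `cycLen`.
          cycle-data : CycleData (clen w i)
          cycle-data with ix-period hw (pos i)
          ... | h , per , h≤n with ix≡⇒sg {p = it w h (pos i)} {q = pos i} (from per ∣-refl)
          ... | b , e = subst CycleData (sym (len (minus w i) refl))
            (per , h≤n , trans e (cong (λ c → sg c (pos i)) (sign b e)))
            where
            sign : ∀ b → it w h (pos i) ≡ sg b (pos i) → b ≡ minus w i
            sign true e = sym (minus⁺ h e)
            -- If `w^h` fixes `pos i`, any time at which the negative of `pos i` were reached would
            -- be a multiple of `h`, and at such a time `pos i` itself is reached.
            sign false e = sym (¬true⇒false λ m → plus (minus⁻ m))
              where
              plus : ¬ (∃ λ r → it w r (pos i) ≡ sg true (pos i))
              plus (r , er) with to per {r} (cong ix er)
              ... | divides u refl with () ← trans (sym er) (it-mul w {h} e u)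
            period-plus : minus w i ≡ false → Per (λ a → it w a (pos i) ≡ pos i) h
            period-plus m = record { positive = positive per ; to = λ ea →
              to per (cong ix ea) ; from = λ { (divides u refl) → it-mul w ret u } }
              where
              ret : it w h (pos i) ≡ pos i
              ret = trans e (cong (λ c → sg c (pos i)) (trans (sign b e) m))
            period-minus : minus w i ≡ true → Per (λ a → it w a (pos i) ≡ pos i) (2 * h)
            period-minus m = record
              { positive = <-≤-trans (positive per) (m≤m+n h (h + 0)) ; to = to′
              ; from = λ { (divides u refl) → it-mul w (trans (power 2) refl) u } }
              where
              power : ∀ u → it w (u * h) (pos i) ≡ sg (par u) (pos i)
              power zero = refl
              power (suc u) = trans (it-+ w h (u * h) (pos i))
                (trans (cong (it w h) (power u)) (trans (it-sg w h (par u) (pos i))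
                (trans (cong (sg (par u)) (trans e (cong (λ c → sg c (pos i)) (trans (sign b e) m))))
                  (trans (sg-sg (par u) true (pos i)) (cong (λ c → sg c (pos i)) (xor-comm (par u) true))))))
              to′ : ∀ {a} → it w a (pos i) ≡ pos i → 2 * h ∣ a
              to′ {a} ea with to per {a} (cong ix ea)
              ... | divides u refl = *-monoˡ-∣ h (even⇒2∣ u
                (sg-fix {a = par u} {p = pos i} (trans (sym (power u)) ea)))
            len : ∀ m → minus w i ≡ m → clen w i ≡ h
            len false eq = trans (clen-minus w i eq) (Per-unique (orbitLen-Per hw (pos i)) (period-plus eq))
            len true eq = trans (clen-minus w i eq) (trans
              (cong ⌊_/2⌋ (trans (Per-unique (orbitLen-Per hw (pos i)) (period-minus eq))
              (cong (h +_) (+-identityʳ h)))) (sym (n≡⌊n+n/2⌋ h)))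

      clen-Per : Per (λ a → ix (it w a (pos i)) ≡ i) (clen w i)
      clen-Per = proj₁ cycle-data

      clen≤n : clen w i ≤ n
      clen≤n = proj₁ (proj₂ cycle-data)

      it-clen : it w (clen w i) (pos i) ≡ sg (minus w i) (pos i)
      it-clen = proj₂ (proj₂ cycle-data)

      it-clen-mul : ∀ u → it w (u * clen w i) (pos i) ≡ sg (par u ∧ minus w i) (pos i)
      it-clen-mul u = trans (it-power (Comm-self w) {σ = 0} {ε = minus w i} it-clen u)
        (cong (λ m → sg (par u ∧ minus w i) (it w m (pos i))) (*-zeroʳ u))

      Sim-period-minus : minus w i ≡ true → ∀ {a} → it w a (pos i) ≡ pos i → 2 * clen w i ∣ a
      Sim-period-minus m {a} ea with to clen-Per {a} (cong ix ea)
      ... | divides u refl = *-monoˡ-∣ (clen w i) (even⇒2∣ u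
        (trans (sym (∧-identityʳ (par u))) (trans (cong (par u ∧_) (sym m))
              (sg-fix {a = par u ∧ minus w i} {p = pos i} (trans (sym (it-clen-mul u)) ea)))))

    simᵇ : Bool → Pt n → Pt n → Bool
    simᵇ b p q = if b then eqPt p q else eqFin (ix p) (ix q)

    simᵇ⁺ : ∀ b {p q} → Sim b p q → simᵇ b p q ≡ true
    simᵇ⁺ true = eqPt⁺
    simᵇ⁺ false = eqFin⁺

    simᵇ⁻ : ∀ b {p q} → simᵇ b p q ≡ true → Sim b p q
    simᵇ⁻ true = eqPt⁻
    simᵇ⁻ false = eqFin⁻

    linkᵇ : SP n → SP n → Fin n → ℕ → Bool
    linkᵇ w g i e = any (λ b → eqFin (ix (it g e (pos i))) (ix (it w b (pos i)))) (upTo n)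

    -- The block of i contributes ζ^(expW w g i) to ω^w(g): g^(expG w g i) is the first positive power of g
    -- mapping the w-cycle of i to itself, and it moves i as w^(expW w g i) does.
    opaque
      expG : SP n → SP n → Fin n → ℕ
      expG w g i = firstℕ (linkᵇ w g i) (applyUpTo suc n)

      expG-def : ∀ w g i → expG w g i ≡ firstℕ (linkᵇ w g i) (applyUpTo suc n)
      expG-def w g i = refl

      expW : SP n → SP n → Fin n → ℕ
      expW w g i = firstℕ (λ r → simᵇ (minus w i) (it w r (pos i)) (it g (expG w g i) (pos i))) (upTo (2 * n))

      expW-def : ∀ w g i → expW w g i ≡ firstℕ (λ r → simᵇ (minus w i) (it w r (pos i)) (it g (expG w g i) (pos i)))
        (upTo (2 * n))
      expW-def w g i = refl

    module _ {w g : SP n} (hw : Perm w) (hg : Perm g) (c : Comm w g) (i : Fin n) where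

      private
        linkᵇ⁺ : ∀ {e} → Link g w (pos i) e → linkᵇ w g i e ≡ true
        linkᵇ⁺ {e} (link b eb) = let (s , s< , es) = reduce-ix {w = w} {p = pos i} {h = clen w i} (clen-Per hw i) b in
          any⁺ (λ b → eqFin (ix (it g e (pos i))) (ix (it w b (pos i)))) {xs = upTo n} {x = s}
            (∈-upTo⁺ {n = n} {i = s} (<-≤-trans {s} {clen w i} {n} s< (clen≤n hw i)))
              (eqFin⁺ {i = ix (it g e (pos i))} {j = ix (it w s (pos i))} (trans eb (sym es)))

        linkᵇ⁻ : ∀ {e} → linkᵇ w g i e ≡ true → Link g w (pos i) e
        linkᵇ⁻ {e} h = let (b , _ , eb) = any⁻ (λ b → eqFin (ix (it g e (pos i))) (ix (it w b (pos i)))) (upTo n) h in link b (eqFin⁻ eb)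

      opaque
        expG-Per : Per (Link g w (pos i)) (expG w g i)
        expG-Per = go (link-period hg hw (Comm-sym {w = w} {v = g} c) (pos i))
          where
          go : (∃ λ e → Per (Link g w (pos i)) e × e ≤ n) → Per (Link g w (pos i)) (expG w g i)
          go (zero , per , _) with () ← positive per
          go (suc e , per , e≤) with firstℕ-spec (linkᵇ w g i) suc n {e} e≤ (linkᵇ⁺ {suc e} (from per ∣-refl))
          ... | s , _ , eq , t , min = subst (Per (Link g w (pos i))) (sym (trans (expG-def w g i) eq))
                (Per-via (s≤s z≤n) (linkᵇ⁻ {suc s} t) (λ
                  { {suc a} _ (s≤s a<s) ea → true≢false (linkᵇ⁺ {suc a} ea) (min a<s) }) (suc e , per))

      opaque
        -- A link gives agreement up to sign only. In class +1 this is all that `Sim` asks; in class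
        -- -1 a wrong sign is repaired by first travelling along the `w`-cycle from `pos i` to its
        -- negative.
        expW-Sim : Sim (minus w i) (it w (expW w g i) (pos i)) (it g (expG w g i) (pos i))
        expW-Sim = go (minus w i) refl (from expG-Per ∣-refl)
          where
          test : ℕ → Bool
          test r = simᵇ (minus w i) (it w r (pos i)) (it g (expG w g i) (pos i))
          found : ∀ r → Sim (minus w i) (it w r (pos i)) (it g (expG w g i) (pos i)) →
                  Sim (minus w i) (it w (expW w g i) (pos i)) (it g (expG w g i) (pos i))
          found r sim with pt-period hw (pos i)
          ... | h , per , h≤ with reduce per r
          ... | s , s< , es with firstℕ-spec test id (2 * n) {s} (<-≤-trans s< h≤)
            (simᵇ⁺ (minus w i) {it w s (pos i)} {it g (expG w g i) (pos i)}
            (Sim-trans (minus w i) (Sim-reflexive (minus w i) es) sim))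
          ... | t , _ , eq , pt , _ = subst (λ m → Sim (minus w i) (it w m (pos i)) (it g (expG w g i) (pos i)))
            (sym (trans (expW-def w g i) eq)) (simᵇ⁻ (minus w i) {it w t (pos i)} {it g (expG w g i) (pos i)} pt)
          go : ∀ b → minus w i ≡ b → Link g w (pos i) (expG w g i) →
               Sim (minus w i) (it w (expW w g i) (pos i)) (it g (expG w g i) (pos i))
          go false eq (link b eb) = found b (subst (λ m → Sim m (it w b (pos i)) (it g (expG w g i) (pos i))) (sym eq)
            (sym eb))
          go true eq (link b eb) with ix≡⇒sg {p = it g (expG w g i) (pos i)} {q = it w b (pos i)} eb
          ... | false , e′ = found b (Sim-reflexive (minus w i) (sym e′))
          ... | true , e′ with minus⁻ hw i eq
          ... | r , er = found (b + r) (Sim-reflexive (minus w i)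
            (trans (it-+ w b r (pos i)) (trans (cong (it w b) er) (trans (it-sg w b true (pos i)) (sym e′)))))

    -- Only the orbits of the two starting points under each permutation are compared, not the
    -- actions as a whole. Hence it covers both conjugation and `off-transport`, where `w` is
    -- altered outside the block of `i`.
    record Transport (w g w′ g′ : SP n) (i i′ : Fin n) : Set where
      field
        v : Pt n → Pt n
        v-inj : ∀ {p q} → v p ≡ v q → p ≡ q
        v-ix : ∀ {p q} → ix p ≡ ix q → ix (v p) ≡ ix (v q)
        v-ix-inj : ∀ {p q} → ix (v p) ≡ ix (v q) → ix p ≡ ix q
        v-neg : ∀ p → v (sg true p) ≡ sg true (v p)
        it-w : ∀ r → it w′ r (pos i′) ≡ v (it w r (pos i))
        it-g : ∀ r → it g′ r (pos i′) ≡ v (it g r (pos i))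

    module Transported {w g w′ g′ : SP n} {i i′ : Fin n} (hw : Perm w) (hw′ : Perm w′) (hg : Perm g) (hg′ : Perm g′)
      (c : Comm w g) (c′ : Comm w′ g′) (t : Transport w g w′ g′ i i′) where
      open Transport t

      minus-≡ : minus w i ≡ minus w′ i′
      minus-≡ = bool-ext
        (λ m → let (r , er) = minus⁻ hw i m in minus⁺ hw′ i′ r (trans (it-w r) (trans (cong v er) (trans (v-neg (pos i)) (cong (sg true) (sym (it-w 0)))))))
        (λ m → let (r , er) = minus⁻ hw′ i′ m in minus⁺ hw i r (v-inj (trans (sym (it-w r)) (trans er (trans (cong (sg true) (it-w 0)) (sym (v-neg (pos i))))))))

      clen-≡ : clen w i ≡ clen w′ i′
      clen-≡ = Per-unique (clen-Per hw i) record
        { positive = positive (clen-Per hw′ i′)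
        ; to = λ {a} e → to (clen-Per hw′ i′) (trans (cong ix (it-w a))
          (trans (v-ix {q = pos i} e) (cong ix (sym (it-w 0)))))
        ; from = λ {a} d → v-ix-inj {q = pos i} (trans (cong ix (sym (it-w a)))
          (trans (from (clen-Per hw′ i′) d) (cong ix (it-w 0)))) }

      expG-≡ : expG w g i ≡ expG w′ g′ i′
      expG-≡ = Per-unique (expG-Per hw hg c i) record
        { positive = positive (expG-Per hw′ hg′ c′ i′)
        ; to = λ { {a} (link b e) → to (expG-Per hw′ hg′ c′ i′)
          (link b (trans (cong ix (it-g a)) (trans (v-ix e) (cong ix (sym (it-w b)))))) }
        ; from = λ {a} d → let (link b e) = from (expG-Per hw′ hg′ c′ i′) d in
            link b (v-ix-inj (trans (cong ix (sym (it-g a))) (trans e (cong ix (it-w b))))) }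

      simᵇ-v : ∀ b p q → simᵇ b p q ≡ simᵇ b (v p) (v q)
      simᵇ-v true p q = bool-ext (λ e → eqPt⁺ (cong v (eqPt⁻ e))) (λ e → eqPt⁺ (v-inj (eqPt⁻ e)))
      simᵇ-v false p q = bool-ext (λ e → eqFin⁺ (v-ix {p = p} {q = q} (eqFin⁻ e)))
        (λ e → eqFin⁺ (v-ix-inj {p = p} {q = q} (eqFin⁻ e)))

      -- An equality and not merely a congruence: the two searches run through the same list with
      -- tests that agree term by term, so the least solutions coincide.
      expW-≡ : expW w g i ≡ expW w′ g′ i′
      expW-≡ = trans (expW-def w g i) (trans (firstℕ-cong (λ r → trans (simᵇ-v (minus w i) _ _)
        (trans (cong₂ (simᵇ (minus w i)) (sym (it-w r)) (sym (it-g (expG w g i))))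
               (cong₂ (λ m e → simᵇ m (it w′ r (pos i′)) (it g′ e (pos i′))) minus-≡ expG-≡))) (upTo (2 * n)))
                 (sym (expW-def w′ g′ i′)))

open Cycles

-- Roots of unity in a field.

module FieldSums where
  open import Data.Bool using (Bool; true; false; _∧_; _xor_; if_then_else_)
  open import Data.Nat using (zero; suc; z≤n; s≤s; _%_; _/_)
  import Data.Nat as ℕ
  import Data.Nat.Properties as ℕP
  open import Data.Nat.Divisibility
  open import Data.Nat.DivMod using (m≡m%n+[m/n]*n; m%n<n)
  open import Data.Nat.GCD using (gcd; module Bézout; gcd-GCD)
  open import Data.Fin using (Fin)
  open import Data.Product using (_,_; proj₁; proj₂; ∃)
  open import Data.Sum using (inj₁; inj₂)
  open import Data.List using (List; []; _∷_; length)
  open import Data.List.Relation.Unary.Any using (here; there)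
  open import Data.List.Relation.Unary.All using (All; []; _∷_)
  open import Data.List.Relation.Unary.AllPairs using (AllPairs; []; _∷_)
  open import Relation.Binary.PropositionalEquality as ≡ using (_≡_)
  open import Relation.Nullary using (contradiction; ¬_)
  import Relation.Binary.Reasoning.Setoid as SetoidReasoning
  import Algebra.Properties.CommutativeSemigroup as CSProps
  import Algebra.Properties.Ring as RingProps

  module FieldLemmas {c ℓ} (F : Field' c ℓ) where
    open Field' F public
    open FieldOps F public
    open SetoidReasoning setoid
    open RingProps ring public using (-‿distribˡ-*; -‿distribʳ-*; -‿involutive; -1*x≈-x; x[y-z]≈xy-xz; [y-z]x≈yx-zx)
    module Sum = Big +-commutativeMonoid
    module Prod = Big *-commutativeMonoid
    open CSProps *-commutativeSemigroup public using () renaming (interchange to *-interchange; x∙yz≈y∙xz to x*[y*z]≈y*[x*z]; xy∙z≈xz∙y to xy*z≈xz*y)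
    open CSProps +-commutativeSemigroup public using () renaming (interchange to +-interchange; x∙yz≈y∙xz to x+[y+z]≈y+[x+z])

    +-cancelˡ : ∀ x {y z} → x + y ≈ x + z → y ≈ z
    +-cancelˡ x {y} {z} e = begin
      y             ≈⟨ +-identityˡ y ⟨
      0# + y        ≈⟨ +-congʳ (-‿inverseˡ x) ⟨
      - x + x + y   ≈⟨ +-assoc (- x) x y ⟩
      - x + (x + y) ≈⟨ +-congˡ e ⟩
      - x + (x + z) ≈⟨ +-assoc (- x) x z ⟨
      - x + x + z   ≈⟨ +-congʳ (-‿inverseˡ x) ⟩
      0# + z        ≈⟨ +-identityˡ z ⟩
      z             ∎

    x-y≈0⇒x≈y : ∀ {x y} → x - y ≈ 0# → x ≈ y
    x-y≈0⇒x≈y {x} {y} e = begin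
      x             ≈⟨ +-identityʳ x ⟨
      x + 0#        ≈⟨ +-congˡ (-‿inverseˡ y) ⟨
      x + (- y + y) ≈⟨ +-assoc x (- y) y ⟨
      x - y + y     ≈⟨ +-congʳ e ⟩
      0# + y        ≈⟨ +-identityˡ y ⟩
      y             ∎

    *-cancelˡ-unit : ∀ {u} v {x y} → v * u ≈ 1# → u * x ≈ u * y → x ≈ y
    *-cancelˡ-unit {u} v {x} {y} inverse e = begin
      x           ≈⟨ *-identityˡ x ⟨
      1# * x      ≈⟨ *-congʳ inverse ⟨
      v * u * x   ≈⟨ *-assoc v u x ⟩
      v * (u * x) ≈⟨ *-congˡ e ⟩
      v * (u * y) ≈⟨ *-assoc v u y ⟨
      v * u * y   ≈⟨ *-congʳ inverse ⟩
      1# * y      ≈⟨ *-identityˡ y ⟩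
      y           ∎

    *-cancelˡ : ∀ {u x y} → ¬ (u ≈ 0#) → u * x ≈ u * y → x ≈ y
    *-cancelˡ {u} u≉0 = *-cancelˡ-unit (u ⁻¹) (trans (*-comm _ _) (⁻¹-inverse u u≉0))

    powK-cong : ∀ {x y} m → x ≈ y → powK x m ≈ powK y m
    powK-cong zero e = refl
    powK-cong (suc m) e = *-cong e (powK-cong m e)

    powK-+ : ∀ x m k → powK x (m ℕ.+ k) ≈ powK x m * powK x k
    powK-+ x zero k = sym (*-identityˡ _)
    powK-+ x (suc m) k = trans (*-congˡ (powK-+ x m k)) (sym (*-assoc _ _ _))

    powK-one : ∀ m → powK 1# m ≈ 1#
    powK-one zero = refl
    powK-one (suc m) = trans (*-identityˡ _) (powK-one m)

    powK-* : ∀ x m k → powK x (k ℕ.* m) ≈ powK (powK x m) k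
    powK-* x m zero = refl
    powK-* x m (suc k) = trans (powK-+ x m (k ℕ.* m)) (*-congˡ (powK-* x m k))

    powK-distrib : ∀ x y m → powK (x * y) m ≈ powK x m * powK y m
    powK-distrib x y zero = sym (*-identityˡ _)
    powK-distrib x y (suc m) = trans (*-congˡ (powK-distrib x y m)) (*-interchange _ _ _ _)

    powK-mul : ∀ {x m} → powK x m ≈ 1# → ∀ k → powK x (k ℕ.* m) ≈ 1#
    powK-mul {x} {m} e k = trans (powK-* x m k) (trans (powK-cong k e) (powK-one k))

    powK-gcd : ∀ {x} a b → powK x a ≈ 1# → powK x b ≈ 1# → powK x (gcd a b) ≈ 1#
    powK-gcd {x} a b ea eb with Bézout.identity (gcd-GCD a b)
    ... | Bézout.+- s t e = begin
      powK x (gcd a b)                        ≈⟨ *-identityʳ _ ⟨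
      powK x (gcd a b) * 1#                   ≈⟨ *-congˡ (powK-mul eb t) ⟨
      powK x (gcd a b) * powK x (t ℕ.* b)     ≈⟨ powK-+ x (gcd a b) (t ℕ.* b) ⟨
      powK x (gcd a b ℕ.+ t ℕ.* b)            ≡⟨ ≡.cong (powK x) e ⟩
      powK x (s ℕ.* a)                        ≈⟨ powK-mul ea s ⟩
      1#                                      ∎
    ... | Bézout.-+ s t e = begin
      powK x (gcd a b)                        ≈⟨ *-identityʳ _ ⟨
      powK x (gcd a b) * 1#                   ≈⟨ *-congˡ (powK-mul ea s) ⟨
      powK x (gcd a b) * powK x (s ℕ.* a)     ≈⟨ powK-+ x (gcd a b) (s ℕ.* a) ⟨
      powK x (gcd a b ℕ.+ s ℕ.* a)            ≡⟨ ≡.cong (powK x) e ⟩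
      powK x (t ℕ.* b)                        ≈⟨ powK-mul eb t ⟩
      1#                                      ∎

    PrimRoot-Per : ∀ {m x} → 1 ≤ m → PrimRoot m x → ∀ {a} → powK x a ≈ 1# → m ∣ a
    PrimRoot-Per {suc m} {x} _ (e , min) {a} ea with a % suc m in eq | m%n<n a (suc m)
    ... | zero | _ = m%n≡0⇒n∣m a (suc m) eq
    ... | suc r | r<m = contradiction rem (min (suc r) (s≤s z≤n) r<m)
      where
      rem : powK x (suc r) ≈ 1#
      rem = begin
        powK x (suc r)                                             ≈⟨ *-identityʳ _ ⟨
        powK x (suc r) * 1#                                        ≈⟨ *-congˡ (powK-mul e (a / suc m)) ⟨
        powK x (suc r) * powK x ((a / suc m) ℕ.* suc m)            ≈⟨ powK-+ x (suc r) _ ⟨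
        powK x (suc r ℕ.+ (a / suc m) ℕ.* suc m)
          ≡⟨ ≡.cong (λ z → powK x (z ℕ.+ (a / suc m) ℕ.* suc m)) eq ⟨
        powK x (a % suc m ℕ.+ (a / suc m) ℕ.* suc m)               ≡⟨ ≡.cong (powK x) (m≡m%n+[m/n]*n a (suc m)) ⟨
        powK x a                                                   ≈⟨ ea ⟩
        1#                                                         ∎

    -- hsym m L is the complete homogeneous symmetric polynomial h_m(L).
    -- As (a - b) h_m(a, b, L) = h_(m+1)(a, L) - h_(m+1)(b, L), iterated divided differences of x ↦ x^q
    -- show that the h_m of lower degree vanish at distinct q-th roots of unity.
    hsym : ℕ → List Carrier → Carrier
    hsym zero L = 1#
    hsym (suc m) [] = 0#
    hsym (suc m) (a ∷ L) = hsym (suc m) L + a * hsym m (a ∷ L)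

    -- The recursion treats the first variable specially, so symmetry needs an argument. `core` is
    -- the divided difference `(a - b) h_m(a,b,L) = a h_m(a,L) - b h_m(b,L)` written without
    -- subtraction; the two statements are proved by a common induction on the degree.
    hsym-swap : ∀ m a b L → hsym m (a ∷ b ∷ L) ≈ hsym m (b ∷ a ∷ L)
    hsym-swap zero a b L = refl
    hsym-swap (suc m) a b L = begin
      H + b * Hb + a * X        ≈⟨ +-assoc _ _ _ ⟩
      H + (b * Hb + a * X)      ≈⟨ +-congˡ (core m) ⟩
      H + (a * Ha + b * X)      ≈⟨ +-congˡ (+-congˡ (*-congˡ (hsym-swap m a b L))) ⟩
      H + (a * Ha + b * hsym m (b ∷ a ∷ L)) ≈⟨ +-assoc _ _ _ ⟨
      H + a * Ha + b * hsym m (b ∷ a ∷ L)   ∎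
      where
      H Ha Hb X : Carrier
      H = hsym (suc m) L
      Ha = hsym m (a ∷ L)
      Hb = hsym m (b ∷ L)
      X = hsym m (a ∷ b ∷ L)
      core : ∀ m → b * hsym m (b ∷ L) + a * hsym m (a ∷ b ∷ L) ≈ a * hsym m (a ∷ L) + b * hsym m (a ∷ b ∷ L)
      core zero = +-comm _ _
      core (suc m) = +-cancelˡ (b * (a * Y)) (begin
        b * (a * Y) + (b * Hb′ + a * X′)  ≈⟨ +-assoc _ _ _ ⟨
        b * (a * Y) + b * Hb′ + a * X′    ≈⟨ +-congʳ (trans (+-comm _ _) (sym (distribˡ b _ _))) ⟩
        b * X′ + a * X′                   ≈⟨ +-comm _ _ ⟩
        a * X′ + b * X′                   ≈⟨ +-congʳ (*-congˡ (hsym-swap (suc m) a b L)) ⟩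
        a * (Ha′ + b * Y′) + b * X′       ≈⟨ +-congʳ (trans (distribˡ a _ _) (+-comm _ _)) ⟩
        a * (b * Y′) + a * Ha′ + b * X′   ≈⟨ +-congʳ
          (+-congʳ (trans (x*[y*z]≈y*[x*z] a b Y′) (*-congˡ (*-congˡ (sym (hsym-swap m a b L)))))) ⟩
        b * (a * Y) + a * Ha′ + b * X′    ≈⟨ +-assoc _ _ _ ⟩
        b * (a * Y) + (a * Ha′ + b * X′)  ∎)
        where
        Y Y′ Ha′ Hb′ X′ : Carrier
        Y = hsym m (a ∷ b ∷ L)
        Y′ = hsym m (b ∷ a ∷ L)
        Ha′ = hsym (suc m) (a ∷ L)
        Hb′ = hsym (suc m) (b ∷ L)
        X′ = hsym (suc m) (a ∷ b ∷ L)

    hsym-divided : ∀ m a b L → hsym (suc m) (a ∷ L) ≈ hsym (suc m) (b ∷ L) → ¬ (a ≈ b) → hsym m (a ∷ b ∷ L) ≈ 0#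
    hsym-divided m a b L e a≉b = *-cancelˡ {a - b} (λ z → a≉b (x-y≈0⇒x≈y z)) (begin
      (a - b) * X     ≈⟨ [y-z]x≈yx-zx X a b ⟩
      a * X - b * X   ≈⟨ +-congʳ same ⟩
      b * X - b * X   ≈⟨ -‿inverseʳ _ ⟩
      0#              ≈⟨ zeroʳ _ ⟨
      (a - b) * 0#    ∎)
      where
      X = hsym m (a ∷ b ∷ L)
      same : a * X ≈ b * X
      same = +-cancelˡ (hsym (suc m) (b ∷ L)) (begin
        hsym (suc m) (b ∷ L) + a * X                    ≈⟨ hsym-swap (suc m) a b L ⟩
        hsym (suc m) (a ∷ L) + b * hsym m (b ∷ a ∷ L)   ≈⟨ +-cong e (*-congˡ (sym (hsym-swap m a b L))) ⟩
        hsym (suc m) (b ∷ L) + b * X                    ∎)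

    hsym-one : ∀ L → hsym 1 L ≈ sumK L
    hsym-one [] = refl
    hsym-one (a ∷ L) = trans (+-cong (hsym-one L) (*-identityʳ a)) (+-comm _ _)

    hsym-single : ∀ m a → hsym m (a ∷ []) ≈ powK a m
    hsym-single zero a = refl
    hsym-single (suc m) a = trans (+-identityˡ _) (*-congˡ (hsym-single m a))

    module _ {q : ℕ} where

      private
        value : List Carrier → Carrier
        value [] = 1#
        value (_ ∷ _) = 0#

        -- The degree plus the number of variables stays `q + 1`. With one variable the value is
        -- `a^q = 1`; each further variable is a divided difference of two equal values, hence 0.
        hsym-roots : ∀ L a m → m ℕ.+ length L ≡ q → AllPairs (λ x y → ¬ (x ≈ y)) (a ∷ L) →
          All (λ x → powK x q ≈ 1#) (a ∷ L) →
                     hsym m (a ∷ L) ≈ value L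
        hsym-roots [] a m e _ (ra ∷ []) = trans (hsym-single m a)
          (trans (reflexive (≡.cong (powK a) (≡.trans (≡.sym (ℕP.+-identityʳ m)) e))) ra)
        hsym-roots (b ∷ L) a m e ((a≉b ∷ a≉L) ∷ (b≉L ∷ pL)) (ra ∷ rb ∷ rL) = hsym-divided m a b L
          (trans (hsym-roots L a (suc m) e′ (a≉L ∷ pL) (ra ∷ rL))
            (sym (hsym-roots L b (suc m) e′ (b≉L ∷ pL) (rb ∷ rL)))) a≉b
          where
          e′ : suc m ℕ.+ length L ≡ q
          e′ = ≡.trans (≡.sym (ℕP.+-suc m (length L))) e

      -- The sum is `h_1` in `q` variables, the case of degree 1 in `hsym-roots`. The roots come in
      -- no particular order, so they cannot be summed as a geometric progression.
      sum-distinct-roots : ∀ L → 2 ≤ q → length L ≡ q → AllPairs (λ x y → ¬ (x ≈ y)) L → All (λ x → powK x q ≈ 1#) L →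
        sumK L ≈ 0#
      sum-distinct-roots [] 2≤q ≡.refl with () ← 2≤q
      sum-distinct-roots (_ ∷ []) (s≤s ()) ≡.refl
      sum-distinct-roots (a ∷ b ∷ L) _ e d r = trans (sym (hsym-one (a ∷ b ∷ L))) (hsym-roots (b ∷ L) a 1 e d r)

    sign : Bool → Carrier
    sign true = - 1#
    sign false = 1#

    sign-xor : ∀ a b → sign (a xor b) ≈ sign a * sign b
    sign-xor false b = sym (*-identityˡ _)
    sign-xor true false = sym (*-identityʳ _)
    sign-xor true true = sym (trans (-1*x≈-x _) (-‿involutive 1#))

    sign-square : ∀ a → sign a * sign a ≈ 1#
    sign-square false = *-identityˡ 1#
    sign-square true = trans (-1*x≈-x _) (-‿involutive 1#)

    sign-pow : ∀ a m → powK (sign a) m ≈ sign (par m ∧ a)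
    sign-pow a zero = refl
    sign-pow a (suc m) = trans (*-congˡ (sign-pow a m))
      (trans (sym (sign-xor a (par m ∧ a))) (reflexive (≡.cong sign (xor-∧-step (par m) a))))

    *-sumˡ : ∀ {a} {A : Set a} (xs : List A) x (f : A → Carrier) → x * Sum.big xs f ≈ Sum.big xs (λ y → x * f y)
    *-sumˡ [] x f = zeroʳ x
    *-sumˡ (y ∷ xs) x f = trans (distribˡ x _ _) (+-congˡ (*-sumˡ xs x f))

    sum-const : ∀ {a} {A : Set a} (xs : List A) x → Sum.big xs (λ _ → x) ≈ fromℕ (length xs) * x
    sum-const [] x = sym (zeroˡ x)
    sum-const (y ∷ xs) x = trans (+-cong (sym (*-identityˡ x)) (sum-const xs x)) (sym (distribʳ x _ _))

    fromℕ-length : ∀ {a} {A : Set a} (xs : List A) → fromℕ (length xs) ≈ Sum.big xs (λ _ → 1#)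
    fromℕ-length [] = refl
    fromℕ-length (x ∷ xs) = +-congˡ (fromℕ-length xs)

    prod-zero : ∀ {a} {A : Set a} (xs : List A) {f : A → Carrier} {x} → x ∈ xs → f x ≈ 0# → Prod.big xs f ≈ 0#
    prod-zero (x ∷ xs) (here ≡.refl) e = trans (*-congʳ e) (zeroˡ _)
    prod-zero (y ∷ xs) (there x∈) e = trans (*-congˡ (prod-zero xs x∈ e)) (zeroʳ _)

  module Zeta {c ℓ} (F : Field' c ℓ) (n : ℕ) (α β : ℕ → Field'.Carrier F)
    (prim : ∀ i → 1 ≤ i → i ≤ n → FieldOps.PrimRoot F i (α i) × FieldOps.PrimRoot F (2 ℕ.* i) (β i)) where
    open FieldLemmas F
    open SetoidReasoning setoid

    zeta′ : Bool → ℕ → Carrier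
    zeta′ b h = if b then β h else α h

    zeta : SP n → Fin n → Carrier
    zeta w i = zeta′ (minus w i) (clen w i)

    module _ {w : SP n} (hw : Perm w) (i : Fin n) where

      private
        prim′ : PrimRoot (clen w i) (α (clen w i)) × PrimRoot (2 ℕ.* clen w i) (β (clen w i))
        prim′ = prim (clen w i) (positive (clen-Per hw i)) (clen≤n hw i)

        to-Sim : ∀ b → minus w i ≡ b → ∀ {a} → powK (zeta′ b (clen w i)) a ≈ 1# → Sim b (it w a (pos i)) (pos i)
        to-Sim false m {a} e = from (clen-Per hw i) (PrimRoot-Per (positive (clen-Per hw i)) (proj₁ prim′) {a} e)
        to-Sim true m {a} e with PrimRoot-Per (ℕP.<-≤-trans (positive (clen-Per hw i)) (ℕP.m≤m+n _ _)) (proj₂ prim′)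
          {a} e
        ... | divides u ≡.refl = it-mul w {2 ℕ.* clen w i} (≡.trans (it-clen-mul hw i 2) ≡.refl) u

        of-Sim : ∀ b → minus w i ≡ b → ∀ {a} → Sim b (it w a (pos i)) (pos i) → powK (zeta′ b (clen w i)) a ≈ 1#
        of-Sim false m {a} s with to (clen-Per hw i) {a} s
        ... | divides u ≡.refl = powK-mul (proj₁ (proj₁ prim′)) u
        of-Sim true m {a} s with Sim-period-minus hw i m {a} s
        ... | divides u ≡.refl = powK-mul (proj₁ (proj₂ prim′)) u

      -- The order of ζ is `clen` in class +1, the period of `i` on absolute values, and `2 * clen`
      -- in class -1, the period on signed points. This is what ties powers of ζ to `Sim`.
      zeta-one⇒Sim : ∀ {a} → powK (zeta w i) a ≈ 1# → Sim (minus w i) (it w a (pos i)) (pos i)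
      zeta-one⇒Sim {a} = to-Sim (minus w i) ≡.refl {a}

      Sim⇒zeta-one : ∀ {a} → Sim (minus w i) (it w a (pos i)) (pos i) → powK (zeta w i) a ≈ 1#
      Sim⇒zeta-one {a} = of-Sim (minus w i) ≡.refl {a}

      -- The inverse of a power of ζ is again a power: `N * a + a` is a multiple of the period
      -- `suc N`.
      zeta-unit : ∀ a → ∃ λ v → v * powK (zeta w i) a ≈ 1#
      zeta-unit a with pt-period hw (pos i)
      ... | zero , per , _ with () ← positive per
      ... | suc N , per , _ = powK (zeta w i) (N ℕ.* a) , (begin
        powK (zeta w i) (N ℕ.* a) * powK (zeta w i) a ≈⟨ powK-+ _ (N ℕ.* a) a ⟨
        powK (zeta w i) (N ℕ.* a ℕ.+ a)
          ≡⟨ ≡.cong (powK (zeta w i)) (≡.trans (ℕP.+-comm (N ℕ.* a) a) (ℕP.*-comm (suc N) a)) ⟩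
        powK (zeta w i) (a ℕ.* suc N)
          ≈⟨ Sim⇒zeta-one {a ℕ.* suc N} (Sim-reflexive (minus w i) (from per (divides a ≡.refl))) ⟩
        1#                                            ∎)

      private
        eq⇒Sim+ : ∀ a c → powK (zeta w i) a ≈ powK (zeta w i) (a ℕ.+ c) →
          Sim (minus w i) (it w a (pos i)) (it w (a ℕ.+ c) (pos i))
        eq⇒Sim+ a c e = Sim-trans (minus w i) (Sim-sym (minus w i) (Sim-it (minus w i) w a (zeta-one⇒Sim {c}
            (*-cancelˡ-unit (proj₁ (zeta-unit a)) (proj₂ (zeta-unit a))
              (sym (trans (*-identityʳ _) (trans e (powK-+ _ a c))))))))
            (Sim-reflexive (minus w i) (≡.sym (it-+ w a c (pos i))))

        Sim⇒eq+ : ∀ a c → Sim (minus w i) (it w a (pos i)) (it w (a ℕ.+ c) (pos i)) →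
          powK (zeta w i) a ≈ powK (zeta w i) (a ℕ.+ c)
        Sim⇒eq+ a c s = sym (trans (powK-+ _ a c) (trans (*-congˡ (Sim⇒zeta-one {c}
          (Sim-it-inj (minus w i) hw a (Sim-trans (minus w i) (Sim-reflexive (minus w i) (≡.sym (it-+ w a c (pos i))))
            (Sim-sym (minus w i) s))))) (*-identityʳ _)))

      zeta-eq⇒Sim : ∀ a b → powK (zeta w i) a ≈ powK (zeta w i) b → Sim (minus w i) (it w a (pos i)) (it w b (pos i))
      zeta-eq⇒Sim a b e with ℕP.≤-total a b
      ... | inj₁ a≤b with ℕP.m≤n⇒∃[o]m+o≡n a≤b
      ...   | c , ≡.refl = eq⇒Sim+ a c e
      zeta-eq⇒Sim a b e | inj₂ b≤a with ℕP.m≤n⇒∃[o]m+o≡n b≤a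
      ...   | c , ≡.refl = Sim-sym (minus w i) (eq⇒Sim+ b c (sym e))

      Sim⇒zeta-eq : ∀ a b → Sim (minus w i) (it w a (pos i)) (it w b (pos i)) → powK (zeta w i) a ≈ powK (zeta w i) b
      Sim⇒zeta-eq a b e with ℕP.≤-total a b
      ... | inj₁ a≤b with ℕP.m≤n⇒∃[o]m+o≡n a≤b
      ...   | c , ≡.refl = Sim⇒eq+ a c e
      Sim⇒zeta-eq a b e | inj₂ b≤a with ℕP.m≤n⇒∃[o]m+o≡n b≤a
      ...   | c , ≡.refl = sym (Sim⇒eq+ b c (Sim-sym (minus w i) e))

    rho : SP n → SP n → Fin n → Carrier
    rho w g i = powK (zeta w i) (expW w g i)

    rho-transport : ∀ {w g w′ g′ : SP n} {i i′} → Perm w → Perm w′ → Perm g → Perm g′ → Comm w g → Comm w′ g′ →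
      Transport w g w′ g′ i i′ → rho w g i ≡ rho w′ g′ i′
    rho-transport hw hw′ hg hg′ c c′ t = ≡.cong₂ powK (≡.cong₂ zeta′ minus-≡ clen-≡) expW-≡
      where open Transported hw hw′ hg hg′ c c′ t

open FieldSums

-- Cycles and blocks of a commuting pair.

module BlockDecomposition where
  open import Function using (_∘_; id)
  open import Data.Bool using (Bool; true; false; _∨_; if_then_else_)
  open import Data.Bool.Properties using (∨-zeroʳ)
  open import Data.Bool.ListAction using (any)
  open import Data.Nat using (zero; suc; _+_; _*_; _≡ᵇ_)
  open import Data.Nat.Properties
  open import Data.Nat.Divisibility
  open import Data.Fin using (Fin; toℕ)
  open import Data.Fin.Properties using (toℕ-injective)
  open import Data.Product using (_,_; proj₁; ∃)
  open import Data.Sum using (inj₁; inj₂)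
  open import Data.Maybe using (just; nothing; maybe′)
  open import Data.List using (filterᵇ; head; upTo; allFin)
  open import Data.List.Membership.Propositional.Properties using (∈-upTo⁺; ∈-allFin)
  open import Relation.Binary.PropositionalEquality hiding (setoid)
  open import Relation.Nullary using (contradiction)
  import Data.Fin as Fin

  ∨⁺ˡ : ∀ {a b} → a ≡ true → a ∨ b ≡ true
  ∨⁺ˡ refl = refl

  ∨⁺ʳ : ∀ a {b} → b ≡ true → a ∨ b ≡ true
  ∨⁺ʳ a refl = ∨-zeroʳ a

  module _ {n : ℕ} where

    opaque
      firstFin : (Fin n → Bool) → Fin n → Fin n
      firstFin P i = maybe′ id i (head (filterᵇ P (allFin n)))

      firstFin-spec : ∀ (P : Fin n → Bool) (i : Fin n) {j} → P j ≡ true → P (firstFin P i) ≡ true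
      firstFin-spec P i {j} pj with head (filterᵇ P (allFin n)) in eq
      ... | just k = head-filterᵇ-just P (allFin n) eq
      ... | nothing = contradiction (head-filterᵇ-nothing P (allFin n) eq (∈-allFin j)) (true≢false pj)

      firstFin-cong : ∀ (P Q : Fin n → Bool) (i i′ : Fin n) {j} → P j ≡ true → (∀ j → P j ≡ Q j) →
        firstFin P i ≡ firstFin Q i′
      firstFin-cong P Q i i′ {j} pj e = trans head-P
        (cong (maybe′ id i′ ∘ head) (filterᵇ-cong {p = P} {q = Q} e (allFin n)))
        where
        head-P : maybe′ id i (head (filterᵇ P (allFin n))) ≡ maybe′ id i′ (head (filterᵇ P (allFin n)))
        head-P with head (filterᵇ P (allFin n)) in eq
        ... | just k = refl
        ... | nothing = contradiction (head-filterᵇ-nothing P (allFin n) eq (∈-allFin j)) (true≢false pj)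

    opaque
      it-back : ∀ {w : SP n} → Perm w → ∀ r p → ∃ λ s → ix (it w s (it w r p)) ≡ ix p
      it-back {w} hw r p = let (h , _ , e) = ix-return hw p in
        h * r , trans (cong ix (sym (it-+ w (h * r) r p)))
          (trans (cong (λ m → ix (it w m p)) (trans (+-comm (h * r) r) (*-comm (suc h) r))) (it-mul-ix w e r))

    record Cyc (w : SP n) (p q : Pt n) : Set where
      constructor cyc
      field
        steps : ℕ
        arrives : ix (it w steps p) ≡ ix q

    Cyc-refl : ∀ {w p q} → ix p ≡ ix q → Cyc w p q
    Cyc-refl e = cyc 0 e

    Cyc-trans : ∀ {w p q s} → Cyc w p q → Cyc w q s → Cyc w p s
    Cyc-trans {w} {p} (cyc a ea) (cyc b eb) = cyc (b + a) (trans (cong ix (it-+ w b a p)) (trans (it-ix w b ea) eb))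

    Cyc-sym : ∀ {w} → Perm w → ∀ {p q} → Cyc w p q → Cyc w q p
    Cyc-sym {w} hw {p} (cyc a ea) = let (s , es) = it-back hw a p in cyc s (trans (sym (it-ix w s ea)) es)

    Cyc-it : ∀ {w g} → Comm w g → ∀ l {p q} → Cyc w p q → Cyc w (it g l p) (it g l q)
    Cyc-it {w} {g} c l {p} (cyc a ea) = cyc a (trans (cong ix (it-it c a l p)) (it-ix g l ea))

    Cyc-it-cancel : ∀ {w g} → Comm w g → Perm g → ∀ l {p q} → Cyc w (it g l p) (it g l q) → Cyc w p q
    Cyc-it-cancel {w} {g} c hg l {p} (cyc a ea) = cyc a (it-ix-inj hg l (trans (cong ix (sym (it-it c a l p))) ea))

    opaque
      unfolding firstFin

      base : SP n → Pt n → Fin n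
      base = baseIdx

      base≡baseIdx : ∀ w p → base w p ≡ baseIdx w p
      base≡baseIdx w p = refl

      isBase-def : ∀ w i → isBase w i ≡ (toℕ (base w (pos i)) ≡ᵇ toℕ i)
      isBase-def w i = refl

      cycᵇ : SP n → Pt n → Fin n → Bool
      cycᵇ w p j = inOrbit w p (false , j) ∨ inOrbit w p (true , j)

      base-first : ∀ w p → base w p ≡ firstFin (cycᵇ w p) (ix p)
      base-first w p with head (filterᵇ (λ j → inOrbit w p (false , j) ∨ inOrbit w p (true , j)) (allFin n))
      ... | just j = refl
      ... | nothing = refl

      cycᵇ⁺ : ∀ {w} → Perm w → ∀ p j → Cyc w p (pos j) → cycᵇ w p j ≡ true
      cycᵇ⁺ {w} hw p j (cyc r e) with ix≡⇒sg {p = it w r p} {q = pos j} e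
      ... | false , e′ = ∨⁺ˡ {inOrbit w p (false , j)} {inOrbit w p (true , j)}
        (inOrbit⁺ {w = w} hw {p} {false , j} r e′)
      ... | true , e′ = ∨⁺ʳ (inOrbit w p (false , j)) {inOrbit w p (true , j)}
        (inOrbit⁺ {w = w} hw {p} {true , j} r e′)

      cycᵇ⁻ : ∀ w p j → cycᵇ w p j ≡ true → Cyc w p (pos j)
      cycᵇ⁻ w p j h with ∨⁻ {inOrbit w p (false , j)} {inOrbit w p (true , j)} h
      ... | inj₁ o = let (r , e) = inOrbit⁻ {w = w} {p} {false , j} o in cyc r (cong ix e)
      ... | inj₂ o = let (r , e) = inOrbit⁻ {w = w} {p} {true , j} o in cyc r (cong ix e)

    module _ {w : SP n} (hw : Perm w) where

      opaque
        base-Cyc : ∀ p → Cyc w p (pos (base w p))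
        base-Cyc p = cycᵇ⁻ w p (base w p) (subst (λ j → cycᵇ w p j ≡ true) (sym (base-first w p))
          (firstFin-spec (cycᵇ w p) (ix p) (cycᵇ⁺ hw p (ix p) (cyc 0 refl))))

        base-≡ : ∀ {p q} → Cyc w p q → base w p ≡ base w q
        base-≡ {p} {q} c = trans (base-first w p) (trans
          (firstFin-cong (cycᵇ w p) (cycᵇ w q) (ix p) (ix q) (cycᵇ⁺ hw p (ix p) (cyc 0 refl))
          (λ j → bool-ext (λ h → cycᵇ⁺ hw q j (Cyc-trans {w} {q} {p} {pos j} (Cyc-sym hw {p} {q} c) (cycᵇ⁻ w p j h)))
            (λ h → cycᵇ⁺ hw p j (Cyc-trans {w} {p} {q} {pos j} c (cycᵇ⁻ w q j h))))) (sym (base-first w q)))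

      base-≡⁻ : ∀ {p q} → base w p ≡ base w q → Cyc w p q
      base-≡⁻ {p} {q} e = Cyc-trans (base-Cyc p) (subst (λ j → Cyc w (pos j) q) (sym e) (Cyc-sym hw (base-Cyc q)))

      isBase⁺ : ∀ {i} → base w (pos i) ≡ i → isBase w i ≡ true
      isBase⁺ {i} e = trans (isBase-def w i) (≡ᵇ-true (cong toℕ e))
        where
        ≡ᵇ-true : ∀ {a b} → a ≡ b → (a ≡ᵇ b) ≡ true
        ≡ᵇ-true {zero} refl = refl
        ≡ᵇ-true {suc a} refl = ≡ᵇ-true {a} refl

      isBase⁻ : ∀ {i} → isBase w i ≡ true → base w (pos i) ≡ i
      isBase⁻ {i} h = toℕ-injective (≡ᵇ-eq (trans (sym (isBase-def w i)) h))
        where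
        ≡ᵇ-eq : ∀ {a b} → (a ≡ᵇ b) ≡ true → a ≡ b
        ≡ᵇ-eq {zero} {zero} _ = refl
        ≡ᵇ-eq {suc a} {suc b} h = cong suc (≡ᵇ-eq h)

    -- As `w` and `g` commute, the products `w^a g^b` already reach the whole orbit of ⟨w, g⟩ on
    -- absolute values.
    record Blk (w g : SP n) (i j : Fin n) : Set where
      constructor blk
      field
        wsteps gsteps : ℕ
        reaches : ix (it w wsteps (it g gsteps (pos i))) ≡ j

    opaque
      blkᵇ : SP n → SP n → Fin n → Fin n → Bool
      blkᵇ w g i j = any (λ a → any (λ b → eqFin (ix (it w a (it g b (pos i)))) j) (upTo n)) (upTo n)

      blkᵇ⁻ : ∀ w g i j → blkᵇ w g i j ≡ true → Blk w g i j
      blkᵇ⁻ w g i j h with any⁻ (λ a → any (λ b → eqFin (ix (it w a (it g b (pos i)))) j) (upTo n)) (upTo n) h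
      ... | a , _ , h′ with any⁻ (λ b → eqFin (ix (it w a (it g b (pos i)))) j) (upTo n) h′
      ... | b , _ , e = blk a b (eqFin⁻ e)

      blkᵇ⁺ : ∀ w g → Perm w → Perm g → ∀ i j → Blk w g i j → blkᵇ w g i j ≡ true
      blkᵇ⁺ w g hw hg i j (blk a b e) with ix-period hg (pos i)
      ... | hb , perb , hb≤ with reduce-ix perb b
      ... | b′ , b′< , eb with ix-period hw (it g b′ (pos i))
      ... | ha , pera , ha≤ with reduce-ix pera a
      ... | a′ , a′< , ea = any⁺ (λ a → any (λ b → eqFin (ix (it w a (it g b (pos i)))) j) (upTo n)) {xs = upTo n}
        {x = a′} (∈-upTo⁺ (<-≤-trans a′< ha≤))
            (any⁺ (λ b → eqFin (ix (it w a′ (it g b (pos i)))) j) {xs = upTo n} {x = b′} (∈-upTo⁺ (<-≤-trans b′< hb≤))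
              (eqFin⁺ {i = ix (it w a′ (it g b′ (pos i)))} {j = j} (trans ea (trans (it-ix w a eb) e))))

    Blk-refl : ∀ {w g i} → Blk w g i i
    Blk-refl = blk 0 0 refl

    Blk-trans : ∀ {w g} → Comm w g → ∀ {i j k} → Blk w g i j → Blk w g j k → Blk w g i k
    Blk-trans {w} {g} c {i} {j} (blk a b e) (blk a′ b′ e′) = blk (a′ + a) (b′ + b)
      (trans (cong ix path) (trans (it-ix w a′ (it-ix g b′ e)) e′))
      where
      path : it w (a′ + a) (it g (b′ + b) (pos i)) ≡ it w a′ (it g b′ (it w a (it g b (pos i))))
      path = trans (it-+ w a′ a _) (cong (it w a′) (trans (cong (it w a) (it-+ g b′ b (pos i))) (it-it c a b′ _)))

    opaque
      Blk-sym : ∀ {w g} → Perm w → Perm g → Comm w g → ∀ {i j} → Blk w g i j → Blk w g j i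
      Blk-sym {w} {g} hw hg c {i} {j} (blk a b e) = let (b′ , eb) = it-back hg b (pos i) ; (a′ , ea) = it-back hw a (it g b′ (it g b (pos i))) in
        blk a′ b′ (trans (it-ix w a′ (trans (it-ix g b′ {pos j} (sym e))
          (cong ix (sym (it-it c a b′ (it g b (pos i))))))) (trans ea eb))

    -- The least element of the block. It depends only on the block as a set, so it stays the same
    -- under every modification of `w` that preserves the blocks.
    blkRep : SP n → SP n → Fin n → Fin n
    blkRep w g i = firstFin (blkᵇ w g i) i

    isRep : SP n → SP n → Fin n → Bool
    isRep w g i = eqFin (blkRep w g i) i

    module Blocks {w g : SP n} (hw : Perm w) (hg : Perm g) (c : Comm w g) where

      opaque
        blkRep-Blk : ∀ i → Blk w g i (blkRep w g i)
        blkRep-Blk i = blkᵇ⁻ w g i _ (firstFin-spec (blkᵇ w g i) i (blkᵇ⁺ w g hw hg i i (Blk-refl {w} {g})))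

        blkRep-≡ : ∀ {i j} → Blk w g i j → blkRep w g i ≡ blkRep w g j
        blkRep-≡ {i} {j} b = firstFin-cong (blkᵇ w g i) (blkᵇ w g j) i j (blkᵇ⁺ w g hw hg i i (Blk-refl {w} {g})) λ k
          →
          bool-ext (λ h → blkᵇ⁺ w g hw hg j k (Blk-trans {w} {g} c (Blk-sym {w} {g} hw hg c b) (blkᵇ⁻ w g i k h)))
                   (λ h → blkᵇ⁺ w g hw hg i k (Blk-trans {w} {g} c b (blkᵇ⁻ w g j k h)))

        blkRep-idem : ∀ i → blkRep w g (blkRep w g i) ≡ blkRep w g i
        blkRep-idem i = sym (blkRep-≡ (blkRep-Blk i))

        blkRep-≡⁻ : ∀ {i j} → blkRep w g i ≡ blkRep w g j → Blk w g i j
        blkRep-≡⁻ {i} {j} e = Blk-trans {w} {g} c (blkRep-Blk i)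
          (subst (λ k → Blk w g k j) (sym e) (Blk-sym {w} {g} hw hg c (blkRep-Blk j)))

    record Iso (w g w′ g′ : SP n) : Set where
      field
        v : Pt n → Pt n
        v-inj : ∀ {p q} → v p ≡ v q → p ≡ q
        v-sg : ∀ b p → v (sg b p) ≡ sg b (v p)
        v-w : ∀ p → v (act w p) ≡ act w′ (v p)
        v-g : ∀ p → v (act g p) ≡ act g′ (v p)

      v-ix : ∀ {p q} → ix p ≡ ix q → ix (v p) ≡ ix (v q)
      v-ix {p} {q} e = let (b , e′) = ix≡⇒sg {p = p} {q = q} e in trans (cong (ix ∘ v) e′) (cong ix (v-sg b q))

      v-ix-inj : ∀ {p q} → ix (v p) ≡ ix (v q) → ix p ≡ ix q
      v-ix-inj {p} {q} e = let (b , e′) = ix≡⇒sg {p = v p} {q = v q} e in cong ix (v-inj {p} {sg b q} (trans e′ (sym (v-sg b q))))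

      it-v-w : ∀ r p → it w′ r (v p) ≡ v (it w r p)
      it-v-w zero p = refl
      it-v-w (suc r) p = trans (cong (act w′) (it-v-w r p)) (sym (v-w _))

      it-v-g : ∀ r p → it g′ r (v p) ≡ v (it g r p)
      it-v-g zero p = refl
      it-v-g (suc r) p = trans (cong (act g′) (it-v-g r p)) (sym (v-g _))

      -- `v (pos i)` may be a negative point, whereas a `Transport` starts at a positive one;
      -- composing with its sign `s` repairs this, since signs commute with everything.
      transport : ∀ i → Transport w g w′ g′ i (ix (v (pos i)))
      transport i = record
        { v = λ p → sg s (v p)
        ; v-inj = λ e → v-inj (sg-inj s e)
        ; v-ix = v-ix
        ; v-ix-inj = v-ix-inj
        ; v-neg = λ p → trans (cong (sg s) (v-sg true p)) (sg-comm s true (v p))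
        ; it-w = λ r → trans (cong (it w′ r) start) (trans (it-sg w′ r s _) (cong (sg s) (it-v-w r (pos i))))
        ; it-g = λ r → trans (cong (it g′ r) start) (trans (it-sg g′ r s _) (cong (sg s) (it-v-g r (pos i)))) }
        where
        s : Bool
        s = proj₁ (v (pos i))
        start : pos (ix (v (pos i))) ≡ sg s (v (pos i))
        start = sym (trans (cong (sg s) (pos-ix (v (pos i)))) (sg-invol s _))

    Iso-act : ∀ {w g z} → Perm z → Comm z w → Comm z g → Iso w g w g
    Iso-act {z = z} hz cw cg = record { v = act z ; v-inj = hz ; v-sg = act-sg z ; v-w = cw ; v-g = cg }

    -- Each `w^a g^b` is an automorphism of the pair `(w, g)`. Hence class, length and block factor
    -- agree at all points of a block.
    Iso-Blk : ∀ {w g} → Perm w → Perm g → Comm w g → ∀ a b → Iso w g w g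
    Iso-Blk {w} {g} hw hg c a b = record
      { v = λ p → it w a (it g b p)
      ; v-inj = λ e → it-inj hg b (it-inj hw a e)
      ; v-sg = λ s p → trans (cong (it w a) (it-sg g b s p)) (it-sg w a s _)
      ; v-w = λ p → trans (cong (it w a) (it-app (Comm-sym {w = w} {v = g} c) b p)) (it-app (Comm-self w) a _)
      ; v-g = λ p → trans (cong (it w a) (it-app (Comm-self g) b p)) (it-app c a _) }

    opaque
      minus-Blk : ∀ {w g} → Perm w → Perm g → Comm w g → ∀ {i j} → Blk w g i j → minus w i ≡ minus w j
      minus-Blk hw hg c {i} (blk a b refl) = Transported.minus-≡ hw hw hg hg c c
        (Iso.transport (Iso-Blk hw hg c a b) i)

    opaque
      clen-Blk : ∀ {w g} → Perm w → Perm g → Comm w g → ∀ {i j} → Blk w g i j → clen w i ≡ clen w j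
      clen-Blk hw hg c {i} (blk a b refl) = Transported.clen-≡ hw hw hg hg c c (Iso.transport (Iso-Blk hw hg c a b) i)

    Cyc⇒Blk : ∀ {w q j} → Cyc w q (pos j) → Blk w w (ix q) j
    Cyc⇒Blk {w} {q} (cyc r e) = blk r 0 (trans (it-ix w r {pos (ix q)} {q} refl) e)

    opaque
      base-shift : ∀ {w} → Perm w → ∀ q → ∃ λ r → Sim (minus w (ix q)) (it w r (pos (base w q))) q
      base-shift {w} hw q = go (minus w (ix q)) refl (Cyc-sym hw (base-Cyc hw q))
        where
        go : ∀ m → minus w (ix q) ≡ m → Cyc w (pos (base w q)) q → ∃ λ r → Sim m (it w r (pos (base w q))) q
        go false _ (cyc r e) = r , e
        go true eq (cyc r e) with ix≡⇒sg {p = it w r (pos (base w q))} {q = q} e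
        ... | false , e′ = r , e′
        ... | true , e′ with minus⁻ hw (base w q) (trans
          (sym (minus-Blk hw hw (Comm-self w) (Cyc⇒Blk {q = q} (base-Cyc hw q)))) eq)
        ... | s , es = r + s , trans (it-+ w r s _) (trans (cong (it w r) es)
          (trans (it-sg w r true _) (trans (cong (sg true) e′) (sg-invol true q))))

    opaque
      shift : SP n → SP n → Fin n → ℕ
      shift = shiftR

      shift≡shiftR : ∀ w z i → shift w z i ≡ shiftR w z i
      shift≡shiftR w z i = refl

      private
        shiftTest : Bool → SP n → Fin n → Pt n → ℕ → Bool
        shiftTest true w j q r = eqPt (iterP w r (pos j)) q
        shiftTest false w j q r = eqPt (iterP w r (pos j)) q ∨ eqPt (iterP w r (pos j)) (negP q)

        shift-first : ∀ w z i m → minus w i ≡ m → shift w z i ≡ firstℕ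
          (shiftTest m w (base w (act z (pos i))) (act z (pos i))) (upTo (2 * n))
        shift-first w z i m eq = trans (cong (λ m → sh m (app z (pos i)) (baseIdx w (app z (pos i))))
          (trans (sym (minus≡isMinus w i)) eq))
          (trans (cong₂ (sh m) (sym (act≡app z (pos i)))
            (trans (cong (baseIdx w) (sym (act≡app z (pos i)))) (sym (base≡baseIdx w _)))) (lem m))
          where
          sh : Bool → Pt n → Fin n → ℕ
          sh m q j = if m then firstℕ (λ r → eqPt (iterP w r (pos j)) q) (upTo (2 * n))
                          else firstℕ (λ r → eqPt (iterP w r (pos j)) q ∨ eqPt (iterP w r (pos j)) (negP q))
                            (upTo (2 * n))
          lem : ∀ m → sh m (act z (pos i)) (base w (act z (pos i))) ≡ firstℕ
            (shiftTest m w (base w (act z (pos i))) (act z (pos i))) (upTo (2 * n))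
          lem true = refl
          lem false = refl

        shiftTest⁺ : ∀ m w j q r → Sim m (it w r (pos j)) q → shiftTest m w j q r ≡ true
        shiftTest⁺ true w j q r s = eqPt⁺ {p = iterP w r (pos j)} {q = q} (trans (iterP≡it w r (pos j)) s)
        shiftTest⁺ false w j q r s with ix≡⇒sg {p = it w r (pos j)} {q = q} s
        ... | false , e = ∨⁺ˡ {eqPt (iterP w r (pos j)) q}
          (eqPt⁺ {p = iterP w r (pos j)} {q = q} (trans (iterP≡it w r (pos j)) e))
        ... | true , e = ∨⁺ʳ (eqPt (iterP w r (pos j)) q)
          (eqPt⁺ {p = iterP w r (pos j)} {q = negP q} (trans (iterP≡it w r (pos j)) e))

        shiftTest⁻ : ∀ m w j q r → shiftTest m w j q r ≡ true → Sim m (it w r (pos j)) q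
        shiftTest⁻ true w j q r h = trans (sym (iterP≡it w r (pos j))) (eqPt⁻ {p = iterP w r (pos j)} {q = q} h)
        shiftTest⁻ false w j q r h with ∨⁻ {eqPt (iterP w r (pos j)) q} {eqPt (iterP w r (pos j)) (negP q)} h
        ... | inj₁ e = cong ix (trans (sym (iterP≡it w r (pos j))) (eqPt⁻ {p = iterP w r (pos j)} {q = q} e))
        ... | inj₂ e = cong ix (trans (sym (iterP≡it w r (pos j))) (eqPt⁻ {p = iterP w r (pos j)} {q = negP q} e))

      -- `shiftR` selects its test by the class of `i`, but the search takes place on the cycle of
      -- `z i`; the two classes agree because `z` commutes with `w`.
      shift-Sim : ∀ {w z} → Perm w → Perm z → Comm z w → ∀ i →
        Sim (minus w i) (it w (shift w z i) (pos (base w (act z (pos i))))) (act z (pos i))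
      shift-Sim {w} {z} hw hz c i = go (minus w i) refl
        where
        q : Pt n
        q = act z (pos i)
        same : minus w (ix q) ≡ minus w i
        same = sym (Transported.minus-≡ hw hw hw hw (Comm-self w) (Comm-self w) (Iso.transport (Iso-act hz c c) i))
        go : ∀ m → minus w i ≡ m → Sim m (it w (shift w z i) (pos (base w q))) q
        go m eq with base-shift hw q
        ... | r , sim with pt-period hw (pos (base w q))
        ... | h , per , h≤ with reduce per r
        ... | s , s< , es with firstℕ-spec (shiftTest m w (base w q) q) id (2 * n) {s} (<-≤-trans s< h≤)
                (shiftTest⁺ m w (base w q) q s (subst (λ m → Sim m (it w s (pos (base w q))) q) (trans same eq)
                  (Sim-trans (minus w (ix q)) (Sim-reflexive (minus w (ix q)) es) sim)))
        ... | t , _ , et , pt , _ = subst (λ k → Sim m (it w k (pos (base w q))) q)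
          (sym (trans (shift-first w z i m eq) et))
                (shiftTest⁻ m w (base w q) q t pt)

open BlockDecomposition

-- `omega` as a product over blocks.

module OmegaFactorization where
  open import Function using (_∘_)
  open import Data.Bool using (Bool; true; false; if_then_else_; T?)
  open import Data.Nat using (zero; suc; _<_; _%_; _/_)
  import Data.Nat as ℕ
  import Data.Nat.Properties as ℕP
  open import Data.Nat.Divisibility
  open import Data.Nat.DivMod using (m≡m%n+[m/n]*n; m%n<n)
  open import Data.Fin using (Fin)
  open import Data.Product using (_,_; proj₁; proj₂; ∃)
  open import Data.Sum using (inj₁; inj₂)
  open import Data.List using (List; []; _∷_; filterᵇ; upTo; allFin)
  open import Data.List.Membership.Propositional.Properties using (∈-upTo⁺; ∈-upTo⁻; ∈-allFin)
  import Data.List.Relation.Unary.Unique.Propositional.Properties as UniqueP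
  open import Relation.Binary.PropositionalEquality as ≡ using (_≡_; cong; subst)
  open import Relation.Nullary using (contradiction)
  import Relation.Binary.Reasoning.Setoid as SetoidReasoning

  module _ {n : ℕ} {w g : SP n} (hw : Perm w) (hg : Perm g) (c : Comm w g) where
    open Blocks hw hg c

    -- The w-cycles in the block of b are those of b, g b, …, g^(e-1) b.
    cycleOf : Fin n → ℕ → Fin n
    cycleOf b l = base w (it g l (pos b))

    cycleOf-Cyc : ∀ b l → Cyc w (it g l (pos b)) (pos (cycleOf b l))
    cycleOf-Cyc b l = base-Cyc hw (it g l (pos b))

    cycleOf-base : ∀ b l → base w (pos (cycleOf b l)) ≡ cycleOf b l
    cycleOf-base b l = ≡.sym (base-≡ hw (cycleOf-Cyc b l))

    cycleOf-Blk : ∀ b l → Blk w g b (cycleOf b l)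
    cycleOf-Blk b l = let cyc r e = cycleOf-Cyc b l in blk r l e

    cycleOf-≡ : ∀ b l {q} → Cyc w (it g l (pos b)) q → cycleOf b l ≡ base w q
    cycleOf-≡ b l = base-≡ hw

    private
      Link⇒Cyc : ∀ {b a} → Link g w (pos b) a → Cyc w (pos b) (it g a (pos b))
      Link⇒Cyc (link r e) = cyc r (≡.sym e)

      Cyc⇒Link : ∀ {b a} → Cyc w (pos b) (it g a (pos b)) → Link g w (pos b) a
      Cyc⇒Link (cyc r e) = link r (≡.sym e)

    -- If the cycles of `g^l b` and `g^(l+k) b` coincide, cancelling `g^l` shows that `g^k` returns
    -- `b` to its own `w`-cycle, which is too early unless `k` is 0.
    cycleOf-inj≤ : ∀ b l k → l ℕ.+ k < expG w g b → cycleOf b l ≡ cycleOf b (l ℕ.+ k) → k ≡ 0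
    cycleOf-inj≤ b l zero _ _ = ≡.refl
    cycleOf-inj≤ b l k@(suc _) lt e = contradiction
      (∣⇒≤ (to (expG-Per hw hg c b) (Cyc⇒Link (Cyc-it-cancel {w = w} {g} c hg l
        (Cyc-trans (base-≡⁻ hw {it g l (pos b)} {it g (l ℕ.+ k) (pos b)} e)
          (Cyc-refl {w = w} {it g (l ℕ.+ k) (pos b)} {it g l (it g k (pos b))} (cong ix (it-+ g l k (pos b)))))))))
      (ℕP.<⇒≱ (ℕP.≤-<-trans (ℕP.m≤n+m k l) lt))

    cycleOf-inj : ∀ b {l k} → l < expG w g b → k < expG w g b → cycleOf b l ≡ cycleOf b k → l ≡ k
    cycleOf-inj b {l} {k} l< k< e with ℕP.≤-total l k
    ... | inj₁ le with ℕP.m≤n⇒∃[o]m+o≡n le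
    ...   | o , ≡.refl = ≡.sym (≡.trans (cong (l ℕ.+_) (cycleOf-inj≤ b l o k< e)) (ℕP.+-identityʳ l))
    cycleOf-inj b {l} {k} l< k< e | inj₂ le with ℕP.m≤n⇒∃[o]m+o≡n le
    ...   | o , ≡.refl = ≡.trans (cong (k ℕ.+_) (cycleOf-inj≤ b k o l< (≡.sym e))) (ℕP.+-identityʳ k)

    opaque
      -- The exponent of `g` may be reduced modulo `E`, since multiples of `E` keep `b` on its own
      -- `w`-cycle.
      cycleOf-surj : ∀ b {i} → base w (pos i) ≡ i → Blk w g b i → ∃ λ l → l < expG w g b × cycleOf b l ≡ i
      cycleOf-surj b {i} bi (blk a y e) = go (expG w g b) (expG-Per hw hg c b)
        where
        go : ∀ E → Per (Link g w (pos b)) E → ∃ λ l → l < E × cycleOf b l ≡ i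
        go zero per with () ← positive per
        go (suc E) per = y % suc E , m%n<n y (suc E) , ≡.trans (cycleOf-≡ b (y % suc E) (Cyc-trans back (cyc a e))) bi
          where
          back : Cyc w (it g (y % suc E) (pos b)) (it g y (pos b))
          back = Cyc-trans (Cyc-it c (y % suc E) (Link⇒Cyc (from per (divides (y / suc E) ≡.refl))))
                   (Cyc-refl (cong ix (≡.trans (≡.sym (it-+ g (y % suc E) ((y / suc E) ℕ.* suc E) (pos b)))
                     (cong (λ m → it g m (pos b)) (≡.sym (m≡m%n+[m/n]*n y (suc E)))))))

  module OmegaProduct {c ℓ} (F : Field' c ℓ) (n : ℕ) (α β : ℕ → Field'.Carrier F)
    (prim : ∀ i → 1 ≤ i → i ≤ n → FieldOps.PrimRoot F i (α i) × FieldOps.PrimRoot F (2 ℕ.* i) (β i)) where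
    open FieldLemmas F
    open SetoidReasoning setoid
    open Zeta F n α β prim
    open Chars F α β using (omega)

    Omega : SP n → SP n → Carrier
    Omega w g = Prod.big (allFin n) (λ b → if isRep w g b then rho w g b else 1#)

    factor : SP n → SP n → Fin n → Carrier
    factor w z i = powK (zeta w i) (shift w z i)

    omega-factor : ∀ w z → omega w z ≡ Prod.big (filterᵇ (isBase w) (allFin n)) (factor w z)
    omega-factor w z = big-≡ (filterᵇ (isBase w) (allFin n)) λ i →
      ≡.trans (≡.sym (if-pow (isMinus w i) (cycLen w i) (shiftR w z i)))
      (≡.sym (≡.cong₂ powK (≡.cong₂ zeta′ (minus≡isMinus w i) (clen≡cycLen w i)) (shift≡shiftR w z i)))
      where
      if-pow : ∀ b h r → powK (zeta′ b h) r ≡ (if b then powK (β h) r else powK (α h) r)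
      if-pow true h r = ≡.refl
      if-pow false h r = ≡.refl
      big-≡ : ∀ {A : Set} (xs : List A) {f g : A → Carrier} → (∀ x → f x ≡ g x) → Prod.big xs f ≡ Prod.big xs g
      big-≡ [] h = ≡.refl
      big-≡ (x ∷ xs) h = ≡.cong₂ _*_ (h x) (big-≡ xs h)

    module _ {w g : SP n} (hw : Perm w) (hg : Perm g) (cm : Comm w g) where
      open Blocks hw hg cm

      -- Write `g^l b = w^(offset l) i_l`, in the sense of `Sim`, with `i_l` the base point of the
      -- cycle reached. Modulo the order of ζ, the shift of `g` at `i_l` is then
      -- `offset (l+1) - offset l`. After `expG` steps the base point is `i_0` again and the offset
      -- has grown by `expW`, so the choice of base points cancels.
      module Telescope (b : Fin n) where

        m : Bool
        m = minus w b

        i_ : ℕ → Fin n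
        i_ = cycleOf hw hg cm b

        same-minus : ∀ l → minus w b ≡ minus w (i_ l)
        same-minus l = minus-Blk hw hg cm (cycleOf-Blk hw hg cm b l)

        same-zeta : ∀ l → zeta w b ≡ zeta w (i_ l)
        same-zeta l = ≡.cong₂ zeta′ (same-minus l) (clen-Blk hw hg cm (cycleOf-Blk hw hg cm b l))

        offset : ℕ → ℕ
        offset l = proj₁ (base-shift hw (it g l (pos b)))

        offset-Sim : ∀ l → Sim m (it w (offset l) (pos (i_ l))) (it g l (pos b))
        offset-Sim l = subst (λ m → Sim m (it w (offset l) (pos (i_ l))) (it g l (pos b)))
          (≡.sym (minus-Blk hw hg cm (blk 0 l ≡.refl))) (proj₂ (base-shift hw (it g l (pos b))))

        zeta-≈ : ∀ l x y → Sim m (it w x (pos (i_ l))) (it w y (pos (i_ l))) → powK (zeta w b) x ≈ powK (zeta w b) y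
        zeta-≈ l x y s = trans (reflexive (cong (λ z → powK z x) (same-zeta l)))
          (trans (Sim⇒zeta-eq hw (i_ l) x y (subst (λ m → Sim m (it w x (pos (i_ l))) (it w y (pos (i_ l))))
            (same-minus l) s))
                 (reflexive (cong (λ z → powK z y) (≡.sym (same-zeta l)))))

        step-cycle : ∀ l → base w (act g (pos (i_ l))) ≡ i_ (suc l)
        step-cycle l = ≡.sym (cycleOf-≡ hw hg cm b (suc l) (Cyc-it {w = w} {g} cm 1 (cycleOf-Cyc hw hg cm b l)))

        step : ∀ l → powK (zeta w b) (offset l) * powK (zeta w b) (shift w g (i_ l)) ≈ powK (zeta w b)
          (offset (suc l))
        step l = trans (sym (powK-+ _ (offset l) s)) (zeta-≈ (suc l) (offset l ℕ.+ s) (offset (suc l))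
          (Sim-trans m (Sim-reflexive m (it-+ w (offset l) s _))
          (Sim-trans m (Sim-it m w (offset l) shifted)
          (Sim-trans m (Sim-reflexive m (it-app cm (offset l) (pos (i_ l))))
          (Sim-trans m (Sim-it m g 1 (offset-Sim l)) (Sim-sym m (offset-Sim (suc l))))))))
          where
          s : ℕ
          s = shift w g (i_ l)
          shifted : Sim m (it w s (pos (i_ (suc l)))) (act g (pos (i_ l)))
          shifted = ≡.subst₂ (λ m j → Sim m (it w s (pos j)) (act g (pos (i_ l)))) (≡.sym (same-minus l))
            (step-cycle l)
                      (shift-Sim hw hg (Comm-sym {w = w} {v = g} cm) (i_ l))

        telescope : ∀ L → Prod.big (upTo L) (λ l → factor w g (i_ l)) * powK (zeta w b) (offset 0) ≈ powK (zeta w b)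
          (offset L)
        telescope zero = *-identityˡ _
        telescope (suc L) = begin
          Prod.big (upTo (suc L)) (λ l → factor w g (i_ l)) * z₀          ≈⟨ *-congʳ (Prod.big-upTo-last L _) ⟩
          Prod.big (upTo L) (λ l → factor w g (i_ l)) * factor w g (i_ L) * z₀ ≈⟨ xy*z≈xz*y _ _ _ ⟩
          Prod.big (upTo L) (λ l → factor w g (i_ l)) * z₀ * factor w g (i_ L)
            ≈⟨ *-cong (telescope L) (reflexive (cong (λ z → powK z (shift w g (i_ L))) (≡.sym (same-zeta L)))) ⟩
          powK (zeta w b) (offset L) * powK (zeta w b) (shift w g (i_ L)) ≈⟨ step L ⟩
          powK (zeta w b) (offset (suc L))                                ∎
          where
          z₀ = powK (zeta w b) (offset 0)

        product : Prod.big (upTo (expG w g b)) (λ l → factor w g (i_ l)) ≈ rho w g b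
        product = *-cancelˡ-unit (proj₁ (zeta-unit hw b (offset 0))) (proj₂ (zeta-unit hw b (offset 0)))
          (trans (*-comm _ _) (trans (telescope e) (trans last (powK-+ _ (offset 0) r))))
          where
          e = expG w g b
          r = expW w g b
          -- The cycle list wraps around here, which allows the offsets at `e` and at 0 to be
          -- compared from one base point.
          closes : i_ e ≡ i_ 0
          closes = cycleOf-≡ hw hg cm b e (Cyc-sym hw (let (link s es) = from (expG-Per hw hg cm b) ∣-refl in cyc s (≡.sym es)))
          last : powK (zeta w b) (offset e) ≈ powK (zeta w b) (offset 0 ℕ.+ r)
          last = zeta-≈ 0 (offset e) (offset 0 ℕ.+ r)
            (Sim-trans m (subst (λ j → Sim m (it w (offset e) (pos j)) (it g e (pos b))) closes (offset-Sim e))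
            (Sim-trans m (Sim-sym m (expW-Sim hw hg cm b))
            (Sim-trans m (Sim-it m w r (Sim-sym m (offset-Sim 0)))
                         (Sim-reflexive m (≡.sym (it-+′ w (offset 0) r _))))))

      omega≈Omega : omega w g ≈ Omega w g
      omega≈Omega = begin
        omega w g
          ≡⟨ omega-factor w g ⟩
        Prod.big bases (factor w g)
          ≈⟨ Prod.big-fibre {xs = bases} {ys = allFin n} (λ b i → eqFin b (blkRep w g i)) (blkRep w g) (factor w g)
            (UniqueP.allFin⁺ n) (λ _ → ∈-allFin _)
               (λ _ → eqFin⁺ ≡.refl) (λ _ _ → eqFin⁻) ⟩
        Prod.big (allFin n) (λ b → Prod.big bases (λ i → if eqFin b (blkRep w g i) then factor w g i else 1#))
          ≈⟨ Prod.big-cong (allFin n) (λ b _ → block b (isRep w g b) ≡.refl) ⟩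
        Omega w g ∎
        where
        bases : List (Fin n)
        bases = filterᵇ (isBase w) (allFin n)
        block : ∀ b t → isRep w g b ≡ t → Prod.big bases (λ i → if eqFin b (blkRep w g i) then factor w g i else 1#) ≈
          (if t then rho w g b else 1#)
        block b false nr = Prod.big-ε bases λ i _ → reflexive
          (cong (λ t → if t then factor w g i else 1#) (¬true⇒false λ e →
          true≢false (eqFin⁺ {i = blkRep w g b} {j = b}
            (≡.trans (cong (blkRep w g) (eqFin⁻ {i = b} e)) (≡.trans (blkRep-idem i) (≡.sym (eqFin⁻ {i = b} e)))))
            nr))
        block b true rep = begin
          Prod.big bases (λ i → if eqFin b (blkRep w g i) then factor w g i else 1#)
            ≈⟨ Prod.big-filter (λ i → eqFin b (blkRep w g i)) bases (factor w g) ⟨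
          Prod.big (filterᵇ (λ i → eqFin b (blkRep w g i)) bases) (factor w g)
            ≈⟨ Prod.big-reindex (cycleOf hw hg cm b) (factor w g) (UniqueP.upTo⁺ e) unique into
                 (λ l∈ k∈ → cycleOf-inj hw hg cm b (∈-upTo⁻ l∈) (∈-upTo⁻ k∈)) onto ⟩
          Prod.big (upTo e) (λ l → factor w g (cycleOf hw hg cm b l))
            ≈⟨ Telescope.product b ⟩
          rho w g b ∎
          where
          e = expG w g b
          unique = UniqueP.filter⁺ (T? ∘ λ i → eqFin b (blkRep w g i)) {xs = bases}
            (UniqueP.filter⁺ (T? ∘ isBase w) (UniqueP.allFin⁺ n))
          into : ∀ {l} → l ∈ upTo e → cycleOf hw hg cm b l ∈ filterᵇ (λ i → eqFin b (blkRep w g i)) bases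
          into {l} _ = ∈-filterᵇ⁺ (λ i → eqFin b (blkRep w g i))
            (∈-filterᵇ⁺ (isBase w) (∈-allFin _) (isBase⁺ hw (cycleOf-base hw hg cm b l)))
            (eqFin⁺ (≡.trans (≡.sym (eqFin⁻ rep)) (blkRep-≡ (cycleOf-Blk hw hg cm b l))))
          onto : ∀ {i} → i ∈ filterᵇ (λ i → eqFin b (blkRep w g i)) bases → ∃ λ l →
            l ∈ upTo e × cycleOf hw hg cm b l ≡ i
          onto {i} i∈ with ∈-filterᵇ⁻ (λ i → eqFin b (blkRep w g i)) {bases} i∈
          ... | i∈b , eb with cycleOf-surj hw hg cm b (isBase⁻ hw (proj₂ (∈-filterᵇ⁻ (isBase w) {allFin n} i∈b)))
                   (blkRep-≡⁻ (≡.trans (eqFin⁻ rep) (eqFin⁻ eb)))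
          ... | l , l< , el = l , ∈-upTo⁺ l< , el

open OmegaFactorization

-- The factor of a block determines the return exponent.

module CycleValues where
  open import Data.Bool using (Bool; true; false; _∧_; if_then_else_)
  open import Data.Bool.Properties using (∧-zeroʳ)
  open import Data.Nat using (_<_; NonZero; >-nonZero)
  import Data.Nat as ℕ
  import Data.Nat.Properties as ℕP
  open import Data.Nat.Divisibility
  open import Data.Fin using (Fin)
  open import Data.Product using (_,_; proj₁; proj₂; ∃)
  open import Data.Sum using (inj₁; inj₂)
  open import Relation.Binary.PropositionalEquality as ≡ using (_≡_; cong; subst)
  open import Relation.Nullary using (contradiction; ¬_)
  import Relation.Binary.Reasoning.Setoid as SetoidReasoning

  module _ {n : ℕ} where

    order : SP n → Fin n → ℕ
    order w i = if minus w i then 2 ℕ.* clen w i else clen w i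

    order′ : Bool → ℕ → ℕ
    order′ b h = if b then 2 ℕ.* h else h

    module _ {w : SP n} (hw : Perm w) (i : Fin n) where

      opaque
        plus-exact : minus w i ≡ false → ∀ {a} → ix (it w a (pos i)) ≡ i → it w a (pos i) ≡ pos i
        plus-exact m {a} e with to (clen-Per hw i) {a} e
        ... | divides u ≡.refl = ≡.trans (it-clen-mul hw i u)
          (cong (λ b → sg b (pos i)) (≡.trans (cong (par u ∧_) m) (∧-zeroʳ (par u))))

        plus-exact₂ : minus w i ≡ false → ∀ a b → ix (it w a (pos i)) ≡ ix (it w b (pos i)) →
          it w a (pos i) ≡ it w b (pos i)
        plus-exact₂ m a b e with ℕP.≤-total a b
        ... | inj₁ a≤b with ℕP.m≤n⇒∃[o]m+o≡n a≤b
        ...   | c , ≡.refl = ≡.sym (≡.trans (it-+ w a c (pos i))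
          (cong (it w a) (plus-exact m {c} (it-ix-inj hw a {q = pos i}
          (≡.trans (cong ix (≡.sym (it-+ w a c (pos i)))) (≡.sym e))))))
        plus-exact₂ m a b e | inj₂ b≤a with ℕP.m≤n⇒∃[o]m+o≡n b≤a
        ...   | c , ≡.refl = ≡.trans (it-+ w b c (pos i))
          (cong (it w b) (plus-exact m {c} (it-ix-inj hw b {q = pos i}
          (≡.trans (cong ix (≡.sym (it-+ w b c (pos i)))) e))))

        order-Per : Per (λ a → it w a (pos i) ≡ pos i) (order w i)
        order-Per = go (minus w i) ≡.refl
          where
          go : ∀ b → minus w i ≡ b → Per (λ a → it w a (pos i) ≡ pos i) (order′ b (clen w i))
          go false m = record { positive = positive (clen-Per hw i) ; to = λ {a} e →
            to (clen-Per hw i) {a} (cong ix e)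
            ; from = λ {a} d → plus-exact m {a} (from (clen-Per hw i) d) }
          go true m = record { positive = ℕP.<-≤-trans (positive (clen-Per hw i)) (ℕP.m≤m+n (clen w i) _)
            ; to = λ {a} → Sim-period-minus hw i m {a}
            ; from = λ { (divides u ≡.refl) → it-mul w (it-clen-mul hw i 2) u } }

  -- The elements y considered share the g-cycle of p, its first return time d under y, and the sign ε;
  -- they differ in the exponent σ with which y returns to that cycle.
  record Member {n : ℕ} (g : SP n) (j : Fin n) (ε : Bool) (d σ : ℕ) (y : SP n) : Set where
    field
      perm : Perm y
      comm : Comm y g
      first-return : Per (Link y g (pos j)) d
      return : it y d (pos j) ≡ sg ε (it g σ (pos j))

  -- Two descriptions of one block: the `g`-cycle of `p` has length `m` and `y` returns to it every
  -- `d` steps; the `y`-cycle has length `h` and `g` returns to it every `e` steps.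
  -- `M = m / e = h / d` counts the absolute values common to both cycles. The condition on `ε` is a
  -- normalization: on a negative `g`-cycle -1 is a power of `g` and is absorbed into `σ`.
  module MemberFacts {n : ℕ} {g : SP n} (hg : Perm g) {j : Fin n} {ε : Bool} (εty : ε ≡ true → minus g j ≡ false) {d σ : ℕ} {y : SP n}
    (mem : Member g j ε d σ y) where
    open Member mem

    p : Pt n
    p = pos j

    m e R h : ℕ
    m = clen g j
    e = expG y g j
    R = expW y g j
    h = clen y j
    κ : Bool
    κ = minus y j

    perE : Per (Link g y p) e
    perE = expG-Per perm hg comm j

    simR : Sim κ (it y R p) (it g e p)
    simR = expW-Sim perm hg comm j

    simR-mul : ∀ x → Sim κ (it y (x ℕ.* R) p) (it g (x ℕ.* e) p)
    simR-mul = Sim-power κ comm simR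

    opaque
      e∣m : e ∣ m
      e∣m = to perE (link 0 (from (clen-Per hg j) ∣-refl))

      e∣σ : e ∣ σ
      e∣σ = to perE {σ} (link d (≡.sym (cong ix return)))

      d∣R : d ∣ R
      d∣R = to first-return {R} (link e (Sim⇒ix κ simR))

    M : ℕ
    M = quotient e∣m

    m≡Me : m ≡ M ℕ.* e
    m≡Me = _∣_.equality e∣m

    s₁ : ℕ
    s₁ = quotient e∣σ

    σ≡s₁e : σ ≡ s₁ ℕ.* e
    σ≡s₁e = _∣_.equality e∣σ

    instance
      e-nonZero : NonZero e
      e-nonZero = >-nonZero (positive perE)

    M>0 : 0 < M
    M>0 = ℕP.n≢0⇒n>0 λ M≡0 → ℕP.n≮0 (subst (0 <_) (≡.trans m≡Me (cong (ℕ._* e) M≡0)) (positive (clen-Per hg j)))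

    return-mul : ∀ u → it y (u ℕ.* d) p ≡ sg (par u ∧ ε) (it g (u ℕ.* σ) p)
    return-mul = it-power comm {d} {σ} {ε} {p} return

    Mσ : M ℕ.* σ ≡ s₁ ℕ.* m
    Mσ = ≡.trans (cong (M ℕ.*_) σ≡s₁e) (≡.trans (≡.sym (ℕP.*-assoc M s₁ e))
      (≡.trans (cong (ℕ._* e) (ℕP.*-comm M s₁)) (≡.trans (ℕP.*-assoc s₁ M e) (cong (s₁ ℕ.*_) (≡.sym m≡Me)))))

    m∣x*e⇒M∣x : ∀ x → m ∣ x ℕ.* e → M ∣ x
    m∣x*e⇒M∣x x div = *-cancelʳ-∣ e (subst (_∣ x ℕ.* e) m≡Me div)

    opaque
      -- The two counts `d m` and `e h` of the block agree; here this is derived from return times.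
      h≡Md : h ≡ M ℕ.* d
      h≡Md = Per-unique (clen-Per perm j) record
        { positive = ℕP.*-mono-≤ M>0 (positive first-return)
        ; to = λ {a} ea → to′ ea (to first-return {a} (link 0 ea))
        ; from = λ { (divides k ≡.refl) → from′ k } }
        where
        to′ : ∀ {a} → ix (it y a p) ≡ j → d ∣ a → M ℕ.* d ∣ a
        to′ ea (divides u ≡.refl) = *-monoˡ-∣ d (m∣x*e⇒M∣x u (to (clen-Per hg j) {u ℕ.* e} (back d∣R)))
          where
          uσ : ix (it g (u ℕ.* σ) p) ≡ j
          uσ = ≡.trans (≡.sym (cong ix (return-mul u))) ea
          -- With `R = u′ d`, the points `g^e p`, `y^R p` and `g^(u′ σ) p` agree up to sign. Hence
          -- `u e` steps of `g` amount to `u′` times `u σ` steps, and `u σ` steps return.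
          back : d ∣ R → ix (it g (u ℕ.* e) p) ≡ j
          back (divides u′ R≡) = ≡.trans (≡.sym (it-power-ix {y = g} {g} (Comm-self g) {u′ ℕ.* σ} {e} {p}
              (≡.trans (≡.sym (cong ix (return-mul u′))) (≡.trans (cong (λ r → ix (it y r p)) (≡.sym R≡))
                (Sim⇒ix κ simR))) u))
            (≡.trans (cong (λ x → ix (it g x p)) (swap u u′ σ)) (it-mul-ix g {u ℕ.* σ} {p} uσ u′))
            where
            swap : ∀ a b c → a ℕ.* (b ℕ.* c) ≡ b ℕ.* (a ℕ.* c)
            swap a b c = ≡.trans (≡.sym (ℕP.*-assoc a b c))
              (≡.trans (cong (ℕ._* c) (ℕP.*-comm a b)) (ℕP.*-assoc b a c))
        from′ : ∀ k → ix (it y (k ℕ.* (M ℕ.* d)) p) ≡ j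
        from′ k = it-mul-ix y {M ℕ.* d} {p} (≡.trans (cong ix (return-mul M))
          (≡.trans (cong (λ x → ix (it g x p)) Mσ) (from (clen-Per hg j) (divides s₁ ≡.refl)))) k

      sign-h : sg κ p ≡ sg (par M ∧ ε) (it g (s₁ ℕ.* m) p)
      sign-h = ≡.trans (≡.sym (it-clen perm j)) (≡.trans (cong (λ x → it y x p) h≡Md)
        (≡.trans (return-mul M) (cong (λ x → sg (par M ∧ ε) (it g x p)) Mσ)))

      -- One turn of the `y`-cycle consists of `M` returns to the `g`-cycle, each contributing the
      -- sign `ε`; a positive `g`-cycle adds no sign of its own.
      κ-formula : minus g j ≡ false → κ ≡ par M ∧ ε
      κ-formula ty = sign-eq (≡.trans sign-h (cong (sg (par M ∧ ε))
        (plus-exact hg j ty {s₁ ℕ.* m} (from (clen-Per hg j) (divides s₁ ≡.refl)))))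
        where
        sign-eq : ∀ {a b} → sg a p ≡ sg b p → a ≡ b
        sign-eq {true} {true} _ = ≡.refl
        sign-eq {false} {false} _ = ≡.refl

      ε-false : minus g j ≡ true → ε ≡ false
      ε-false ty = ¬true⇒false λ eε → true≢false ty (εty eε)

      -- For even `M` the unknown sign in `g^e p = ± y^R p` disappears in the `M`-th power. Since
      -- `g^(M e) p = g^m p` is the negative of `p`, the `y`-cycle would then contain that negative.
      plus⇒M-odd : minus g j ≡ true → κ ≡ false → par M ≡ true
      plus⇒M-odd ty κf = go (par M) ≡.refl
        where
        go : ∀ b → par M ≡ b → b ≡ true
        go true _ = ≡.refl
        go false even with ix≡⇒sg {p = it g e p} {q = it y R p} (≡.sym (Sim⇒ix κ simR))
        ... | b , eb = contradiction κf (true≢false (minus⁺ perm j (M ℕ.* R)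
              (≡.trans (≡.sym (≡.trans (it-power (Comm-sym {w = y} {v = g} comm) {e} {R} {b} {p} eb M)
                (cong (λ x → sg (x ∧ b) (it y (M ℕ.* R) p)) even)))
                (≡.trans (cong (λ x → it g x p) (≡.sym m≡Me)) (≡.trans (it-clen hg j) (cong (λ b → sg b p) ty))))))

    -- An exponent at which `y` acts on `p` like `g^σ`. If `ε` is -1, an extra turn `y^h` supplies
    -- the missing sign when the `y`-cycle is negative; when it is positive, `Sim` does not see the
    -- sign.
    D : ℕ
    D = d ℕ.+ (if ε then h else 0)

    opaque
      simD : Sim κ (it y D p) (it g σ p)
      simD = go ε ≡.refl κ ≡.refl
        where
        go : ∀ a → ε ≡ a → ∀ b → κ ≡ b → Sim b (it y (d ℕ.+ (if a then h else 0)) p) (it g σ p)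
        go false eε b _ = Sim-reflexive b (≡.trans (cong (λ x → it y x p) (ℕP.+-identityʳ d))
          (≡.trans return (cong (λ b → sg b (it g σ p)) eε)))
        go true eε b eκ = subst (λ b → Sim b (it y (d ℕ.+ h) p) (it g σ p)) eκ
          (Sim-trans κ (Sim-reflexive κ turn) (flip κ))
          where
          turn : it y (d ℕ.+ h) p ≡ sg κ (sg true (it g σ p))
          turn = ≡.trans (it-+ y d h p) (≡.trans (cong (it y d) (it-clen perm j)) (≡.trans (it-sg y d κ p)
            (cong (sg κ) (≡.trans return (cong (λ b → sg b (it g σ p)) eε)))))
          flip : ∀ b → Sim b (sg b (sg true (it g σ p))) (it g σ p)
          flip true = sg-invol true (it g σ p)
          flip false = ≡.refl

  module LocalValues {c ℓ} (F : Field' c ℓ) (n : ℕ) (α β : ℕ → Field'.Carrier F)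
    (prim : ∀ i → 1 ≤ i → i ≤ n → FieldOps.PrimRoot F i (α i) × FieldOps.PrimRoot F (2 ℕ.* i) (β i)) where
    open FieldLemmas F
    open SetoidReasoning setoid
    open Zeta F n α β prim

    module RhoFacts {g : SP n} (hg : Perm g) {j : Fin n} {ε : Bool} (εty : ε ≡ true → minus g j ≡ false) {d σ : ℕ} {y : SP n}
      (mem : Member g j ε d σ y) where
      open Member mem
      open MemberFacts hg εty mem public

      opaque
        rho-one⇒Sim : ∀ x → powK (rho y g j) x ≈ 1# → Sim κ (it g (x ℕ.* e) p) p
        rho-one⇒Sim x one = Sim-trans κ (Sim-sym κ (simR-mul x))
          (zeta-one⇒Sim perm j {x ℕ.* R} (trans (powK-* (zeta y j) R x) one))

        Sim⇒rho-one : ∀ x → Sim κ (it g (x ℕ.* e) p) p → powK (rho y g j) x ≈ 1#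
        Sim⇒rho-one x s = trans (sym (powK-* (zeta y j) R x))
          (Sim⇒zeta-one perm j {x ℕ.* R} (Sim-trans κ (simR-mul x) s))

        -- Together with `rho-M` and `rho-2M` this leaves only `M` and `2 * M` as the order of ρ, so
        -- ρ nearly determines `M`; parity decides between the two in `same-M`.
        rho-one⇒M∣ : ∀ x → powK (rho y g j) x ≈ 1# → M ∣ x
        rho-one⇒M∣ x one = m∣x*e⇒M∣x x (to (clen-Per hg j) {x ℕ.* e} (Sim⇒ix κ (rho-one⇒Sim x one)))

        rho-order : powK (rho y g j) (order g j) ≈ 1#
        rho-order = Sim⇒rho-one (order g j) (Sim-reflexive κ (from (order-Per hg j) (m∣m*n e)))

        -- As `d ∣ R`, the power `ρ^l = ζ^(l R)` is a power of `ζ^(l d)`.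
        rho-return : ∀ l → it y (l ℕ.* d) p ≡ p → powK (rho y g j) l ≈ 1#
        rho-return l el = trans (sym (powK-* (zeta y j) R l)) (go d∣R)
          where
          go : d ∣ R → powK (zeta y j) (l ℕ.* R) ≈ 1#
          go (divides u R≡) = trans (reflexive (cong (powK (zeta y j))
            (≡.trans (cong (l ℕ.*_) R≡) (≡.trans (≡.sym (ℕP.*-assoc l u d))
              (≡.trans (cong (ℕ._* d) (ℕP.*-comm l u)) (ℕP.*-assoc u l d))))))
            (Sim⇒zeta-one perm j {u ℕ.* (l ℕ.* d)} (Sim-reflexive κ (it-mul y el u)))

        rho-M : κ ≡ false ⊎ minus g j ≡ false → powK (rho y g j) M ≈ 1#
        rho-M c = Sim⇒rho-one M (subst (λ x → Sim κ (it g x p) p) m≡Me (back c))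
          where
          back : κ ≡ false ⊎ minus g j ≡ false → Sim κ (it g m p) p
          back (inj₁ κf) = subst (λ b → Sim b (it g m p) p) (≡.sym κf) (from (clen-Per hg j) ∣-refl)
          back (inj₂ tf) = Sim-reflexive κ (plus-exact hg j tf {m} (from (clen-Per hg j) ∣-refl))

        rho-2M : powK (rho y g j) (2 ℕ.* M) ≈ 1#
        rho-2M = Sim⇒rho-one (2 ℕ.* M) (Sim-reflexive κ
          (≡.trans (cong (λ x → it g x p) (≡.trans (ℕP.*-assoc 2 M e) (cong (2 ℕ.*_) (≡.sym m≡Me))))
          (it-clen-mul hg j 2)))

    module Distinct {g : SP n} (hg : Perm g) {j : Fin n} {ε : Bool} (εty : ε ≡ true → minus g j ≡ false) {d : ℕ} where

      private
        module R {σ : ℕ} {y : SP n} (mem : Member g j ε d σ y) = RhoFacts hg εty mem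

      double-cancel : ∀ c M e x → c ≡ M ℕ.* e → 0 < e → 2 ℕ.* c ∣ x ℕ.* e → 2 ℕ.* M ∣ x
      double-cancel c M e x ec pos div = *-cancelʳ-∣ e {{>-nonZero pos}}
        (subst (_∣ x ℕ.* e) (≡.trans (cong (2 ℕ.*_) ec) (≡.sym (ℕP.*-assoc 2 M e))) div)

      opaque
        2M∣ : ∀ {σ y} (a : Member g j ε d σ y) → minus g j ≡ true → minus y j ≡ true → ∀ x → powK (rho y g j) x ≈ 1# →
          2 ℕ.* R.M a ∣ x
        2M∣ {σ} {y} a ty κe x one = double-cancel (clen g j) (R.M a) (R.e a) x (R.m≡Me a) (positive (R.perE a))
          (Sim-period-minus hg j ty {x ℕ.* R.e a} (subst (λ k → Sim k (it g (x ℕ.* R.e a) (pos j)) (pos j)) κe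
            (R.rho-one⇒Sim a x one)))

        -- On a negative `g`-cycle, class -1 of `y′` makes the order of ρ even, while class +1 of
        -- `y` makes it divide an odd `M`.
        mixed : ∀ {σ σ′ y y′} (a : Member g j ε d σ y) (b : Member g j ε d σ′ y′) → rho y g j ≈ rho y′ g j →
          minus g j ≡ true →
                minus y j ≡ false → ¬ (minus y′ j ≡ true)
        mixed a b e ty κe κe′ = true≢false (R.plus⇒M-odd a ty κe)
          (2∣⇒even (∣-trans (m∣m*n {2} (R.M b)) (2M∣ b ty κe′ (R.M a)
            (trans (powK-cong (R.M a) (sym e)) (R.rho-M a (inj₁ κe))))))

        M∣M : ∀ {σ σ′ y y′} (a : Member g j ε d σ y) (b : Member g j ε d σ′ y′) → rho y g j ≈ rho y′ g j →
          minus g j ≡ true →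
              ∀ κ κ′ → minus y j ≡ κ → minus y′ j ≡ κ′ → R.M b ∣ R.M a × κ ≡ κ′
        M∣M a b e ty false false κe κe′ = R.rho-one⇒M∣ b (R.M a)
          (trans (powK-cong (R.M a) (sym e)) (R.rho-M a (inj₁ κe))) , ≡.refl
        M∣M a b e ty true true κe κe′ = *-cancelˡ-∣ 2
          (2M∣ b ty κe′ (2 ℕ.* R.M a) (trans (powK-cong (2 ℕ.* R.M a) (sym e)) (R.rho-2M a))) , ≡.refl
        M∣M a b e ty false true κe κe′ = contradiction κe′ (mixed a b e ty κe)
        M∣M a b e ty true false κe κe′ = contradiction κe (mixed b a (sym e) ty κe′)

      opaque
        same-M : ∀ {σ σ′ y y′} (a : Member g j ε d σ y) (b : Member g j ε d σ′ y′) → rho y g j ≈ rho y′ g j →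
                 R.M a ≡ R.M b × minus y j ≡ minus y′ j
        same-M {σ} {σ′} {y} {y′} a b e = go (minus g j) ≡.refl
          where
          go : ∀ t → minus g j ≡ t → R.M a ≡ R.M b × minus y j ≡ minus y′ j
          go false tf = M≡ , ≡.trans (R.κ-formula a tf)
            (≡.trans (cong (λ M → par M ∧ ε) M≡) (≡.sym (R.κ-formula b tf)))
            where
            M≡ : R.M a ≡ R.M b
            M≡ = ∣-antisym (R.rho-one⇒M∣ a (R.M b) (trans (powK-cong (R.M b) e) (R.rho-M b (inj₂ tf))))
                           (R.rho-one⇒M∣ b (R.M a) (trans (powK-cong (R.M a) (sym e)) (R.rho-M a (inj₂ tf))))
          go true ty = ∣-antisym (proj₁ (M∣M b a (sym e) ty _ _ ≡.refl ≡.refl))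
            (proj₁ (M∣M a b e ty _ _ ≡.refl ≡.refl)) , proj₂ (M∣M a b e ty _ _ ≡.refl ≡.refl)

      -- Once `M` agrees, so do `h = M d`, `e = m / M`, the class, ζ and `D`. As `g^σ` is `g^e`
      -- taken `s₁` times, `ζ^D` is the `s₁`-th power of ρ. Equal ρ thus gives
      -- `ζ^(sa Ra) = ζ^(sb Ra)`, which translates back into agreement of `g^σ p` and `g^σ′ p` up to
      -- `Sim`.
      module Pair {σ σ′ : ℕ} {y y′ : SP n} (a : Member g j ε d σ y) (bm : Member g j ε d σ′ y′) (eρ : rho y g j ≈ rho y′ g j) where
        open Member a using (perm)
        p : Pt n
        p = pos j
        κ : Bool
        κ = minus y j
        opaque
          M≡ : R.M a ≡ R.M bm
          M≡ = proj₁ (same-M a bm eρ)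
        opaque
          κ≡ : κ ≡ minus y′ j
          κ≡ = proj₂ (same-M a bm eρ)
        opaque
          h≡ : clen y j ≡ clen y′ j
          h≡ = ≡.trans (R.h≡Md a) (≡.trans (cong (ℕ._* d) M≡) (≡.sym (R.h≡Md bm)))
        opaque
          e≡ : R.e a ≡ R.e bm
          e≡ = ℕP.*-cancelˡ-≡ _ _ (R.M a) {{>-nonZero (R.M>0 a)}}
            (≡.trans (≡.sym (R.m≡Me a)) (≡.trans (R.m≡Me bm) (cong (ℕ._* R.e bm) (≡.sym M≡))))
        opaque
          ζ≡ : zeta y j ≡ zeta y′ j
          ζ≡ = ≡.cong₂ zeta′ κ≡ h≡
        ζ : Carrier
        ζ = zeta y j
        Ra Rb sa sb : ℕ
        Ra = R.R a
        Rb = R.R bm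
        sa = R.s₁ a
        sb = R.s₁ bm
        opaque
          powers-a : powK ζ (R.D a) ≈ powK ζ (sa ℕ.* Ra)
          powers-a = Sim⇒zeta-eq perm j (R.D a) (sa ℕ.* Ra) (Sim-trans κ (R.simD a)
            (Sim-sym κ (subst (λ x → Sim κ (it y (sa ℕ.* Ra) p) (it g x p)) (≡.sym (R.σ≡s₁e a)) (R.simR-mul a sa))))
        opaque
          powers-b : powK ζ (R.D bm) ≈ powK ζ (sb ℕ.* Ra)
          powers-b = begin
            powK ζ (R.D bm)                    ≡⟨ cong (λ z → powK z (R.D bm)) ζ≡ ⟩
            powK (zeta y′ j) (R.D bm)          ≈⟨ Sim⇒zeta-eq (Member.perm bm) j (R.D bm) (sb ℕ.* Rb)
              (Sim-trans (minus y′ j) (R.simD bm)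
                                                   (Sim-sym (minus y′ j) (subst (λ x → Sim (minus y′ j)
                                                     (it y′ (sb ℕ.* Rb) p) (it g x p)) (≡.sym (R.σ≡s₁e bm))
                                                     (R.simR-mul bm sb)))) ⟩
            powK (zeta y′ j) (sb ℕ.* Rb)      ≈⟨ powK-* (zeta y′ j) Rb sb ⟩
            powK (rho y′ g j) sb              ≈⟨ powK-cong sb eρ ⟨
            powK (rho y g j) sb               ≈⟨ powK-* ζ Ra sb ⟨
            powK ζ (sb ℕ.* Ra)                ∎
        opaque
          D≡ : R.D a ≡ R.D bm
          D≡ = cong (λ h → d ℕ.+ (if ε then h else 0)) h≡
        opaque
          sim : Sim κ (it g σ p) (it g σ′ p)
          sim = ≡.subst₂ (λ x x′ → Sim κ (it g x p) (it g x′ p)) (≡.sym (R.σ≡s₁e a))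
            (≡.sym (≡.trans (R.σ≡s₁e bm) (cong (sb ℕ.*_) (≡.sym e≡))))
            (Sim-trans κ (Sim-sym κ (R.simR-mul a sa)) (Sim-trans κ
              (zeta-eq⇒Sim perm j (sa ℕ.* Ra) (sb ℕ.* Ra) (trans (sym powers-a)
                (trans (reflexive (cong (powK ζ) D≡)) powers-b)))
              (R.simR-mul a sb)))
        closed : ∀ {σ y} (m : Member g j ε d σ y) → R.M m ≡ R.M a → minus y j ≡ false → minus g j ≡ true →
          it g (R.M a ℕ.* σ) p ≡ p
        closed {σ} {y} m eM eκ te = ≡.trans (≡.sym
          (≡.trans (R.return-mul m (R.M a)) (cong (λ b → sg b (it g (R.M a ℕ.* σ) p))
          (≡.trans (cong (par (R.M a) ∧_) (R.ε-false m te)) (∧-zeroʳ (par (R.M a)))))))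
          (≡.trans (cong (λ x → it y x p) (≡.trans (cong (ℕ._* d) (≡.sym eM)) (≡.sym (R.h≡Md m))))
            (≡.trans (it-clen (Member.perm m) j) (cong (λ b → sg b p) eκ)))
        -- The case where both `Sim` and `g` leave a sign open. As `y^h` fixes `p` and `h = M d`,
        -- both `g^(M σ)` and `g^(M σ′)` fix `p`; since `M` is odd, a sign between `g^σ p` and
        -- `g^σ′ p` would survive in the `M`-th power.
        plus-minus : κ ≡ false → minus g j ≡ true → (∃ λ b → it g σ p ≡ sg b (it g σ′ p)) → it g σ p ≡ it g σ′ p
        plus-minus κe te (b , eb) = ≡.trans eb (cong (λ b → sg b (it g σ′ p)) b-false)
          where
          M : ℕ
          M = R.M a
          b-false : b ≡ false
          b-false = sg-fix {a = b} {p = p} (≡.trans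
            (cong (sg b) (≡.sym (closed bm (≡.sym M≡) (≡.trans (≡.sym κ≡) κe) te)))
            (≡.trans (cong (λ x → sg (x ∧ b) (it g (M ℕ.* σ′) p)) (≡.sym (R.plus⇒M-odd a te κe)))
              (≡.trans (≡.sym (it-power (Comm-self g) {σ} {σ′} {b} {p} eb M)) (closed a ≡.refl κe te))))
        exact : ∀ k → κ ≡ k → ∀ t → minus g j ≡ t → it g σ p ≡ it g σ′ p
        exact true κe t te = subst (λ k → Sim k (it g σ p) (it g σ′ p)) κe sim
        exact false κe false te = plus-exact₂ hg j te σ σ′ (Sim⇒ix κ sim)
        exact false κe true te = plus-minus κe te (ix≡⇒sg {p = it g σ p} {q = it g σ′ p} (Sim⇒ix κ sim))

      opaque
        rho-injective : ∀ {σ σ′ y y′} (a : Member g j ε d σ y) (b : Member g j ε d σ′ y′) → rho y g j ≈ rho y′ g j →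
                        it g σ (pos j) ≡ it g σ′ (pos j)
        rho-injective {y = y} a b eρ = Pair.exact a b eρ (minus y j) ≡.refl (minus g j) ≡.refl

open CycleValues

-- Linear congruences and sums of roots of unity.

module CongruenceCounting where
  open import Function using (_∘_)
  open import Data.Bool using (Bool; true; false; if_then_else_; T?)
  open import Data.Nat using (zero; suc; _+_; _*_; _<_; z≤n; s≤s; NonZero; ≢-nonZero⁻¹)
  import Data.Nat as ℕ
  import Data.Nat.Properties as ℕP
  open import Data.Nat.Properties using (+-0-commutativeMonoid)
  open import Data.Nat.Divisibility
  open import Data.Nat.GCD using (gcd; gcd[m,n]∣m; gcd[m,n]∣n; gcd-greatest; c*gcd[m,n]≡gcd[cm,cn]; gcd[m,n]≢0; gcd-GCD; module Bézout)
  open import Data.Nat.Solver using (module +-*-Solver)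
  open import Data.Product using (_,_; ∃)
  open import Data.Sum using (inj₁)
  open import Data.List using (List; []; _∷_; map; filterᵇ; upTo; length)
  open import Data.List.Properties using (length-map)
  open import Data.List.Membership.Propositional.Properties using (∈-upTo⁻)
  open import Data.List.Relation.Unary.Any using (here; there)
  open import Data.List.Relation.Unary.All using (All; []; _∷_)
  import Data.List.Relation.Unary.All as All
  import Data.List.Relation.Unary.All.Properties as AllP
  open import Data.List.Relation.Unary.AllPairs using (AllPairs; []; _∷_)
  open import Data.List.Relation.Unary.Unique.Propositional using (Unique)
  import Data.List.Relation.Unary.Unique.Propositional.Properties as UniqueP
  open import Relation.Binary.PropositionalEquality as ≡ using (_≡_; refl; sym; trans; cong; cong₂; subst; module ≡-Reasoning)
  open import Relation.Nullary using (contradiction; ¬_)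

  module Count = Big +-0-commutativeMonoid

  ind : Bool → ℕ
  ind b = if b then 1 else 0

  big-upTo-+ : ∀ a b (f : ℕ → ℕ) → Count.big (upTo (a + b)) f ≡ Count.big (upTo a) f + Count.big (upTo b)
    (λ s → f (a + s))
  big-upTo-+ zero b f = refl
  big-upTo-+ (suc a) b f = trans (Count.big-upTo-first (a + b) f)
    (trans (cong (f 0 +_) (big-upTo-+ a b (f ∘ suc)))
      (trans (sym (ℕP.+-assoc (f 0) _ _)) (cong (_+ Count.big (upTo b) (λ s → f (suc a + s)))
      (sym (Count.big-upTo-first a f)))))

  module _ (o : ℕ) where

    Periodic : (ℕ → ℕ) → Set
    Periodic f = ∀ s → f (o + s) ≡ f s

    -- Sliding the window by one exchanges the term `f 0` for `f o`, which has the same value.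
    count-shift : ∀ s₀ (f : ℕ → ℕ) → Periodic f → Count.big (upTo o) (λ s → f (s₀ + s)) ≡ Count.big (upTo o) f
    count-shift zero f per = refl
    count-shift (suc s₀) f per = trans (count-shift s₀ (f ∘ suc)
      (λ s → trans (cong f (sym (ℕP.+-suc o s))) (per (suc s))))
      (ℕP.+-cancelˡ-≡ (f 0) _ _ (begin
        f 0 + Count.big (upTo o) (f ∘ suc) ≡⟨ Count.big-upTo-first o f ⟨
        Count.big (upTo (suc o)) f         ≡⟨ Count.big-upTo-last o f ⟩
        Count.big (upTo o) f + f o         ≡⟨ cong (Count.big (upTo o) f +_)
          (trans (cong f (sym (ℕP.+-identityʳ o))) (per 0)) ⟩
        Count.big (upTo o) f + f 0         ≡⟨ ℕP.+-comm _ (f 0) ⟩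
        f 0 + Count.big (upTo o) f         ∎))
      where open ≡-Reasoning

    count-mul : ∀ q (f : ℕ → ℕ) → Periodic f → Count.big (upTo (q * o)) f ≡ q * Count.big (upTo o) f
    count-mul zero f per = refl
    count-mul (suc q) f per = trans (big-upTo-+ o (q * o) f)
      (cong (Count.big (upTo o) f +_) (trans (Count.big-cong (upTo (q * o)) (λ s _ → per s)) (count-mul q f per)))

  module _ (o : ℕ) .{{_ : NonZero o}} (l : ℕ) where

    private
      q : ℕ
      q = gcd o l

      instance
        q≢0 : NonZero q
        q≢0 = ℕ.≢-nonZero (gcd[m,n]≢0 o l (inj₁ (≢-nonZero⁻¹ o)))

      o₁ : ℕ
      o₁ = quotient (gcd[m,n]∣m o l)

      o≡ : o ≡ q * o₁
      o≡ = trans (_∣_.equality (gcd[m,n]∣m o l)) (ℕP.*-comm o₁ q)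

      o₁>0 : 0 < o₁
      o₁>0 = ℕP.n≢0⇒n>0 λ e → ≢-nonZero⁻¹ o (trans o≡ (trans (cong (q *_) e) (ℕP.*-zeroʳ q)))

      root⇒ : ∀ {σ} → o ∣ l * σ → o₁ ∣ σ
      root⇒ {σ} div = *-cancelˡ-∣ q (subst (_∣ q * σ) o≡
        (subst (o ∣_) (trans (sym (c*gcd[m,n]≡gcd[cm,cn] σ o l)) (ℕP.*-comm σ q))
        (gcd-greatest (n∣m*n σ {o}) (subst (o ∣_) (ℕP.*-comm l σ) div))))

      root⇐ : ∀ {σ} → o₁ ∣ σ → o ∣ l * σ
      root⇐ {σ} div = subst (_∣ l * σ) (sym o≡) (*-pres-∣ (gcd[m,n]∣n o l) div)

      count-one : ∀ r (P : ℕ → Bool) → 0 < r → (∀ {s} → P s ≡ true → r ∣ s) → (∀ {s} → r ∣ s → P s ≡ true) →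
                  Count.big (upTo r) (ind ∘ P) ≡ 1
      count-one (suc r) P _ to from = trans (Count.big-upTo-first r (ind ∘ P)) (cong₂ _+_ (cong ind (from (suc r ∣0)))
        (Count.big-ε (upTo r) λ s s∈ → cong ind (¬true⇒false λ ps → ℕP.<⇒≱ (s≤s (∈-upTo⁻ s∈)) (∣⇒≤ (to ps)))))

    -- With `o = q * o₁`, the condition `o ∣ l * σ` says `o₁ ∣ σ`; a window of length `o` contains
    -- `q` such numbers wherever it starts.
    count-roots : (P : ℕ → Bool) → (∀ {σ} → P σ ≡ true → o ∣ l * σ) → (∀ {σ} → o ∣ l * σ → P σ ≡ true) →
      ∀ s₀ → Count.big (upTo o) (λ s → ind (P (s₀ + s))) ≡ gcd o l
    count-roots P to from s₀ = begin
      Count.big (upTo o) (λ s → ind (P (s₀ + s))) ≡⟨ count-shift o s₀ (ind ∘ P) per-o ⟩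
      Count.big (upTo o) (ind ∘ P)                ≡⟨ cong (λ m → Count.big (upTo m) (ind ∘ P)) o≡ ⟩
      Count.big (upTo (q * o₁)) (ind ∘ P)         ≡⟨ count-mul o₁ q (ind ∘ P) per ⟩
      q * Count.big (upTo o₁) (ind ∘ P)           ≡⟨ cong (q *_) (count-one o₁ P o₁>0 (root⇒ ∘ to) (from ∘ root⇐)) ⟩
      q * 1                                       ≡⟨ ℕP.*-identityʳ q ⟩
      q                                           ∎
      where
      open ≡-Reasoning
      per : Periodic o₁ (ind ∘ P)
      per s = cong ind (bool-ext (λ h → from (root⇐ (∣m+n∣m⇒∣n (root⇒ (to h)) ∣-refl)))
        (λ h → from (root⇐ (∣m∣n⇒∣m+n ∣-refl (root⇒ (to h))))))
      per-o : Periodic o (ind ∘ P)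
      per-o s = cong ind (bool-ext (λ h → from (∣m+n∣m⇒∣n (subst (o ∣_) (ℕP.*-distribˡ-+ l o s) (to h)) (n∣m*n l)))
                                   (λ h → from (subst (o ∣_) (sym (ℕP.*-distribˡ-+ l o s))
                                     (∣m∣n⇒∣m+n (n∣m*n l) (to h)))))

  -- The congruence l σ ≡ 1 (mod suc o) is written suc o ∣ l * σ + o.
  module _ (o l : ℕ) where

    unit-solution : gcd (suc o) l ≡ 1 → ∃ λ s → suc o ∣ l * s + o
    unit-solution q≡1 with Bézout.identity (gcd-GCD (suc o) l)
    ... | Bézout.-+ x y e = y , divides (suc x) (begin
      l * y + o                       ≡⟨ cong (_+ o) (trans (ℕP.*-comm l y) (sym e)) ⟩
      gcd (suc o) l + x * suc o + o   ≡⟨ cong (λ g → g + x * suc o + o) q≡1 ⟩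
      1 + x * suc o + o               ≡⟨ solve 2
        (λ x o → con 1 :+ x :* (con 1 :+ o) :+ o := (con 1 :+ x) :* (con 1 :+ o)) refl x o ⟩
      suc x * suc o                   ∎)
      where
      open ≡-Reasoning
      open +-*-Solver
    -- Here the inverse of `l` is the negative of `y`; modulo `suc o` it is represented by `o * y`.
    ... | Bézout.+- x y e = o * y , divides (o * x) (begin
      l * (o * y) + o                 ≡⟨ solve 3 (λ l o y → l :* (o :* y) :+ o := o :* (con 1 :+ y :* l)) refl l o y ⟩
      o * (1 + y * l)                 ≡⟨ cong (λ g → o * (g + y * l)) (sym q≡1) ⟩
      o * (gcd (suc o) l + y * l)     ≡⟨ cong (o *_) e ⟩
      o * (x * suc o)                 ≡⟨ sym (ℕP.*-assoc o x (suc o)) ⟩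
      o * x * suc o                   ∎)
      where
      open ≡-Reasoning
      open +-*-Solver

    -- The gcd divides `l * σ`, so it would divide both `o` and `suc o`, hence 1.
    no-solution : 2 ≤ gcd (suc o) l → ∀ σ → ¬ (suc o ∣ l * σ + o)
    no-solution 2≤q σ div = ℕP.<⇒≱ 2≤q (∣⇒≤
      (∣m+n∣m⇒∣n {m = o} {n = 1} (subst (gcd (suc o) l ∣_) (ℕP.+-comm 1 o) (gcd[m,n]∣m (suc o) l))
      (∣m+n∣m⇒∣n (∣-trans (gcd[m,n]∣m (suc o) l) div) (∣-trans (gcd[m,n]∣n (suc o) l) (m∣m*n σ)))))

    -- Subtracting a particular solution `s₁`, in the form of adding `o * s₁`, turns the
    -- inhomogeneous congruence into the homogeneous one.
    count-units : gcd (suc o) l ≡ 1 → (P Q : ℕ → Bool) →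
      (∀ {σ} → P σ ≡ true → suc o ∣ l * σ) → (∀ {σ} → suc o ∣ l * σ → P σ ≡ true) →
      (∀ {σ} → Q σ ≡ true → suc o ∣ l * σ + o) → (∀ {σ} → suc o ∣ l * σ + o → Q σ ≡ true) →
      ∀ s₀ → Count.big (upTo (suc o)) (λ s → ind (Q (s₀ + s))) ≡ 1
    count-units q≡1 P Q toP fromP toQ fromQ s₀ with unit-solution q≡1
    ... | s₁ , divides k e = trans (Count.big-cong (upTo (suc o)) λ s _ → cong ind
      (trans (translate (s₀ + s)) (cong P (lem s))))
            (trans (count-roots (suc o) l P toP fromP (o * s₁ + s₀)) q≡1)
      where
      open +-*-Solver
      lem : ∀ s → s₀ + s + o * s₁ ≡ o * s₁ + s₀ + s
      lem s = solve 3 (λ a s b → a :+ s :+ b := b :+ a :+ s) refl s₀ s (o * s₁)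
      balance : ∀ σ → l * (σ + o * s₁) + o * suc o ≡ l * σ + o + (o * k) * suc o
      balance σ = begin
        l * (σ + o * s₁) + o * suc o     ≡⟨ solve 4
          (λ l σ o s → l :* (σ :+ o :* s) :+ o :* (con 1 :+ o) := l :* σ :+ o :+ o :* (l :* s :+ o)) refl l σ o s₁ ⟩
        l * σ + o + o * (l * s₁ + o)     ≡⟨ cong (λ x → l * σ + o + o * x) e ⟩
        l * σ + o + o * (k * suc o)      ≡⟨ cong (l * σ + o +_) (sym (ℕP.*-assoc o k (suc o))) ⟩
        l * σ + o + (o * k) * suc o      ∎
        where open ≡-Reasoning
      translate : ∀ σ → Q σ ≡ P (σ + o * s₁)
      translate σ = bool-ext
        (λ h → fromP (∣m+n∣m⇒∣n (subst (suc o ∣_) (trans (sym (balance σ)) (ℕP.+-comm _ (o * suc o)))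
          (∣m∣n⇒∣m+n (toQ h) (n∣m*n (o * k)))) (n∣m*n o)))
        (λ h → fromQ (∣m+n∣m⇒∣n (subst (suc o ∣_) (trans (balance σ) (ℕP.+-comm _ (o * k * suc o)))
          (∣m∣n⇒∣m+n (toP h) (n∣m*n o))) (n∣m*n (o * k))))

  module CoreSums {c ℓ} (F : Field' c ℓ) where
    open FieldLemmas F hiding (refl; sym; trans; zero)
    private module K = Field' F

    sum-ind : ∀ (xs : List ℕ) (P : ℕ → Bool) → Sum.big xs (λ s → if P s then 1# else 0#) ≈ fromℕ
      (Count.big xs (ind ∘ P))
    sum-ind [] P = K.refl
    sum-ind (x ∷ xs) P with P x
    ... | true = K.+-congˡ (sum-ind xs P)
    ... | false = K.trans (K.+-identityˡ _) (sum-ind xs P)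

    count-length : ∀ (xs : List ℕ) (P : ℕ → Bool) → Count.big xs (ind ∘ P) ≡ length (filterᵇ P xs)
    count-length [] P = refl
    count-length (x ∷ xs) P with P x
    ... | true = cong suc (count-length xs P)
    ... | false = count-length xs P

    private
      all-distinct : {xs : List ℕ} (v : ℕ → Carrier) → Unique xs → (∀ {x y} → x ∈ xs → y ∈ xs → v x ≈ v y → x ≡ y) →
                     AllPairs (λ a b → ¬ (a ≈ b)) (map v xs)
      all-distinct v [] inj = []
      all-distinct v (x∉ ∷ u) inj = AllP.map⁺ (All.tabulate λ y∈ e → All.lookup x∉ y∈ (inj (here refl) (there y∈) e))
        ∷ all-distinct v u (λ a b → inj (there a) (there b))

    sum-zero : ∀ (xs : List ℕ) q → 2 ≤ q → Unique xs → (P : ℕ → Bool) (v : ℕ → Carrier) → Count.big xs (ind ∘ P) ≡ q →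
      (∀ {s} → s ∈ xs → P s ≡ true → powK (v s) q ≈ 1#) →
      (∀ {s t} → s ∈ xs → t ∈ xs → P s ≡ true → P t ≡ true → v s ≈ v t → s ≡ t) →
      Sum.big xs (λ s → if P s then v s else 0#) ≈ 0#
    sum-zero xs q 2≤q u P v cnt roots inj = K.trans (K.sym (Sum.big-filter P xs v))
      (sum-distinct-roots (map v ys) 2≤q (trans (length-map v ys) (trans (sym (count-length xs P)) cnt))
        (all-distinct v (UniqueP.filter⁺ (T? ∘ P) u) (λ a b → let (a∈ , pa) = ∈-filterᵇ⁻ P a ; (b∈ , pb) = ∈-filterᵇ⁻ P b in inj a∈ b∈ pa pb))
        (AllP.map⁺ (All.tabulate λ s∈ → let (s∈xs , ps) = ∈-filterᵇ⁻ P s∈ in roots s∈xs ps)))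
      where
      ys : List ℕ
      ys = filterᵇ P xs

    -- The window starts at an arbitrary `s₀` because the moves start from the exponent of the given
    -- element, not from 0. At a homogeneous solution both `v^(suc o)` and `v^l` are 1, so `v` is a
    -- root of unity of order dividing the gcd.
    sum-units≈sum-roots : ∀ o l (P Q : ℕ → Bool) s₀ (v : ℕ → Carrier) →
      (∀ {σ} → P σ ≡ true → suc o ∣ l ℕ.* σ) → (∀ {σ} → suc o ∣ l ℕ.* σ → P σ ≡ true) →
      (∀ {σ} → Q σ ≡ true → suc o ∣ l ℕ.* σ ℕ.+ o) → (∀ {σ} → suc o ∣ l ℕ.* σ ℕ.+ o → Q σ ≡ true) →
      (∀ s → P (s₀ ℕ.+ s) ≡ true → powK (v s) (suc o) ≈ 1#) → (∀ s → P (s₀ ℕ.+ s) ≡ true → powK (v s) l ≈ 1#) →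
      (∀ {s t} → s < suc o → t < suc o → v s ≈ v t → s ≡ t) →
      Sum.big (upTo (suc o)) (λ s → if Q (s₀ ℕ.+ s) then 1# else 0#) ≈ Sum.big (upTo (suc o))
        (λ s → if P (s₀ ℕ.+ s) then v s else 0#)
    sum-units≈sum-roots o l P Q s₀ v toP fromP toQ fromQ vo vl inj = go (gcd (suc o) l) refl
      where
      root : ∀ s → P (s₀ ℕ.+ s) ≡ true → powK (v s) (gcd (suc o) l) ≈ 1#
      root s ps = powK-gcd (suc o) l (vo s ps) (vl s ps)
      go : ∀ q → gcd (suc o) l ≡ q → _
      go zero e = contradiction e (λ z → gcd[m,n]≢0 (suc o) l (inj₁ λ ()) z)
      go (suc zero) e = K.trans (sum-ind (upTo (suc o)) (λ s → Q (s₀ ℕ.+ s))) (K.trans (K.reflexive (cong fromℕ (trans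
          (count-units o l e P Q toP fromP toQ fromQ s₀) (sym (trans (count-roots (suc o) l P toP fromP s₀) e)))))
        (K.trans (K.sym (sum-ind (upTo (suc o)) (λ s → P (s₀ ℕ.+ s)))) (Sum.big-cong (upTo (suc o)) λ s _ → value s)))
        where
        value : ∀ s → (if P (s₀ ℕ.+ s) then 1# else 0#) ≈ (if P (s₀ ℕ.+ s) then v s else 0#)
        value s with P (s₀ ℕ.+ s) in ps
        ... | false = K.refl
        ... | true = K.sym (K.trans (K.sym (K.*-identityʳ (v s))) (subst (λ q → powK (v s) q ≈ 1#) e (root s ps)))
      go (suc (suc q)) e = K.trans (Sum.big-ε (upTo (suc o)) λ s _ → K.reflexive (cong (λ b → if b then 1# else 0#)
          (¬true⇒false λ qs → no-solution o l 2≤q (s₀ ℕ.+ s) (toQ qs))))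
        (K.sym (sum-zero (upTo (suc o)) (gcd (suc o) l) 2≤q (UniqueP.upTo⁺ (suc o)) (λ s → P (s₀ ℕ.+ s)) v
          (count-roots (suc o) l P toP fromP s₀)
          (λ {s} _ → root s) (λ s∈ t∈ _ _ → inj (∈-upTo⁻ s∈) (∈-upTo⁻ t∈))))
        where
        2≤q : 2 ≤ gcd (suc o) l
        2≤q = subst (2 ≤_) (sym e) (s≤s (s≤s z≤n))

open CongruenceCounting

-- Multiplication by a factor supported on a single `g`-cycle.

module CycleCuts where
  open import Function using (_∘_; id)
  open import Data.Bool using (Bool; true; false; not; if_then_else_)
  open import Data.Bool.Properties using (xor-comm)
  open import Data.Nat using (zero; suc; _<_)
  import Data.Nat as ℕ
  import Data.Nat.Properties as ℕP
  open import Data.Nat.Divisibility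
  open import Data.Fin using (Fin)
  open import Data.Product using (_,_; proj₁; ∃)
  open import Data.Vec using (tabulate)
  open import Relation.Binary.PropositionalEquality as ≡ using (_≡_; cong; subst; refl; sym; trans)
  open import Relation.Nullary using (contradiction; ¬_)

  module _ {n : ℕ} where

    record Adm (g w : SP n) : Set where
      constructor adm
      field
        perm : Perm w
        comm : Comm w g

    onCyc : SP n → Fin n → Fin n → Bool
    onCyc g j i = eqFin (base g (pos i)) (base g (pos j))

    onCyc⁺ : ∀ {g} → Perm g → ∀ {j p} → Cyc g p (pos j) → onCyc g j (ix p) ≡ true
    onCyc⁺ {g} hg {j} {p} c = eqFin⁺ {i = base g (pos (ix p))} {j = base g (pos j)}
      (base-≡ hg (Cyc-trans (Cyc-refl {q = p} refl) c))

    onCyc⁻ : ∀ {g} → Perm g → ∀ {j p} → onCyc g j (ix p) ≡ true → Cyc g p (pos j)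
    onCyc⁻ {g} hg {j} {p} h = Cyc-trans (Cyc-refl {p = p} {q = pos (ix p)} refl)
      (base-≡⁻ hg {pos (ix p)} {pos j} (eqFin⁻ {i = base g (pos (ix p))} h))

    opaque
      cut : SP n → Fin n → SP n → SP n
      cut g j u = tabulate (λ i → if onCyc g j i then act u (pos i) else pos i)

      cut-on : ∀ g j u p → onCyc g j (ix p) ≡ true → act (cut g j u) p ≡ act u p
      cut-on g j u p h = trans (act-tabulate _ p) (trans
        (cong (λ b → sg (proj₁ p) (if b then act u (pos (ix p)) else pos (ix p))) h)
        (trans (sym (act-sg u (proj₁ p) (pos (ix p)))) (cong (act u) (sym (pos-ix p)))))

      cut-off : ∀ g j u p → onCyc g j (ix p) ≡ false → act (cut g j u) p ≡ p
      cut-off g j u p h = trans (act-tabulate _ p) (trans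
        (cong (λ b → sg (proj₁ p) (if b then act u (pos (ix p)) else pos (ix p))) h) (sym (pos-ix p)))

      cut-pos : ∀ g j u i → act (cut g j u) (pos i) ≡ (if onCyc g j i then act u (pos i) else pos i)
      cut-pos g j u i = act-tabulate _ (pos i)

      negSP : SP n
      negSP = tabulate (λ i → (true , i))

      act-neg : ∀ p → act negSP p ≡ sg true p
      act-neg (b , i) = trans (act-tabulate _ (b , i)) (cong (_, i) (xor-comm b true))

    -- What `g` and -1 have in common as factors: a power of `g` on absolute values, and commutation
    -- with the centralizer of `g`. Both moves are thereby treated at once.
    record CutBy (g u : SP n) : Set where
      field
        u-perm : Perm u
        power : ℕ
        u-ix : ∀ p → ix (act u p) ≡ ix (it g power p)
        u-comm : ∀ {w} → Comm w g → Comm w u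

    cutBy-self : ∀ {g} → Perm g → CutBy g g
    cutBy-self hg = record { u-perm = hg ; power = 1 ; u-ix = λ _ → refl ; u-comm = id }

    cutBy-neg : ∀ {g} → CutBy g negSP
    cutBy-neg = record
      { u-perm = λ {p} {q} e → sg-inj true (trans (sym (act-neg p)) (trans e (act-neg q)))
      ; power = 0
      ; u-ix = λ p → cong ix (act-neg p)
      ; u-comm = λ {w} _ p → trans (cong (act w) (act-neg p)) (trans (act-sg w true p) (sym (act-neg (act w p)))) }

    module Cut {g u : SP n} (hg : Perm g) (cb : CutBy g u) (j : Fin n) where
      open CutBy cb

      t : SP n
      t = cut g j u

      private
        u-Cyc : ∀ p → Cyc g p (act u p)
        u-Cyc p = cyc power (sym (u-ix p))

      opaque
        onCyc-u : ∀ p → onCyc g j (ix (act u p)) ≡ onCyc g j (ix p)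
        onCyc-u p = bool-ext (λ h → onCyc⁺ hg {j} {p} (Cyc-trans (u-Cyc p) (onCyc⁻ hg {j} {act u p} h)))
                             (λ h → onCyc⁺ hg {j} {act u p} (Cyc-trans (Cyc-sym hg (u-Cyc p)) (onCyc⁻ hg {j} {p} h)))

        onCyc-g : ∀ p → onCyc g j (ix (act g p)) ≡ onCyc g j (ix p)
        onCyc-g p = bool-ext (λ h → onCyc⁺ hg {j} {p} (Cyc-trans (cyc 1 refl) (onCyc⁻ hg {j} {act g p} h)))
                             (λ h → onCyc⁺ hg {j} {act g p} (Cyc-trans (Cyc-sym hg {p} {act g p} (cyc 1 refl))
                               (onCyc⁻ hg {j} {p} h)))

        cut-Perm : Perm t
        cut-Perm {p} {q} e = go (onCyc g j (ix p)) refl (onCyc g j (ix q)) refl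
          where
          image : ∀ p b → onCyc g j (ix p) ≡ b → onCyc g j (ix (act t p)) ≡ b
          image p true h = trans (cong (onCyc g j ∘ ix) (cut-on g j u p h)) (trans (onCyc-u p) h)
          image p false h = trans (cong (onCyc g j ∘ ix) (cut-off g j u p h)) h
          go : ∀ a → onCyc g j (ix p) ≡ a → ∀ b → onCyc g j (ix q) ≡ b → p ≡ q
          go true hp true hq = u-perm (trans (sym (cut-on g j u p hp)) (trans e (cut-on g j u q hq)))
          go false hp false hq = trans (sym (cut-off g j u p hp)) (trans e (cut-off g j u q hq))
          go true hp false hq = contradiction (trans (sym (cong (onCyc g j ∘ ix) e)) (image p true hp))
            (λ z → true≢false z (image q false hq))
          go false hp true hq = contradiction (trans (cong (onCyc g j ∘ ix) e) (image q true hq))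
            (λ z → true≢false z (image p false hp))

        cut-Comm : Comm t g
        cut-Comm p = go (onCyc g j (ix p)) refl
          where
          go : ∀ b → onCyc g j (ix p) ≡ b → act t (act g p) ≡ act g (act t p)
          go true h = trans (cut-on g j u (act g p) (trans (onCyc-g p) h))
            (trans (sym (u-comm (Comm-self g) p)) (cong (act g) (sym (cut-on g j u p h))))
          go false h = trans (cut-off g j u (act g p) (trans (onCyc-g p) h)) (cong (act g) (sym (cut-off g j u p h)))

      module _ {w : SP n} (aw : Adm g w) where
        open Adm aw

        y : SP n
        y = comp w t

        opaque
          y-on : ∀ p → onCyc g j (ix p) ≡ true → act y p ≡ act u (act w p)
          y-on p h = trans (act-comp w t p) (trans (cong (act w) (cut-on g j u p h)) (u-comm comm p))

          y-off : ∀ p → onCyc g j (ix p) ≡ false → act y p ≡ act w p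
          y-off p h = trans (act-comp w t p) (cong (act w) (cut-off g j u p h))

          y-Adm : Adm g y
          y-Adm = adm (Perm-comp perm cut-Perm) λ p → trans (act-comp w t (act g p))
            (trans (cong (act w) (cut-Comm p)) (trans (comm (act t p)) (cong (act g) (sym (act-comp w t p)))))

          y-step : ∀ p → ∃ λ b → ix (act y p) ≡ ix (act w (it g b p))
          y-step p = go (onCyc g j (ix p)) refl
            where
            go : ∀ b → onCyc g j (ix p) ≡ b → ∃ λ b → ix (act y p) ≡ ix (act w (it g b p))
            go true h = power , trans (cong ix (trans (act-comp w t p) (cong (act w) (cut-on g j u p h))))
              (act-ix w (u-ix p))
            go false h = 0 , cong ix (y-off p h)

          -- Each step of `y` is a step of `w` preceded by some power of `g`, which commutation
          -- carries to the start. With `w⇒y` this shows that a cut does not change the blocks.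
          y⇒w : ∀ a p → ∃ λ b → ix (it y a p) ≡ ix (it w a (it g b p))
          y⇒w zero p = 0 , refl
          y⇒w (suc a) p with y⇒w a p | y-step (it y a p)
          ... | b , e | b′ , e′ = b′ ℕ.+ b , trans e′ (act-ix w
            (trans (it-ix g b′ e) (trans (cong ix (sym (it-it comm a b′ _)))
            (it-ix w a (cong ix (sym (it-+ g b′ b p)))))))

          w⇒y : ∀ a p → ∃ λ b → ix (it w a p) ≡ ix (it y a (it g b p))
          w⇒y zero p = 0 , refl
          w⇒y (suc a) p with w⇒y a p | y-step (it w a p)
          ... | b , e | b′ , e′ with it-back hg b′ (it w (suc a) p)
          ... | s , es = s ℕ.+ b , trans (sym es) (trans
            (it-ix g s (trans (cong ix (it-app (Comm-sym {w = w} {v = g} comm) b′ (it w a p)))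
            (trans (sym e′) (act-ix y e))))
                (cong ix (trans (sym (it-it {w = y} {v = g} (Adm.comm y-Adm) (suc a) s (it g b p)))
                  (cong (it y (suc a)) (sym (it-+ g s b p))))))

          Blk-y : ∀ i k → blkᵇ y g i k ≡ blkᵇ w g i k
          Blk-y i k = bool-ext
            (λ h → let (blk a b e) = blkᵇ⁻ y g i k h ; (b′ , e′) = y⇒w a (it g b (pos i)) in
              blkᵇ⁺ w g perm hg i k (blk a (b′ ℕ.+ b) (trans (it-ix w a (cong ix (it-+ g b′ b (pos i))))
                (trans (sym e′) e))))
            (λ h → let (blk a b e) = blkᵇ⁻ w g i k h ; (b′ , e′) = w⇒y a (it g b (pos i)) in
              blkᵇ⁺ y g (Adm.perm y-Adm) hg i k (blk a (b′ ℕ.+ b)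
                (trans (it-ix y a (cong ix (it-+ g b′ b (pos i)))) (trans (sym e′) e))))

          blkRep-y : ∀ i → blkRep y g i ≡ blkRep w g i
          blkRep-y i = firstFin-cong (blkᵇ y g i) (blkᵇ w g i) i i (blkᵇ⁺ y g (Adm.perm y-Adm) hg i i Blk-refl)
            (Blk-y i)

          it-off : ∀ b → ¬ Blk w g b j → ∀ r → it y r (pos b) ≡ it w r (pos b)
          it-off b ¬blk zero = refl
          it-off b ¬blk (suc r) = trans (cong (act y) (it-off b ¬blk r))
            (y-off (it w r (pos b)) (¬true⇒false λ on → ¬blk (reach (onCyc⁻ hg {j} {it w r (pos b)} on))))
            where
            reach : Cyc g (it w r (pos b)) (pos j) → Blk w g b j
            reach (cyc s e) = blk r s (trans (cong ix (it-it comm r s (pos b))) e)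

        off-transport : ∀ b → ¬ Blk w g b j → Transport w g y g b b
        off-transport b ¬blk = record { v = id ; v-inj = id ; v-ix = id ; v-ix-inj = id ; v-neg = λ _ → refl ; it-w =
          it-off b ¬blk ; it-g = λ _ → refl }

        module Return {d : ℕ} (first : Per (Link w g (pos j)) d) where

          private
            p : Pt n
            p = pos j

          opaque
            -- The start lies on the `g`-cycle and the orbit then stays off it until time `d`. So
            -- `u` is applied exactly once, at the first step, and commutation carries it along.
            it-before : ∀ a → suc a ≤ d → it y (suc a) p ≡ act u (it w (suc a) p)
            it-before zero _ = y-on p (onCyc⁺ hg {j} {p} (Cyc-refl refl))
            it-before (suc a) lt = trans (cong (act y) (it-before a (ℕP.<⇒≤ lt)))
              (trans (y-off (act u (it w (suc a) p)) (¬true⇒false λ on → away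
                (onCyc⁻ hg {j} {it w (suc a) p} (trans (sym (onCyc-u _)) on)))) (u-comm comm (it w (suc a) p)))
              where
              away : ¬ Cyc g (it w (suc a) p) p
              away c with Cyc-sym hg c
              ... | cyc r e = ℕP.<⇒≱ lt (∣⇒≤ (to first {suc a} (link r (sym e))))

            it-return : it y d p ≡ act u (it w d p)
            it-return = go d refl
              where
              go : ∀ d′ → d′ ≡ d → it y d′ p ≡ act u (it w d′ p)
              go zero e = contradiction (positive first) (λ z → ℕP.n≮0 (subst (0 <_) (sym e) z))
              go (suc d′) e = it-before d′ (ℕP.≤-reflexive e)

            first-y : Per (Link y g p) d
            first-y = Per-via (positive first) (returns (from first ∣-refl)) minimal (let (e , per , _) = link-period (Adm.perm y-Adm) hg (Adm.comm y-Adm) p in e , per)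
              where
              returns : Link w g p d → Link y g p d
              returns (link b e) = link (power ℕ.+ b) (trans (cong ix it-return)
                (trans (u-ix _) (trans (it-ix g power e) (cong ix (sym (it-+ g power b p))))))
              minimal : ∀ {a} → 0 < a → a < d → ¬ Link y g p a
              minimal {suc a} _ lt (link b e) = ℕP.<⇒≱ lt (∣⇒≤
                (to first {suc a} (back (it-back hg power (it w (suc a) p)))))
                where
                back : (∃ λ s → ix (it g s (it g power (it w (suc a) p))) ≡ ix (it w (suc a) p)) → Link w g p (suc a)
                back (s , es) = link (s ℕ.+ b) (trans (sym es)
                  (trans (it-ix g s (trans (sym (u-ix _)) (trans (cong ix (sym (it-before a (ℕP.<⇒≤ lt)))) e)))
                  (cong ix (sym (it-+ g s b p)))))

    module _ {g : SP n} (hg : Perm g) {j : Fin n} {ε : Bool} {d σ : ℕ} {w : SP n} (mem : Member g j ε d σ w) where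
      open Member mem

      private
        aw : Adm g w
        aw = adm perm comm

      Member-cut-g : Member g j ε d (suc σ) (comp w (cut g j g))
      Member-cut-g = record
        { perm = Adm.perm (Cut.y-Adm hg (cutBy-self hg) j aw)
        ; comm = Adm.comm (Cut.y-Adm hg (cutBy-self hg) j aw)
        ; first-return = Cut.Return.first-y hg (cutBy-self hg) j aw first-return
        ; return = trans (Cut.Return.it-return hg (cutBy-self hg) j aw first-return)
          (trans (cong (act g) return) (act-sg g ε (it g σ (pos j)))) }

      Member-cut-neg : Member g j (not ε) d σ (comp w (cut g j negSP))
      Member-cut-neg = record
        { perm = Adm.perm (Cut.y-Adm hg cutBy-neg j aw)
        ; comm = Adm.comm (Cut.y-Adm hg cutBy-neg j aw)
        ; first-return = Cut.Return.first-y hg cutBy-neg j aw first-return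
        ; return = trans (Cut.Return.it-return hg cutBy-neg j aw first-return)
          (trans (act-neg _) (trans (cong (sg true) return) (sg-sg true ε (it g σ (pos j))))) }

    record Start (g : SP n) (j : Fin n) (w : SP n) : Set where
      field
        {ε} : Bool
        {d σ} : ℕ
        member : Member g j ε d σ w
        ε⇒plus : ε ≡ true → minus g j ≡ false

    opaque
      -- Arranges the normalization of `ε`: on a negative `g`-cycle the sign -1 is `g^m` at `j`,
      -- with `m = clen g j`, and is moved into `σ`.
      startMember : ∀ {g} → Perm g → ∀ {w} → Adm g w → ∀ j → Start g j w
      startMember {g} hg {w} aw j with link-period (Adm.perm aw) hg (Adm.comm aw) (pos j)
      ... | d , per , _ with from per ∣-refl
      ... | link σ e with ix≡⇒sg {p = it w d (pos j)} {q = it g σ (pos j)} e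
      ... | b , eb = go b eb (minus g j) refl
        where
        mk : ∀ {ε σ} → it w d (pos j) ≡ sg ε (it g σ (pos j)) → Member g j ε d σ w
        mk e = record { perm = Adm.perm aw ; comm = Adm.comm aw ; first-return = per ; return = e }
        go : ∀ b → it w d (pos j) ≡ sg b (it g σ (pos j)) → ∀ ty → minus g j ≡ ty → Start g j w
        go false e ty _ = record { member = mk {false} {σ} e ; ε⇒plus = λ () }
        go true e false ety = record { member = mk {true} {σ} e ; ε⇒plus = λ _ → ety }
        go true e true ety = record { ε⇒plus = λ () ; member = mk {false} {σ ℕ.+ clen g j}
          (trans e (sym (trans (it-+ g σ (clen g j) (pos j))
          (trans (cong (it g σ) (trans (it-clen hg j) (cong (λ b → sg b (pos j)) ety))) (it-sg g σ true (pos j)))))) }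

    iterC : SP n → Fin n → ℕ → SP n → SP n
    iterC g j zero w = w
    iterC g j (suc s) w = comp (iterC g j s w) (cut g j g)

    negC : SP n → Fin n → Bool → SP n → SP n
    negC g j true w = comp w (cut g j negSP)
    negC g j false w = w

    Member-iterC : ∀ {g} → Perm g → ∀ {j ε d σ w} → Member g j ε d σ w → ∀ s →
      Member g j ε d (s ℕ.+ σ) (iterC g j s w)
    Member-iterC hg m zero = m
    Member-iterC hg m (suc s) = Member-cut-g hg (Member-iterC hg m s)

    module _ {g : SP n} (hg : Perm g) (j : Fin n) where

      Adm-iterC : ∀ {w} → Adm g w → ∀ s → Adm g (iterC g j s w)
      Adm-iterC aw zero = aw
      Adm-iterC aw (suc s) = Cut.y-Adm hg (cutBy-self hg) j (Adm-iterC aw s)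

      Adm-negC : ∀ {w} → Adm g w → ∀ b → Adm g (negC g j b w)
      Adm-negC aw true = Cut.y-Adm hg cutBy-neg j aw
      Adm-negC aw false = aw

      blkRep-τ : ∀ {w} → Adm g w → ∀ b s i → blkRep (iterC g j s (negC g j b w)) g i ≡ blkRep w g i
      blkRep-τ aw b (suc s) i = trans (Cut.blkRep-y hg (cutBy-self hg) j (Adm-iterC (Adm-negC aw b) s) i)
        (blkRep-τ aw b s i)
      blkRep-τ aw true zero i = Cut.blkRep-y hg cutBy-neg j aw i
      blkRep-τ aw false zero i = refl

open CycleCuts

-- Averaging over the centralizer, one block at a time.

module CentralizerAveraging where
  open import Function using (_∘_)
  open import Data.Bool using (Bool; true; false; if_then_else_; T?)
  open import Data.Nat using (zero; suc; _<_; z≤n; s≤s)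
  import Data.Nat as ℕ
  import Data.Nat.Properties as ℕP
  open import Data.Nat.Divisibility
  open import Data.Fin using (Fin)
  open import Data.Product using (_,_)
  open import Data.Sum using (inj₁; inj₂)
  open import Data.List using (List; []; _∷_; map; filterᵇ; upTo; allFin; _++_; length)
  open import Data.List.Relation.Unary.Any using (here; there)
  open import Data.List.Relation.Unary.AllPairs using ([]; _∷_)
  import Data.List.Relation.Unary.All as All
  open import Data.List.Relation.Unary.Unique.Propositional using (Unique)
  import Data.List.Relation.Unary.Unique.Propositional.Properties as UniqueP
  open import Relation.Binary.PropositionalEquality as ≡ using (_≡_; cong)
  open import Relation.Nullary using (contradiction; ¬_)
  import Relation.Binary.Reasoning.Setoid as SetoidReasoning

  module _ {n : ℕ} where

    commᵇ : SP n → SP n → Bool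
    commᵇ g w = eqSP (comp w g) (comp g w)

    commᵇ⁺ : ∀ {g w} → Comm w g → commᵇ g w ≡ true
    commᵇ⁺ {g} {w} c = eqSP⁺ {v = comp w g} {w = comp g w}
      (SP-ext λ p → ≡.trans (act-comp w g p) (≡.trans (c p) (≡.sym (act-comp g w p))))

    commᵇ⁻ : ∀ {g w} → commᵇ g w ≡ true → Comm w g
    commᵇ⁻ {g} {w} e p = ≡.trans (≡.sym (act-comp w g p))
      (≡.trans (cong (λ v → act v p) (eqSP⁻ {v = comp w g} {w = comp g w} e)) (act-comp g w p))

    opaque
      centralizer : SP n → List (SP n)
      centralizer g = filterᵇ (commᵇ g) (Bn n)

      centralizer-def : ∀ g → centralizer g ≡ filterᵇ (commᵇ g) (Bn n)
      centralizer-def g = ≡.refl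

      ∈-centralizer⁺ : ∀ {g w} → Adm g w → w ∈ centralizer g
      ∈-centralizer⁺ {g} {w} (adm p c) = ∈-filterᵇ⁺ (commᵇ g) (∈-Bn⁺ p) (commᵇ⁺ {g} {w} c)

      ∈-centralizer⁻ : ∀ {g w} → w ∈ centralizer g → Adm g w
      ∈-centralizer⁻ {g} {w} w∈ = let (b , c) = ∈-filterᵇ⁻ (commᵇ g) {Bn n} w∈ in adm (∈-Bn⁻ b) (commᵇ⁻ {g} {w} c)

      centralizer-unique : ∀ g → Unique (centralizer g)
      centralizer-unique g = UniqueP.filter⁺ (T? ∘ commᵇ g) {xs = Bn n} Bn-unique

    comp-injʳ : ∀ {t w v : SP n} → Perm t → comp w t ≡ comp v t → w ≡ v
    comp-injʳ {t} {w} {v} ht e = SP-ext λ p → ≡.trans (cong (act w) (≡.sym (inv-spec ht p)))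
      (≡.trans (≡.sym (act-comp w t _))
      (≡.trans (cong (λ x → act x (act (inv t) p)) e) (≡.trans (act-comp v t _) (cong (act v) (inv-spec ht p)))))

    comp-inv-cancel : ∀ {t : SP n} → Perm t → ∀ w → comp (comp w (inv t)) t ≡ w
    comp-inv-cancel {t} ht w = SP-ext λ p → ≡.trans (act-comp (comp w (inv t)) t p)
      (≡.trans (act-comp w (inv t) _) (cong (act w) (inv-specˡ ht p)))

    Adm-comp : ∀ {g w v : SP n} → Adm g w → Adm g v → Adm g (comp w v)
    Adm-comp {g} {w} {v} (adm p c) (adm p′ c′) = adm (Perm-comp p p′) λ q →
      ≡.trans (act-comp w v (act g q)) (≡.trans (cong (act w) (c′ q))
        (≡.trans (c (act v q)) (cong (act g) (≡.sym (act-comp w v q)))))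

    Adm-inv : ∀ {g w : SP n} → Adm g w → Adm g (inv w)
    Adm-inv {g} {w} (adm p c) = adm (Perm-inv p) λ q → p
      (≡.trans (inv-spec p (act g q)) (≡.sym (≡.trans (c (act (inv w) q)) (cong (act g) (inv-spec p q)))))

    order-inj≤ : ∀ {g : SP n} → Perm g → ∀ j {s t} → s ≤ t → t < order g j → it g s (pos j) ≡ it g t (pos j) → s ≡ t
    order-inj≤ {g} hg j {s} le t< e with ℕP.m≤n⇒∃[o]m+o≡n le
    ... | zero , ≡.refl = ≡.sym (ℕP.+-identityʳ s)
    ... | suc o , ≡.refl = contradiction (∣⇒≤
      (to (order-Per hg j) {suc o} (it-inj hg s (≡.trans (≡.sym (it-+ g s (suc o) (pos j))) (≡.sym e)))))
        (ℕP.<⇒≱ (ℕP.≤-<-trans (ℕP.m≤n+m (suc o) s) t<))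

    order-inj : ∀ {g : SP n} → Perm g → ∀ j {s t} → s < order g j → t < order g j → it g s (pos j) ≡ it g t (pos j) →
      s ≡ t
    order-inj hg j {s} {t} s< t< e with ℕP.≤-total s t
    ... | inj₁ le = order-inj≤ hg j le t< e
    ... | inj₂ le = ≡.sym (order-inj≤ hg j le s< (≡.sym e))

  module Averaging {c ℓ} (F : Field' c ℓ) (char0 : FieldOps.CharZero F) {n : ℕ} where
    open FieldLemmas F
    open SetoidReasoning setoid

    fromℕ≉0 : ∀ {m} → 0 < m → ¬ (fromℕ m ≈ 0#)
    fromℕ≉0 {suc m} _ = char0 m

    module _ {g : SP n} (hg : Perm g) where

      sum-translate : ∀ {t} → Adm g t → (f : SP n → Carrier) →
        Sum.big (centralizer g) f ≈ Sum.big (centralizer g) (λ w → f (comp w t))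
      sum-translate {t} at f = Sum.big-reindex (λ w → comp w t) f (centralizer-unique g) (centralizer-unique g)
        (λ w∈ → ∈-centralizer⁺ (Adm-comp (∈-centralizer⁻ w∈) at))
        (λ _ _ → comp-injʳ (Adm.perm at))
        (λ {w} w∈ → comp w (inv t) , ∈-centralizer⁺ (Adm-comp (∈-centralizer⁻ w∈) (Adm-inv at)) , comp-inv-cancel
          (Adm.perm at) w)

      -- Each `τ i` preserves sums over the centralizer, so a sum equals its mean over the moves,
      -- and it suffices to compare the two functions along the moves of each `w`. Characteristic
      -- zero permits division by the number of moves.
      average : {A : Set} (I : List A) (τ : A → SP n → SP n) → 0 < length I →
        (∀ i f → Sum.big (centralizer g) f ≈ Sum.big (centralizer g) (f ∘ τ i)) → (f f′ : SP n → Carrier) →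
        (∀ {w} → Adm g w → Sum.big I (λ i → f (τ i w)) ≈ Sum.big I (λ i → f′ (τ i w))) →
        Sum.big (centralizer g) f ≈ Sum.big (centralizer g) f′
      average I τ pos invariant f f′ h = *-cancelˡ (fromℕ≉0 pos)
        (trans (spread f) (trans (Sum.big-cong (centralizer g) (λ w w∈ → h (∈-centralizer⁻ w∈))) (sym (spread f′))))
        where
        spread : ∀ f → fromℕ (length I) * Sum.big (centralizer g) f ≈ Sum.big (centralizer g)
          (λ w → Sum.big I (λ i → f (τ i w)))
        spread f = trans (sym (sum-const I _)) (trans (Sum.big-cong I (λ i _ → invariant i f))
          (Sum.big-swap I (centralizer g) _))

      module _ (j : Fin n) where

        -- Powers of the cycle run `σ` through all residues. Negation is added for the twisted sum:
        -- on a positive cycle `g` does not change `sgn`, while -1 does when the length is odd.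
        moves : List (Bool × ℕ)
        moves = map (true ,_) (upTo (order g j)) ++ map (false ,_) (upTo (order g j))

        τ : Bool × ℕ → SP n → SP n
        τ (b , s) w = iterC g j s (negC g j b w)

        sum-moves : ∀ (f : Bool × ℕ → Carrier) → Sum.big moves f ≈ Sum.big (upTo (order g j)) (λ s → f (true , s)) +
          Sum.big (upTo (order g j)) (λ s → f (false , s))
        sum-moves f = trans (Sum.big-++ (map (true ,_) (upTo (order g j))) (map (false ,_) (upTo (order g j))) f)
          (+-cong (reflexive (Sum.big-map (true ,_) (upTo (order g j)) f))
            (reflexive (Sum.big-map (false ,_) (upTo (order g j)) f)))

        moves>0 : 0 < length moves
        moves>0 = nonempty (order g j) (positive (order-Per hg j))
          where
          nonempty : ∀ o → 0 < o → 0 < length (map {B = Bool × ℕ} (true ,_) (upTo o) ++ map (false ,_) (upTo o))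
          nonempty (suc o) _ = s≤s z≤n

        private
          cut-Adm : ∀ {u} → CutBy g u → Adm g (cut g j u)
          cut-Adm cb = adm (Cut.cut-Perm hg cb j) (Cut.cut-Comm hg cb j)

        sum-τ : ∀ i f → Sum.big (centralizer g) f ≈ Sum.big (centralizer g) (f ∘ τ i)
        sum-τ (b , suc s) f = trans (sum-translate (cut-Adm (cutBy-self hg)) f)
          (sum-τ (b , s) (λ w → f (comp w (cut g j g))))
        sum-τ (true , zero) f = sum-translate (cut-Adm cutBy-neg) f
        sum-τ (false , zero) f = refl

        Adm-τ : ∀ {w} → Adm g w → ∀ i → Adm g (τ i w)
        Adm-τ aw (b , s) = Adm-iterC hg j (Adm-negC hg j aw b) s

      -- X b w only depends on w through the block of b.
      Local : (Fin n → SP n → Carrier) → Set _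
      Local X = ∀ {w} → Adm g w → ∀ j b → ¬ Blk w g b j → ∀ {u} → CutBy g u → X b (comp w (cut g j u)) ≈ X b w

      -- The value 1 off the representatives gives the products the same index list for all `w`, so
      -- a single factor can be exchanged inside the sum over `w`.
      atRep : (Fin n → SP n → Carrier) → Fin n → SP n → Carrier
      atRep X b w = if isRep w g b then X b w else 1#

      isRep-τ : ∀ {w} → Adm g w → ∀ j i b → isRep (τ j i w) g b ≡ isRep w g b
      isRep-τ aw j (c , s) b = cong (λ r → eqFin r b) (blkRep-τ hg j aw c s b)

      private
        Local-τ : ∀ {X} → Local X → ∀ {w} → Adm g w → ∀ j i b → ¬ Blk w g b j → X b (τ j i w) ≈ X b w
        Local-τ {X} loc {w} aw j (c , suc s) b ¬blk = trans
          (loc (Adm-τ j aw (c , s)) j b (λ k → ¬blk (Blocks.blkRep-≡⁻ hw hg cw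
            (≡.trans (≡.sym (blkRep-τ hg j aw c s b)) (≡.trans
              (Blocks.blkRep-≡ (Adm.perm (Adm-τ j aw (c , s))) hg (Adm.comm (Adm-τ j aw (c , s))) k)
              (blkRep-τ hg j aw c s j))))) (cutBy-self hg))
          (Local-τ loc aw j (c , s) b ¬blk)
          where
          hw = Adm.perm aw
          cw = Adm.comm aw
        Local-τ loc aw j (true , zero) b ¬blk = loc aw j b ¬blk cutBy-neg
        Local-τ loc aw j (false , zero) b ¬blk = refl

        atRep-τ : ∀ {X} → Local X → ∀ {w} → Adm g w → ∀ j → isRep w g j ≡ true → ∀ i b → ¬ (b ≡ j) →
          atRep X b (τ j i w) ≈ atRep X b w
        atRep-τ {X} loc {w} aw j rj i b b≢j = trans (reflexive
          (cong (λ r → if r then X b (τ j i w) else 1#) (isRep-τ aw j i b))) (go (isRep w g b) ≡.refl)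
          where
          go : ∀ r → isRep w g b ≡ r → (if r then X b (τ j i w) else 1#) ≈ (if r then X b w else 1#)
          go false _ = refl
          go true rb = Local-τ loc aw j i b λ k → b≢j (≡.trans (≡.sym (eqFin⁻ rb))
            (≡.trans (Blocks.blkRep-≡ (Adm.perm aw) hg (Adm.comm aw) k) (eqFin⁻ rj)))

        *-sumʳ : ∀ {A : Set} (xs : List A) (f : A → Carrier) x → Sum.big xs (λ a → f a * x) ≈ Sum.big xs f * x
        *-sumʳ xs f x = trans (Sum.big-cong xs (λ a _ → *-comm (f a) x)) (trans (sym (*-sumˡ xs x f)) (*-comm x _))

      -- The weight `Φ` depends on all of `w`, so it cannot be distributed over the blocks; it
      -- accompanies the factor under exchange, as the hypothesis `exchange` reflects.
      module Hybrid (Φ : SP n → Carrier) (X Y : Fin n → SP n → Carrier) (locX : Local X) (locY : Local Y)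
        (exchange : ∀ {w} → Adm g w → ∀ j → isRep w g j ≡ true →
          Sum.big (moves j) (λ i → Φ (τ j i w) * X j (τ j i w)) ≈ Sum.big (moves j)
            (λ i → Φ (τ j i w) * Y j (τ j i w))) where

        private
          step : ∀ j (rest : SP n → Carrier) → (∀ {w} → Adm g w → isRep w g j ≡ true → ∀ i → rest (τ j i w) ≈ rest w)
            →
            Sum.big (centralizer g) (λ w → Φ w * (atRep X j w * rest w)) ≈ Sum.big (centralizer g)
              (λ w → Φ w * (atRep Y j w * rest w))
          step j rest inv-rest = average (moves j) (τ j) (moves>0 j) (sum-τ j) _ _ λ {w} aw →
            go aw (isRep w g j) ≡.refl
            where
            go : ∀ {w} → Adm g w → ∀ r → isRep w g j ≡ r →
              Sum.big (moves j) (λ i → Φ (τ j i w) * (atRep X j (τ j i w) * rest (τ j i w))) ≈ Sum.big (moves j)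
                (λ i → Φ (τ j i w) * (atRep Y j (τ j i w) * rest (τ j i w)))
            go {w} aw false r = Sum.big-cong (moves j) λ i _ → *-congˡ
              (*-congʳ (reflexive (≡.trans (off X i) (≡.sym (off Y i)))))
              where
              off : ∀ Z i → atRep Z j (τ j i w) ≡ 1#
              off Z i = cong (λ r → if r then Z j (τ j i w) else 1#) (≡.trans (isRep-τ aw j i j) r)
            go {w} aw true r = trans (Sum.big-cong (moves j) (λ i _ → pull X i)) (trans (*-sumʳ (moves j) _ (rest w))
                (trans (*-congʳ (exchange aw j r)) (sym
                  (trans (Sum.big-cong (moves j) (λ i _ → pull Y i)) (*-sumʳ (moves j) _ (rest w))))))
              where
              pull : ∀ Z i → Φ (τ j i w) * (atRep Z j (τ j i w) * rest (τ j i w)) ≈ Φ (τ j i w) * Z j (τ j i w) * rest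
                w
              pull Z i = trans (*-congˡ (*-cong (reflexive
                (cong (λ r → if r then Z j (τ j i w) else 1#) (≡.trans (isRep-τ aw j i j) r))) (inv-rest aw r i)))
                (sym (*-assoc _ _ _))

          product-τ : ∀ {Z} → Local Z → ∀ j (bs : List (Fin n)) → (∀ {b} → b ∈ bs → ¬ (b ≡ j)) → ∀ {w} → Adm g w →
            isRep w g j ≡ true → ∀ i →
            Prod.big bs (λ b → atRep Z b (τ j i w)) ≈ Prod.big bs (λ b → atRep Z b w)
          product-τ loc j bs avoid aw r i = Prod.big-cong bs λ b b∈ → atRep-τ loc aw j r i b (avoid b∈)

          sweep : ∀ todo (done : List (Fin n)) → Unique todo → (∀ {b} → b ∈ done → ¬ (b ∈ todo)) →
            Sum.big (centralizer g) (λ w → Φ w * (Prod.big done (λ b → atRep Y b w) * Prod.big todo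
              (λ b → atRep X b w))) ≈
            Sum.big (centralizer g) (λ w → Φ w * (Prod.big done (λ b → atRep Y b w) * Prod.big todo
              (λ b → atRep Y b w)))
          sweep [] done _ _ = refl
          sweep (j ∷ todo) done (j∉ ∷ u) avoid = trans (Sum.big-cong (centralizer g)
            (λ w _ → *-congˡ (x*[y*z]≈y*[x*z] _ _ _)))
            (trans (step j _ (λ aw r i → *-cong (product-τ locY j done (λ b∈ e → avoid b∈ (here e)) aw r i)
              (product-τ locX j todo (λ b∈ e → All.lookup j∉ b∈ (≡.sym e)) aw r i)))
            (trans (Sum.big-cong (centralizer g) (λ w _ → *-congˡ (sym (*-assoc _ _ _))))
            (trans (sweep todo (j ∷ done) u (λ
              { (here ≡.refl) j∈ → All.lookup j∉ j∈ ≡.refl ; (there b∈) b∈′ → avoid b∈ (there b∈′) }))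
                   (Sum.big-cong (centralizer g) (λ w _ → *-congˡ (trans (*-assoc _ _ _) (x*[y*z]≈y*[x*z] _ _ _)))))))

        opaque
          hybrid : Sum.big (centralizer g) (λ w → Φ w * Prod.big (allFin n) (λ b → atRep X b w)) ≈ Sum.big
            (centralizer g) (λ w → Φ w * Prod.big (allFin n) (λ b → atRep Y b w))
          hybrid = trans (Sum.big-cong (centralizer g) (λ w _ → *-congˡ (sym (*-identityˡ _))))
            (trans (sweep (allFin n) [] (UniqueP.allFin⁺ n) (λ ()))
            (Sum.big-cong (centralizer g) (λ w _ → *-congˡ (*-identityˡ _))))

open CentralizerAveraging

-- The identity on a single block.

module CycleSums where
  open import Data.Bool using (Bool; true; false; _∧_; if_then_else_)
  open import Data.Bool.Properties using (∧-zeroʳ; ∧-identityʳ)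
  open import Data.Nat using (zero; suc; _<_; NonZero)
  import Data.Nat as ℕ
  import Data.Nat.Properties as ℕP
  open import Data.Nat.Divisibility
  open import Data.Nat.GCD using (gcd; gcd[m,n]≢0; gcd-greatest)
  open import Data.Fin using (Fin)
  open import Data.Product using (_,_; proj₁; proj₂; ∃)
  open import Data.Sum using (inj₁)
  open import Data.List using (upTo)
  open import Data.List.Membership.Propositional.Properties using (∈-upTo⁻)
  import Data.List.Relation.Unary.Unique.Propositional.Properties as UniqueP
  open import Relation.Binary.PropositionalEquality as ≡ using (_≡_; cong; subst)
  open import Relation.Nullary using (contradiction; ¬_; Dec; yes; no)
  import Relation.Binary.Reasoning.Setoid as SetoidReasoning

  module LocalSums {c ℓ} (F : Field' c ℓ) (n : ℕ) (α β : ℕ → Field'.Carrier F)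
    (prim : ∀ i → 1 ≤ i → i ≤ n → FieldOps.PrimRoot F i (α i) × FieldOps.PrimRoot F (2 ℕ.* i) (β i))
    {g : SP n} (hg : Perm g) (k : ℕ) where
    open FieldLemmas F
    open SetoidReasoning setoid
    open Zeta F n α β prim
    open LocalValues F n α β prim
    open CoreSums F

    rootAt : Fin n → SP n → Bool
    rootAt b w = eqPt (it w k (pos b)) (act g (pos b))

    trivialAt : Fin n → SP n → Bool
    trivialAt b w = eqPt (it w k (pos b)) (pos b)

    -- The equations `w^k = g` and `w^k = 1` are tested at one point of the block only; by
    -- commutation they then hold on all of it (`spread`).
    L R : Fin n → SP n → Carrier
    L b w = if rootAt b w then 1# else 0#
    R b w = if trivialAt b w then rho w g b else 0#

    module _ {w : SP n} (aw : Adm g w) (j b : Fin n) (¬blk : ¬ Blk w g b j) {u : SP n} (cb : CutBy g u) where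

      private
        same : it (comp w (cut g j u)) k (pos b) ≡ it w k (pos b)
        same = Cut.it-off hg cb j aw b ¬blk k

      L-local : L b (comp w (cut g j u)) ≈ L b w
      L-local = reflexive (cong (λ q → if eqPt q (act g (pos b)) then 1# else 0#) same)

      R-local : R b (comp w (cut g j u)) ≈ R b w
      R-local = reflexive (≡.cong₂ (λ q v → if eqPt q (pos b) then v else 0#) same
        (≡.sym (rho-transport (Adm.perm aw) (Adm.perm (Cut.y-Adm hg cb j aw)) hg hg (Adm.comm aw)
          (Adm.comm (Cut.y-Adm hg cb j aw)) (Cut.off-transport hg cb j aw b ¬blk))))

    opaque
      suc-order : ∀ j → ∃ λ o → order g j ≡ suc o
      suc-order j = go (order g j) ≡.refl
        where
        go : ∀ o → order g j ≡ o → ∃ λ o → order g j ≡ suc o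
        go zero e = contradiction (positive (order-Per hg j)) (λ z → ℕP.n≮0 (subst (0 <_) e z))
        go (suc o) e = o , e

    module Family {j : Fin n} {ε : Bool} {d σ : ℕ} {w : SP n} (mem : Member g j ε d σ w) (ε⇒plus : ε ≡ true → minus g j ≡ false) where

      p : Pt n
      p = pos j

      y : ℕ → SP n
      y s = iterC g j s w

      v : ℕ → Carrier
      v s = rho (y s) g j

      member : ∀ s → Member g j ε d (σ ℕ.+ s) (y s)
      member s = subst (λ x → Member g j ε d x (y s)) (ℕP.+-comm s σ) (Member-iterC hg mem s)

      module Facts (s : ℕ) = RhoFacts hg ε⇒plus (member s)

      opaque
        v-injective : ∀ {s t} → s < order g j → t < order g j → v s ≈ v t → s ≡ t
        v-injective {s} {t} s< t< e = order-inj hg j s< t< (it-inj hg σ (≡.trans (≡.sym (it-+ g σ s p))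
          (≡.trans (Distinct.rho-injective hg ε⇒plus (member s) (member t) e) (it-+ g σ t p))))

        not-dividing : ¬ (d ∣ k) → ∀ s → rootAt j (y s) ≡ false × trivialAt j (y s) ≡ false
        not-dividing d∤k s =
          ¬true⇒false (λ h → d∤k (to (Member.first-return (member s)) {k}
            (link 1 (cong ix (eqPt⁻ {p = it (y s) k p} {q = act g p} h))))) ,
          ¬true⇒false (λ h → d∤k (to (Member.first-return (member s)) {k}
            (link 0 (cong ix (eqPt⁻ {p = it (y s) k p} {q = p} h)))))

      module _ (l : ℕ) (k≡ld : k ≡ l ℕ.* d) where

        opaque
          it-k : ∀ s → it (y s) k p ≡ sg (par l ∧ ε) (it g (l ℕ.* (σ ℕ.+ s)) p)
          it-k s = ≡.trans (cong (λ x → it (y s) x p) k≡ld) (Facts.return-mul s l)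

          -- Here `y^k p` is the negative of a point on the `g`-orbit of `p`. A positive `g`-cycle
          -- contains no two opposite points, so neither `g p` nor `p` is attained.
          odd-sign : par l ∧ ε ≡ true → ∀ s → rootAt j (y s) ≡ false × trivialAt j (y s) ≡ false
          odd-sign odd s = ¬true⇒false (λ h → absurd 1 (eqPt⁻ {p = it (y s) k p} {q = act g p} h)) , ¬true⇒false
            (λ h → absurd 0 (eqPt⁻ {p = it (y s) k p} {q = p} h))
            where
            plus : minus g j ≡ false
            plus = ε⇒plus (proj₂ (∧⁻ {par l} odd))
            x : ℕ
            x = l ℕ.* (σ ℕ.+ s)
            absurd : ∀ a → ¬ (it (y s) k p ≡ it g a p)
            absurd a e = true≢false ≡.refl (sg-fix {a = true} {p = it g a p}
              (≡.trans (cong (sg true) (≡.sym (plus-exact₂ hg j plus x a (cong ix turned)))) turned))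
              where
              turned : sg true (it g x p) ≡ it g a p
              turned = ≡.trans (cong (λ b → sg b (it g x p)) (≡.sym odd)) (≡.trans (≡.sym (it-k s)) e)

        P Q : ℕ → Bool
        P x = eqPt (it g (l ℕ.* x) p) p
        Q x = eqPt (it g (l ℕ.* x) p) (act g p)

        module _ (even : par l ∧ ε ≡ false) where

          opaque
            it-k′ : ∀ s → it (y s) k p ≡ it g (l ℕ.* (σ ℕ.+ s)) p
            it-k′ s = ≡.trans (it-k s) (cong (λ b → sg b (it g (l ℕ.* (σ ℕ.+ s)) p)) even)

            L≡ : ∀ s → L j (y s) ≡ (if Q (σ ℕ.+ s) then 1# else 0#)
            L≡ s = cong (λ q → if eqPt q (act g p) then 1# else 0#) (it-k′ s)

            R≡ : ∀ s → R j (y s) ≡ (if P (σ ℕ.+ s) then v s else 0#)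
            R≡ s = cong (λ q → if eqPt q p then v s else 0#) (it-k′ s)

            P⇒ : ∀ {x} → P x ≡ true → order g j ∣ l ℕ.* x
            P⇒ {x} h = to (order-Per hg j) {l ℕ.* x} (eqPt⁻ {p = it g (l ℕ.* x) p} {q = p} h)

            P⇐ : ∀ {x} → order g j ∣ l ℕ.* x → P x ≡ true
            P⇐ {x} h = eqPt⁺ {p = it g (l ℕ.* x) p} {q = p} (from (order-Per hg j) h)

            v-order : ∀ s → powK (v s) (order g j) ≈ 1#
            v-order s = Facts.rho-order s

            v-l : ∀ s → P (σ ℕ.+ s) ≡ true → powK (v s) l ≈ 1#
            v-l s h = Facts.rho-return s l (≡.trans (cong (λ x → it (y s) x p) (≡.sym k≡ld))
              (≡.trans (it-k′ s) (eqPt⁻ {p = it g (l ℕ.* (σ ℕ.+ s)) p} {q = p} h)))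

            sum-main : ∀ o → order g j ≡ suc o → Sum.big (upTo (suc o)) (λ s → L j (y s)) ≈ Sum.big (upTo (suc o))
              (λ s → R j (y s))
            sum-main o oe = trans (Sum.big-cong (upTo (suc o)) (λ s _ → reflexive (L≡ s)))
              (trans (sum-units≈sum-roots o l P Q σ v
                (λ h → subst (_∣ _) oe (P⇒ h)) (λ h → P⇐ (subst (_∣ _) (≡.sym oe) h)) Q⇒ Q⇐
                (λ s _ → subst (λ x → powK (v s) x ≈ 1#) oe (v-order s)) v-l
                (λ s< t< → v-injective (subst (_ <_) (≡.sym oe) s<) (subst (_ <_) (≡.sym oe) t<)))
              (Sum.big-cong (upTo (suc o)) (λ s _ → reflexive (≡.sym (R≡ s)))))
              where
              -- As `g` has order `suc o` on this cycle, `g^o` undoes one step of `g`; this turns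
              -- `l x ≡ 1` into a return after `l x + o` steps.
              closes : it g o (act g p) ≡ p
              closes = ≡.trans (≡.sym (it-sucʳ g o p)) (from (order-Per hg j) (∣-reflexive oe))
              Q⇒ : ∀ {x} → Q x ≡ true → suc o ∣ l ℕ.* x ℕ.+ o
              Q⇒ {x} h = subst (_∣ l ℕ.* x ℕ.+ o) oe (to (order-Per hg j) {l ℕ.* x ℕ.+ o}
                (≡.trans (it-+′ g (l ℕ.* x) o p) (≡.trans
                  (cong (it g o) (eqPt⁻ {p = it g (l ℕ.* x) p} {q = act g p} h)) closes)))
              Q⇐ : ∀ {x} → suc o ∣ l ℕ.* x ℕ.+ o → Q x ≡ true
              Q⇐ {x} h = eqPt⁺ {p = it g (l ℕ.* x) p} {q = act g p} (it-inj hg o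
                (≡.trans (≡.sym (it-+′ g (l ℕ.* x) o p)) (≡.trans
                  (from (order-Per hg j) (subst (_∣ l ℕ.* x ℕ.+ o) (≡.sym oe) h)) (≡.sym closes))))

      opaque
        sum-exchange : Sum.big (upTo (order g j)) (λ s → L j (y s)) ≈ Sum.big (upTo (order g j)) (λ s → R j (y s))
        sum-exchange = go (d ∣? k)
          where
          zeros : (∀ s → rootAt j (y s) ≡ false × trivialAt j (y s) ≡ false) →
            Sum.big (upTo (order g j)) (λ s → L j (y s)) ≈ Sum.big (upTo (order g j)) (λ s → R j (y s))
          zeros h = Sum.big-cong (upTo (order g j)) λ s _ → trans
            (reflexive (cong (λ b → if b then 1# else 0#) (proj₁ (h s))))
            (reflexive (cong (λ b → if b then v s else 0#) (≡.sym (proj₂ (h s)))))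
          go : Dec (d ∣ k) → Sum.big (upTo (order g j)) (λ s → L j (y s)) ≈ Sum.big (upTo (order g j))
            (λ s → R j (y s))
          go (no d∤k) = zeros (not-dividing d∤k)
          go (yes (divides l e)) = by-sign (par l ∧ ε) ≡.refl
            where
            by-sign : ∀ b → par l ∧ ε ≡ b → Sum.big (upTo (order g j)) (λ s → L j (y s)) ≈ Sum.big (upTo (order g j))
              (λ s → R j (y s))
            by-sign true odd = zeros (odd-sign l e odd)
            by-sign false even = let (o , oe) = suc-order j in
              subst (λ x → Sum.big (upTo x) (λ s → L j (y s)) ≈ Sum.big (upTo x) (λ s → R j (y s))) (≡.sym oe)
                (sum-main l e even o oe)

      -- When g has a negative cycle of even length at j, the m-th power of v s detects the parity of the exponent,
      -- so twisting by the sign keeps the values distinct roots of unity.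
      module Twisted (ty : minus g j ≡ true) (m-even : par (clen g j) ≡ false) where

        m : ℕ
        m = clen g j

        private
          ε-false : ε ≡ false
          ε-false = ¬true⇒false λ eε → true≢false ty (ε⇒plus eε)

        opaque
          -- If `y s` is positive at `j`, agreement up to sign suffices. If it is negative,
          -- `g^e p = g^(u (σ + s)) p` holds exactly, and an even `σ + s` makes `m * u * (σ + s)` a
          -- multiple of the order `2 * m` of `g`.
          even⇒ : ∀ s → par (σ ℕ.+ s) ≡ false → powK (v s) m ≈ 1#
          even⇒ s ev = Facts.Sim⇒rho-one s m (go κ ≡.refl)
            where
            open Facts s hiding (m; p; ε-false) renaming (R to Rₑ)
            go : ∀ b → κ ≡ b → Sim κ (it g (m ℕ.* e) p) p
            go false eκ = subst (λ b → Sim b (it g (m ℕ.* e) p) p) (≡.sym eκ) (from (clen-Per hg j) (m∣m*n e))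
            go true eκ = Sim-reflexive κ (exact d∣R)
              where
              exact : d ∣ Rₑ → it g (m ℕ.* e) p ≡ p
              exact (divides u R≡) = ≡.trans (it-power (Comm-self g) {e} {u ℕ.* (σ ℕ.+ s)} {false} {p} (≡.sym back) m)
                (≡.trans (cong (λ b → sg b (it g (m ℕ.* (u ℕ.* (σ ℕ.+ s))) p)) (∧-zeroʳ (par m)))
                  (from (order-Per hg j) (subst (λ b → (if b then 2 ℕ.* m else m) ∣ m ℕ.* (u ℕ.* (σ ℕ.+ s)))
                  (≡.sym ty) double)))
                where
                back : it g (u ℕ.* (σ ℕ.+ s)) p ≡ it g e p
                back = ≡.trans (≡.sym (≡.trans (return-mul u)
                  (cong (λ b → sg b (it g (u ℕ.* (σ ℕ.+ s)) p))
                  (≡.trans (cong (par u ∧_) ε-false) (∧-zeroʳ (par u))))))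
                  (≡.trans (cong (λ x → it (y s) x p) (≡.sym R≡))
                    (subst (λ b → Sim b (it (y s) Rₑ p) (it g e p)) eκ simR))
                double : 2 ℕ.* m ∣ m ℕ.* (u ℕ.* (σ ℕ.+ s))
                double = subst (_∣ m ℕ.* (u ℕ.* (σ ℕ.+ s))) (ℕP.*-comm m 2)
                  (*-monoʳ-∣ m (∣n⇒∣m*n u (even⇒2∣ (σ ℕ.+ s) ev)))

          -- For odd `σ + s` its divisor `e` is odd. As `m = M e` is even, so is `M`, and
          -- `plus⇒M-odd` forces `y s` to be negative at `j`. Then `v^m = 1` would say that
          -- `g^(m e)` fixes `p`, whereas an odd number `e` of turns around a negative cycle negates
          -- it.
          ⇒even : ∀ s → powK (v s) m ≈ 1# → par (σ ℕ.+ s) ≡ false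
          ⇒even s one = ¬true⇒false λ odd → contradiction (sg-fix {a = true} {p = p} (turn (e-odd odd) (κ-true odd)))
            (λ ())
            where
            open Facts s hiding (m; p; R; ε-false)
            e-odd : par (σ ℕ.+ s) ≡ true → par e ≡ true
            e-odd odd = proj₂ (∧⁻ {par s₁} {par e} (≡.trans (≡.sym (≡.trans (cong par σ≡s₁e) (par-* s₁ e))) odd))
            κ-true : par (σ ℕ.+ s) ≡ true → κ ≡ true
            κ-true odd = go κ ≡.refl
              where
              go : ∀ b → κ ≡ b → b ≡ true
              go true _ = ≡.refl
              go false eκ = contradiction (≡.trans (cong par m≡Me)
                (≡.trans (par-* M e) (≡.cong₂ _∧_ (plus⇒M-odd ty eκ) (e-odd odd)))) (λ z → true≢false z m-even)
            turn : par e ≡ true → κ ≡ true → sg true p ≡ p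
            turn eo eκ = ≡.trans (≡.sym (≡.trans (cong (λ x → it g x p) (ℕP.*-comm m e))
              (≡.trans (it-clen-mul hg j e) (cong (λ b → sg b p) (≡.cong₂ _∧_ eo ty)))))
              (subst (λ b → Sim b (it g (m ℕ.* e) p) p) eκ (rho-one⇒Sim m one))

        v± : ℕ → Carrier
        v± s = sign (par (σ ℕ.+ s)) * v s

        opaque
          v±-power : ∀ s q → par q ≡ false → powK (v± s) q ≈ powK (v s) q
          v±-power s q eq = trans (powK-distrib _ _ q) (trans
            (*-congʳ (trans (sign-pow (par (σ ℕ.+ s)) q) (reflexive (cong (λ b → sign (b ∧ par (σ ℕ.+ s))) eq))))
            (*-identityˡ _))

          -- The even power `m` removes the signs and reveals the parities of the exponents; these
          -- being equal, the signs cancel and `v-injective` applies.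
          v±-injective : ∀ {s t} → s < order g j → t < order g j → v± s ≈ v± t → s ≡ t
          v±-injective {s} {t} s< t< e = go (par (σ ℕ.+ s)) (par (σ ℕ.+ t)) ≡.refl ≡.refl
            where
            powers : powK (v s) m ≈ powK (v t) m
            powers = trans (sym (v±-power s m m-even)) (trans (powK-cong m e) (v±-power t m m-even))
            cancel : ∀ b → par (σ ℕ.+ s) ≡ b → par (σ ℕ.+ t) ≡ b → v s ≈ v t
            cancel b es et = *-cancelˡ-unit (sign b) (sign-square b)
              (≡.subst₂ (λ a a′ → sign a * v s ≈ sign a′ * v t) es et e)
            go : ∀ a b → par (σ ℕ.+ s) ≡ a → par (σ ℕ.+ t) ≡ b → s ≡ t
            go true true es et = v-injective s< t< (cancel true es et)
            go false false es et = v-injective s< t< (cancel false es et)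
            go false true es et = contradiction (⇒even t (trans (sym powers) (even⇒ s es))) (true≢false et)
            go true false es et = contradiction (⇒even s (trans powers (even⇒ t et))) (true≢false es)

          -- `k = l d` even and `d` odd make `l` even, and the order `2 * m` is even too. So the gcd
          -- is even: it is at least 2, and the signs vanish from gcd-th powers.
          twisted-sum-zero : par d ≡ true → par k ≡ false → Sum.big (upTo (order g j))
            (λ s → sign (par (σ ℕ.+ s)) * R j (y s)) ≈ 0#
          twisted-sum-zero d-odd k-even = go (d ∣? k)
            where
            go : Dec (d ∣ k) → Sum.big (upTo (order g j)) (λ s → sign (par (σ ℕ.+ s)) * R j (y s)) ≈ 0#
            go (no d∤k) = Sum.big-ε (upTo (order g j)) λ s _ → trans
              (*-congˡ (reflexive (cong (λ b → if b then v s else 0#) (proj₂ (not-dividing d∤k s))))) (zeroʳ _)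
            go (yes (divides l e)) = trans (Sum.big-cong (upTo (order g j))
              (λ s _ → trans (*-congˡ (reflexive (R≡ l e even s))) (push (P l e (σ ℕ.+ s)) s)))
              (sum-zero (upTo (order g j)) (gcd (order g j) l) 2≤q (UniqueP.upTo⁺ (order g j)) (λ s → P l e (σ ℕ.+ s))
                v±
                (count-roots (order g j) {{order≢0}} l (P l e) (P⇒ l e even) (P⇐ l e even) σ)
                (λ {s} _ ps → trans (v±-power s (gcd (order g j) l) (2∣⇒even 2∣q))
                  (powK-gcd (order g j) l (v-order l e even s) (v-l l e even s ps)))
                (λ s∈ t∈ _ _ → v±-injective (∈-upTo⁻ s∈) (∈-upTo⁻ t∈)))
              where
              even : par l ∧ ε ≡ false
              even = ≡.trans (cong (par l ∧_) ε-false) (∧-zeroʳ (par l))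
              l-even : par l ≡ false
              l-even = ≡.trans (≡.sym (∧-identityʳ (par l)))
                (≡.trans (cong (par l ∧_) (≡.sym d-odd)) (≡.trans (≡.sym (par-* l d))
                (≡.trans (cong par (≡.sym e)) k-even)))
              order≢0 : NonZero (order g j)
              order≢0 = ℕ.>-nonZero (positive (order-Per hg j))
              2∣q : 2 ∣ gcd (order g j) l
              2∣q = gcd-greatest (subst (λ b → 2 ∣ (if b then 2 ℕ.* m else m)) (≡.sym ty) (m∣m*n m))
                (even⇒2∣ l l-even)
              2≤q : 2 ≤ gcd (order g j) l
              2≤q = ∣⇒≤ {{ℕ.≢-nonZero (gcd[m,n]≢0 (order g j) l (inj₁ (ℕP.>⇒≢ (positive (order-Per hg j)))))}} 2∣q
              push : ∀ b s → sign (par (σ ℕ.+ s)) * (if b then v s else 0#) ≈ (if b then v± s else 0#)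
              push true s = refl
              push false s = zeroʳ _

open CycleSums

-- The sign character with kernel D_n.

module Signs where
  open import Algebra.Bundles using (CommutativeRing)
  open import Function using (_∘_; id)
  open import Data.Bool using (Bool; true; false; not; _∧_; _xor_; if_then_else_; T?)
  open import Data.Bool.Properties using (∧-identityʳ; xor-∧-commutativeRing; not-involutive; xor-assoc; xor-comm; xor-same; xor-identityʳ)
  open import Data.Nat using (zero; suc; _<_; _≡ᵇ_; _%_)
  import Data.Nat as ℕ
  import Data.Nat.Properties as ℕP
  open import Data.Nat.Divisibility
  open import Data.Nat.DivMod using ([m+kn]%n≡m%n)
  open import Data.Fin using (Fin)
  import Data.Fin as Fin
  open import Data.Product using (_,_; proj₁; proj₂; ∃)
  open import Data.Sum using (inj₁; inj₂)
  open import Data.Vec using (Vec; []; _∷_; lookup; toList)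
  open import Data.List using (List; []; _∷_; filterᵇ; upTo; allFin; length)
  import Data.List as List
  open import Data.List.Properties using (map-tabulate; length-tabulate; length-upTo)
  open import Data.List.Membership.Propositional.Properties using (∈-upTo⁺; ∈-upTo⁻; ∈-allFin)
  open import Data.List.Relation.Unary.Any using (here; there)
  import Data.List.Relation.Unary.Unique.Propositional.Properties as UniqueP
  open import Relation.Binary.PropositionalEquality hiding (setoid)
  open import Relation.Nullary using (contradiction)

  module Xor = Big (CommutativeRing.+-commutativeMonoid xor-∧-commutativeRing)

  xor-const : ∀ {A : Set} (xs : List A) b → Xor.big xs (λ _ → b) ≡ par (length xs) ∧ b
  xor-const [] b = refl
  xor-const (x ∷ xs) b = trans (cong (b xor_) (xor-const xs b)) (xor-∧-step (par (length xs)) b)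

  xor-true : ∀ {A : Set} (xs : List A) {f : A → Bool} → Xor.big xs f ≡ true → ∃ λ x → x ∈ xs × f x ≡ true
  xor-true (x ∷ xs) {f} h with f x in eq
  ... | true = x , here refl , eq
  ... | false = let (y , y∈ , e) = xor-true xs h in y , there y∈ , e

  module _ {n : ℕ} where

    sign-at : SP n → Fin n → Bool
    sign-at w i = proj₁ (act w (pos i))

    act-sign : ∀ w (p : Pt n) → proj₁ (act w p) ≡ proj₁ p xor sign-at w (ix p)
    act-sign w p = trans (cong (λ q → proj₁ (act w q)) (pos-ix p)) (cong proj₁ (act-sg w (proj₁ p) (pos (ix p))))

    opaque
      sgn : SP n → Bool
      sgn w = Xor.big (allFin n) (sign-at w)

      sgn-def : ∀ w → sgn w ≡ Xor.big (allFin n) (sign-at w)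
      sgn-def w = refl

      sgn-comp : ∀ w {v} → Perm v → sgn (comp w v) ≡ sgn w xor sgn v
      sgn-comp w {v} hv = begin
        sgn (comp w v)
          ≡⟨ Xor.big-cong (allFin n) (λ i _ → trans (cong proj₁ (act-comp w v (pos i))) (act-sign w (act v (pos i))))
            ⟩
        Xor.big (allFin n) (λ i → sign-at v i xor sign-at w (ix (act v (pos i))))
          ≡⟨ Xor.big-∙ (allFin n) (sign-at v) (λ i → sign-at w (ix (act v (pos i)))) ⟩
        sgn v xor Xor.big (allFin n) (λ i → sign-at w (ix (act v (pos i))))
          ≡⟨ cong (sgn v xor_) (Xor.big-reindex (λ i → ix (act v (pos i))) (sign-at w) (UniqueP.allFin⁺ n)
            (UniqueP.allFin⁺ n) (λ _ → ∈-allFin _)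
               (λ {i} {k} _ _ e → ix-inj hv {pos i} {pos k} e)
               (λ {i} _ → ix (act (inv v) (pos i)) , ∈-allFin _ , trans (act-ix v refl)
                 (cong ix (inv-spec hv (pos i))))) ⟨
        sgn v xor sgn w
          ≡⟨ xor-comm (sgn v) (sgn w) ⟩
        sgn w xor sgn v ∎
        where open ≡-Reasoning

      sgn-id : sgn (idSP {n}) ≡ false
      sgn-id = Xor.big-ε (allFin n) λ i _ → cong proj₁ (act-id (pos i))

    onCyc-sum : ∀ {g : SP n} → Perm g → ∀ j (f : Fin n → Bool) →
      Xor.big (allFin n) (λ i → if onCyc g j i then f i else false) ≡ Xor.big (upTo (clen g j))
        (λ l → f (ix (it g l (pos j))))
    onCyc-sum {g} hg j f = trans (sym (Xor.big-filter (onCyc g j) (allFin n) f))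
      (Xor.big-reindex (λ l → ix (it g l (pos j))) f (UniqueP.upTo⁺ (clen g j))
        (UniqueP.filter⁺ (T? ∘ onCyc g j) (UniqueP.allFin⁺ n))
        (λ {l} _ → ∈-filterᵇ⁺ (onCyc g j) (∈-allFin _) (onCyc⁺ hg {j} {it g l (pos j)} (Cyc-sym hg (cyc l refl))))
        (λ {l} {k} l∈ k∈ → inj (∈-upTo⁻ l∈) (∈-upTo⁻ k∈))
        (λ {i} i∈ → surj (Cyc-sym hg (onCyc⁻ hg {j} {pos i} (proj₂ (∈-filterᵇ⁻ (onCyc g j) {allFin n} i∈))))))
      where
      inj≤ : ∀ {l k} → l ≤ k → k < clen g j → ix (it g l (pos j)) ≡ ix (it g k (pos j)) → l ≡ k
      inj≤ {l} le k< e with ℕP.m≤n⇒∃[o]m+o≡n le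
      ... | zero , refl = sym (ℕP.+-identityʳ l)
      ... | suc o , refl = contradiction (∣⇒≤
        (to (clen-Per hg j) {suc o} (it-ix-inj hg l {q = pos j}
        (trans (cong ix (sym (it-+ g l (suc o) (pos j)))) (sym e)))))
          (ℕP.<⇒≱ (ℕP.≤-<-trans (ℕP.m≤n+m (suc o) l) k<))
      inj : ∀ {l k} → l < clen g j → k < clen g j → ix (it g l (pos j)) ≡ ix (it g k (pos j)) → l ≡ k
      inj {l} {k} l< k< e with ℕP.≤-total l k
      ... | inj₁ le = inj≤ le k< e
      ... | inj₂ le = sym (inj≤ le l< (sym e))
      surj : ∀ {i} → Cyc g (pos j) (pos i) → ∃ λ l → l ∈ upTo (clen g j) × ix (it g l (pos j)) ≡ i
      surj (cyc r e) = let (s , s< , es) = reduce-ix (clen-Per hg j) r in s , ∈-upTo⁺ s< , trans es e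

    sign-telescope : ∀ (g : SP n) p L → Xor.big (upTo L) (λ l → sign-at g (ix (it g l p))) ≡ proj₁ p xor proj₁
      (it g L p)
    sign-telescope g p zero = sym (xor-same (proj₁ p))
    sign-telescope g p (suc L) = trans (Xor.big-upTo-last L _)
      (trans (cong (_xor sign-at g (ix (it g L p))) (sign-telescope g p L))
      (trans (xor-assoc (proj₁ p) (proj₁ (it g L p)) _) (cong (proj₁ p xor_) (sym (act-sign g (it g L p))))))

    cycle-sign : ∀ {g : SP n} → Perm g → ∀ j → Xor.big (upTo (clen g j)) (λ l → sign-at g (ix (it g l (pos j)))) ≡
      minus g j
    cycle-sign {g} hg j = trans (sign-telescope g (pos j) (clen g j))
      (trans (cong proj₁ (it-clen hg j)) (xor-identityʳ (minus g j)))

    opaque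
      unfolding sgn

      sgn-cut-g : ∀ {g : SP n} → Perm g → ∀ j → sgn (cut g j g) ≡ minus g j
      sgn-cut-g {g} hg j = trans (Xor.big-cong (allFin n)
        (λ i _ → trans (cong proj₁ (cut-pos g j g i)) (if-fst (onCyc g j i))))
        (trans (onCyc-sum hg j (sign-at g)) (cycle-sign hg j))
        where
        if-fst : ∀ b {p : Pt n} {i} → proj₁ (if b then p else pos i) ≡ (if b then proj₁ p else false)
        if-fst true = refl
        if-fst false = refl

      sgn-cut-neg : ∀ {g : SP n} → Perm g → ∀ j → sgn (cut g j negSP) ≡ par (clen g j)
      sgn-cut-neg {g} hg j = trans (Xor.big-cong (allFin n)
        (λ i _ → trans (cong proj₁ (cut-pos g j negSP i)) (if-neg (onCyc g j i))))
        (trans (onCyc-sum hg j (λ _ → true)) (trans (xor-const (upTo (clen g j)) true)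
          (trans (∧-identityʳ _) (cong par (length-upTo (clen g j))))))
        where
        if-neg : ∀ b {i : Fin n} → proj₁ (if b then act negSP (pos i) else pos i) ≡ (if b then true else false)
        if-neg true = cong proj₁ (act-neg (pos _))
        if-neg false = refl

    -- The sign of -g on the block b.
    bad : SP n → SP n → Fin n → Bool
    bad w g b = Xor.big (allFin n) (λ i → if eqFin b (blkRep w g i) then not (sign-at g i) else false)

    module BadBlocks {w g : SP n} (hw : Perm w) (hg : Perm g) (c : Comm w g) where
      open Blocks hw hg c

      private
        c′ : Comm g w
        c′ = Comm-sym {w = w} {v = g} c

        f : Fin n → Bool
        f i = not (sign-at g i)

        cyc-of : Fin n → ℕ → Fin n
        cyc-of = cycleOf hg hw c′

      opaque
        unfolding sgn

        -- The hypothesis says that -g has odd sign. This sign is the sum of the signs on the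
        -- blocks, so some block is odd.
        exists-bad : par n xor sgn g ≡ true → ∃ λ b → isRep w g b ≡ true × bad w g b ≡ true
        exists-bad total with xor-true (allFin n) {bad w g} (trans (sym fibred) total)
          where
          fibred : par n xor sgn g ≡ Xor.big (allFin n) (bad w g)
          fibred = begin
            par n xor sgn g
              ≡⟨ cong (λ x → x xor sgn g) (sym
              (trans (xor-const (allFin n) true) (trans (∧-identityʳ _)
              (cong par (length-tabulate {n = n} (λ (i : Fin n) → i)))))) ⟩
            Xor.big (allFin n) (λ _ → true) xor sgn g
              ≡⟨ Xor.big-∙ (allFin n) (λ _ → true) (sign-at g) ⟨
            Xor.big (allFin n) f
              ≡⟨ Xor.big-fibre {xs = allFin n} {ys = allFin n} (λ b i → eqFin b (blkRep w g i)) (blkRep w g) f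
              (UniqueP.allFin⁺ n) (λ _ → ∈-allFin _) (λ _ → eqFin⁺ refl) (λ _ _ → eqFin⁻) ⟩
            Xor.big (allFin n) (bad w g)                              ∎
            where
            open ≡-Reasoning
        ... | b , _ , hb with xor-true (allFin n) hb
        ... | i , _ , hi = b , eqFin⁺ (rep (eqFin b (blkRep w g i)) refl) , hb
          where
          rep : ∀ t → eqFin b (blkRep w g i) ≡ t → blkRep w g b ≡ b
          rep true e = trans (cong (blkRep w g) (eqFin⁻ {i = b} e)) (trans (blkRep-idem i) (sym (eqFin⁻ {i = b} e)))
          rep false e = contradiction (cong (λ t → if t then not (sign-at g i) else false) e) (λ z → true≢false hi z)

      module _ (j : Fin n) where

        private
          inBlk : Fin n → Bool
          inBlk i = eqFin (blkRep w g j) (blkRep w g i)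

          d : ℕ
          d = expG g w j

          bases : List (Fin n)
          bases = filterᵇ (λ i → eqFin (base g (pos i)) i ∧ inBlk i) (allFin n)

          flip : ∀ {i k} → Blk w g i k → Blk g w i k
          flip {i} (blk a b e) = blk b a (trans (cong ix (sym (it-it c a b (pos i)))) e)

          unflip : ∀ {i k} → Blk g w i k → Blk w g i k
          unflip {i} (blk a b e) = blk b a (trans (cong ix (it-it c b a (pos i))) e)

          inner : ∀ a → Xor.big (allFin n) (λ i → if onCyc g (cyc-of j a) i then f i else false) ≡ par (clen g j) xor
            minus g j
          inner a = begin
            Xor.big (allFin n) (λ i → if onCyc g j′ i then f i else false)    ≡⟨ onCyc-sum hg j′ f ⟩
            Xor.big (upTo (clen g j′)) (λ l → f (ix (it g l (pos j′))))
              ≡⟨ Xor.big-∙ (upTo (clen g j′)) (λ _ → true) (λ l → sign-at g (ix (it g l (pos j′)))) ⟩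
            Xor.big (upTo (clen g j′)) (λ _ → true) xor Xor.big (upTo (clen g j′))
              (λ l → sign-at g (ix (it g l (pos j′))))
              ≡⟨ cong₂ _xor_ (trans (xor-const (upTo (clen g j′)) true)
                (trans (∧-identityʳ _) (cong par (length-upTo (clen g j′))))) (cycle-sign hg j′) ⟩
            par (clen g j′) xor minus g j′
              ≡⟨ cong₂ (λ m t → par m xor t) (clen-Blk hg hw c′ path) (minus-Blk hg hw c′ path) ⟨
            par (clen g j) xor minus g j                                        ∎
            where
            open ≡-Reasoning
            j′ : Fin n
            j′ = cyc-of j a
            path : Blk g w j j′
            path = cycleOf-Blk hg hw c′ j a

          in-base : ∀ {i} → i ∈ bases → base g (pos i) ≡ i × blkRep w g j ≡ blkRep w g i
          in-base {i} i∈ = let (a , b) = ∧⁻ {eqFin (base g (pos i)) i} (proj₂ (∈-filterᵇ⁻ (λ i → eqFin (base g (pos i)) i ∧ inBlk i) {allFin n} i∈)) in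
            eqFin⁻ a , eqFin⁻ b

          base-in : ∀ {i} → base g (pos i) ≡ i → blkRep w g j ≡ blkRep w g i → i ∈ bases
          base-in {i} a b = ∈-filterᵇ⁺ (λ i → eqFin (base g (pos i)) i ∧ inBlk i) (∈-allFin i)
            (cong₂ _∧_ (eqFin⁺ a) (eqFin⁺ b))

        opaque
          -- The block is made of `d` translates by `w` of the `g`-cycle of `j`, all of the same
          -- length and class. On each, -1 contributes the length and `g` contributes its class. The
          -- translates are listed by `cycleOf` with `w` and `g` exchanged.
          bad-formula : isRep w g j ≡ true → bad w g j ≡ par d ∧ (par (clen g j) xor minus g j)
          bad-formula rep = begin
            bad w g j
              ≡⟨ Xor.big-cong (allFin n) (λ i _ → cong (λ r → if eqFin r (blkRep w g i) then f i else false)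
                (sym (eqFin⁻ rep))) ⟩
            Xor.big (allFin n) (λ i → if inBlk i then f i else false)
              ≡⟨ Xor.big-filter inBlk (allFin n) f ⟨
            Xor.big blkL f
              ≡⟨ Xor.big-fibre {xs = blkL} {ys = bases} (λ b i → onCyc g b i) (λ i → base g (pos i)) f
                (UniqueP.filter⁺ (T? ∘ (λ i → eqFin (base g (pos i)) i ∧ inBlk i)) (UniqueP.allFin⁺ n)) into
                   (λ {i} _ → eqFin⁺ (base-≡ hg (base-Cyc hg (pos i))))
                   (λ {i} {b} _ b∈ on → trans (sym (proj₁ (in-base b∈))) (sym (eqFin⁻ on))) ⟩
            Xor.big bases (λ b → Xor.big blkL (λ i → if onCyc g b i then f i else false))
              ≡⟨ Xor.big-cong bases (λ b b∈ → trans (Xor.big-filter inBlk (allFin n) _)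
                (Xor.big-cong (allFin n) (λ i _ → drop b∈ i))) ⟩
            Xor.big bases (λ b → Xor.big (allFin n) (λ i → if onCyc g b i then f i else false))
              ≡⟨ Xor.big-reindex {xs = upTo d} {ys = bases} (cyc-of j)
                (λ b → Xor.big (allFin n) (λ i → if onCyc g b i then f i else false)) (UniqueP.upTo⁺ d)
                (UniqueP.filter⁺ (T? ∘ (λ i → eqFin (base g (pos i)) i ∧ inBlk i)) (UniqueP.allFin⁺ n))
                   (λ {a} _ → base-in (cycleOf-base hg hw c′ j a) (blkRep-≡ (unflip (cycleOf-Blk hg hw c′ j a))))
                   (λ a∈ b∈ → cycleOf-inj hg hw c′ j (∈-upTo⁻ a∈) (∈-upTo⁻ b∈))
                   (λ b∈ → let (l , l< , e) = cycleOf-surj hg hw c′ j (proj₁ (in-base b∈)) (flip (blkRep-≡⁻ (proj₂ (in-base b∈)))) in l , ∈-upTo⁺ l< , e) ⟩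
            Xor.big (upTo d) (λ a → Xor.big (allFin n) (λ i → if onCyc g (cyc-of j a) i then f i else false))
              ≡⟨ Xor.big-cong (upTo d) (λ a _ → inner a) ⟩
            Xor.big (upTo d) (λ _ → par (clen g j) xor minus g j)
              ≡⟨ trans (xor-const (upTo d) _) (cong (λ x → par x ∧ (par (clen g j) xor minus g j)) (length-upTo d)) ⟩
            par d ∧ (par (clen g j) xor minus g j) ∎
            where
            open ≡-Reasoning
            blkL : List (Fin n)
            blkL = filterᵇ inBlk (allFin n)
            into : ∀ {i} → i ∈ blkL → base g (pos i) ∈ bases
            into {i} i∈ = base-in (sym (base-≡ hg (base-Cyc hg (pos i))))
              (trans (eqFin⁻ (proj₂ (∈-filterᵇ⁻ inBlk {allFin n} i∈))) (blkRep-≡ (let cyc r e = base-Cyc hg (pos i) in blk 0 r e)))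
            drop : ∀ {b} → b ∈ bases → ∀ i → (if inBlk i then (if onCyc g b i then f i else false) else false) ≡
              (if onCyc g b i then f i else false)
            drop {b} b∈ i = go (onCyc g b i) refl
              where
              go : ∀ t → onCyc g b i ≡ t → (if inBlk i then (if t then f i else false) else false) ≡
                (if t then f i else false)
              go false _ = const (inBlk i)
                where
                const : ∀ t → (if t then false else false) ≡ false
                const true = refl
                const false = refl
              go true on = cong (λ t → if t then f i else false)
                (eqFin⁺ (trans (proj₂ (in-base b∈)) (sym (blkRep-≡ (path (onCyc⁻ hg {b} {pos i} on))))))
                where
                path : Cyc g (pos i) (pos b) → Blk w g i b
                path (cyc r e) = blk 0 r e

    private
      big-suc : ∀ {m} x (v : Vec (Pt n) m) → Xor.big (allFin m) (proj₁ ∘ lookup v) ≡ Xor.big (List.tabulate Fin.suc)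
        (proj₁ ∘ lookup (x ∷ v))
      big-suc {m} x v = trans (sym (Xor.big-map Fin.suc (allFin m) (proj₁ ∘ lookup (x ∷ v))))
        (cong (λ l → Xor.big l (proj₁ ∘ lookup (x ∷ v))) (map-tabulate id Fin.suc))

      toList-sum : ∀ {m} (v : Vec (Pt n) m) → par (length (filterᵇ proj₁ (toList v))) ≡ Xor.big (allFin m)
        (proj₁ ∘ lookup v)
      toList-sum [] = refl
      toList-sum ((true , i) ∷ v) = cong not (trans (toList-sum v) (big-suc (true , i) v))
      toList-sum ((false , i) ∷ v) = trans (toList-sum v) (big-suc (false , i) v)

      even-%2 : ∀ a → (a % 2 ≡ᵇ 0) ≡ not (par a)
      even-%2 zero = refl
      even-%2 (suc zero) = refl
      even-%2 (suc (suc a)) = trans (cong (_≡ᵇ 0) (trans (cong (_% 2) (ℕP.+-comm 2 a)) ([m+kn]%n≡m%n a 1 2)))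
        (trans (even-%2 a) (cong not (sym (not-involutive (par a)))))

    opaque
      unfolding sgn

      negCount-sgn : ∀ (w : SP n) → (negCount w % 2 ≡ᵇ 0) ≡ not (sgn w)
      negCount-sgn w = trans (even-%2 (negCount w))
        (cong not (trans (toList-sum w) (Xor.big-cong (allFin n) (λ i _ → cong proj₁ (sym (act-pos w i))))))

      ∈-Dn⁺ : ∀ {w : SP n} → Perm w → sgn w ≡ false → w ∈ Dn n
      ∈-Dn⁺ {w} hw e = ∈-filterᵇ⁺ (λ w → negCount w % 2 ≡ᵇ 0) (∈-Bn⁺ hw) (trans (negCount-sgn w) (cong not e))

      ∈-Dn⁻ : ∀ {w : SP n} → w ∈ Dn n → Perm w × sgn w ≡ false
      ∈-Dn⁻ {w} w∈ = let (b , e) = ∈-filterᵇ⁻ (λ w → negCount w % 2 ≡ᵇ 0) {Bn n} w∈ in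
        ∈-Bn⁻ b , trans (sym (not-involutive (sgn w))) (cong not (trans (sym (negCount-sgn w)) e))

open Signs

-- Plain and sign-twisted sums over the centralizer.

module SignedSums where
  open import Data.Bool using (true; false; not; _∧_; _xor_; if_then_else_)
  open import Data.Bool.Properties using (∧-zeroʳ; ∧-identityʳ; xor-assoc; xor-identityʳ)
  open import Data.Nat using (zero; suc)
  import Data.Nat as ℕ
  open import Data.Nat.Divisibility
  open import Data.Fin using (Fin)
  open import Data.Product using (_,_; proj₁; proj₂)
  open import Data.List using (upTo; allFin)
  open import Data.List.Membership.Propositional.Properties using (∈-allFin)
  open import Relation.Binary.PropositionalEquality as ≡ using (_≡_; cong)
  open import Relation.Nullary using (¬_; Dec; yes; no)
  import Relation.Binary.Reasoning.Setoid as SetoidReasoning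

  module CentralizerSums {c ℓ} (F : Field' c ℓ) (char0 : FieldOps.CharZero F) (n : ℕ) (α β : ℕ → Field'.Carrier F)
    (prim : ∀ i → 1 ≤ i → i ≤ n → FieldOps.PrimRoot F i (α i) × FieldOps.PrimRoot F (2 ℕ.* i) (β i))
    {g : SP n} (hg : Perm g) (k : ℕ) where
    open FieldLemmas F
    open SetoidReasoning setoid
    open Averaging F char0
    open LocalSums F n α β prim hg k

    private
      blockProduct : (Fin n → SP n → Carrier) → SP n → Carrier
      blockProduct X w = Prod.big (allFin n) (λ b → atRep hg X b w)

      exchange-s : ∀ {w} → Adm g w → ∀ j → Sum.big (upTo (order g j)) (λ s → L j (iterC g j s w)) ≈ Sum.big
        (upTo (order g j)) (λ s → R j (iterC g j s w))
      exchange-s aw j = Family.sum-exchange (Start.member st) (Start.ε⇒plus st)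
        where st = startMember hg aw j

    opaque
      sum-roots≈sum-trivial : Sum.big (centralizer g) (blockProduct L) ≈ Sum.big (centralizer g) (blockProduct R)
      sum-roots≈sum-trivial = trans (Sum.big-cong (centralizer g) (λ w _ → sym (*-identityˡ _))) (trans
        (Hybrid.hybrid hg (λ _ → 1#) L R (λ aw j b ¬blk cb → L-local aw j b ¬blk cb)
          (λ aw j b ¬blk cb → R-local aw j b ¬blk cb) exchange)
        (Sum.big-cong (centralizer g) (λ w _ → *-identityˡ _)))
        where
        unit : ∀ (X : Fin n → SP n → Carrier) {w} j → Sum.big (moves hg j) (λ i → 1# * X j (τ hg j i w)) ≈
               Sum.big (upTo (order g j)) (λ s → X j (iterC g j s (negC g j true w))) + Sum.big (upTo (order g j))
                 (λ s → X j (iterC g j s w))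
        unit X {w} j = trans (Sum.big-cong (moves hg j) (λ i _ → *-identityˡ _))
          (sum-moves hg j (λ i → X j (τ hg j i w)))
        exchange : ∀ {w} → Adm g w → ∀ j → isRep w g j ≡ true →
          Sum.big (moves hg j) (λ i → 1# * L j (τ hg j i w)) ≈ Sum.big (moves hg j) (λ i → 1# * R j (τ hg j i w))
        -- The identity holds separately for the moves with and without negation, since `w` and its
        -- negated version can both serve as starting element.
        exchange aw j _ = trans (unit L j) (trans (+-cong (exchange-s (Adm-negC hg j aw true) j) (exchange-s aw j))
          (sym (unit R j)))

    private
      -- Setting the factor to 0 on bad blocks leaves the twisted sum unchanged (`exchange°`); since
      -- every `w` has a bad block, all terms then vanish.
      R° : Fin n → SP n → Carrier
      R° b w = if bad w g b then 0# else R b w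

      bad-τ : ∀ {w} → Adm g w → ∀ j i b → bad (τ hg j i w) g b ≡ bad w g b
      bad-τ {w} aw j (c , s) b = Xor.big-cong (allFin n) λ i _ →
        cong (λ r → if eqFin b r then not (sign-at g i) else false) (blkRep-τ hg j aw c s i)

      R°-local : ∀ {w} → Adm g w → ∀ j b → ¬ Blk w g b j → ∀ {u} → CutBy g u → R° b (comp w (cut g j u)) ≈ R° b w
      R°-local {w} aw j b ¬blk {u} cb = trans (reflexive
        (cong (λ t → if t then 0# else R b (comp w (cut g j u))) same)) (go (bad w g b))
        where
        same : bad (comp w (cut g j u)) g b ≡ bad w g b
        same = Xor.big-cong (allFin n) λ i _ → cong (λ r → if eqFin b r then not (sign-at g i) else false)
          (Cut.blkRep-y hg cb j aw i)
        go : ∀ t → (if t then 0# else R b (comp w (cut g j u))) ≈ (if t then 0# else R b w)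
        go true = refl
        go false = R-local aw j b ¬blk cb

      Φ : SP n → Carrier
      Φ w = sign (sgn w)

      sgn-iterC : ∀ w j s → sgn (iterC g j s w) ≡ sgn w xor (par s ∧ minus g j)
      sgn-iterC w j zero = ≡.sym (xor-identityʳ (sgn w))
      sgn-iterC w j (suc s) = ≡.trans (sgn-comp (iterC g j s w) (Cut.cut-Perm hg (cutBy-self hg) j))
        (≡.trans (≡.cong₂ _xor_ (sgn-iterC w j s) (sgn-cut-g hg j))
        (≡.trans (xor-assoc (sgn w) (par s ∧ minus g j) (minus g j)) (cong (sgn w xor_) (lem (par s) (minus g j)))))
        where
        lem : ∀ x y → (x ∧ y) xor y ≡ not x ∧ y
        lem true true = ≡.refl
        lem true false = ≡.refl
        lem false y = ≡.refl

    module _ (k-even : par k ≡ false) where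

      private
        module _ {j : Fin n} where

          -- The return time of the starting element and the one in `bad-formula` generate the same
          -- set of return times, so they are equal; a bad block makes both factors of the formula
          -- odd.
          odd-data : ∀ {w} (aw : Adm g w) → isRep w g j ≡ true → bad w g j ≡ true →
            par (Start.d (startMember hg aw j)) ≡ true × par (clen g j) xor minus g j ≡ true
          odd-data {w} (adm p cm) rep hb = ∧⁻ (≡.trans (cong (λ d → par d ∧ (par (clen g j) xor minus g j))
            (Per-unique (Member.first-return (Start.member (startMember hg (adm p cm) j)))
              (expG-Per hg p (Comm-sym {w = w} {v = g} cm) j)))
            (≡.trans (≡.sym (BadBlocks.bad-formula p hg cm j rep)) hb))

          -- On a negative cycle each move by `g` changes the sign of `w`, so the sum alternates in
          -- `s`. The cycle has even length because the block is bad.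
          zero-minus : ∀ {w} (aw : Adm g w) → isRep w g j ≡ true → bad w g j ≡ true → minus g j ≡ true →
            Sum.big (upTo (order g j)) (λ s → Φ (iterC g j s w) * R j (iterC g j s w)) ≈ 0#
          zero-minus {w} aw rep hb ty = begin
            Sum.big (upTo (order g j)) (λ s → Φ (y s) * R j (y s))
              ≈⟨ Sum.big-cong (upTo (order g j)) (λ s _ → trans (*-congʳ (split s)) (*-assoc _ _ _)) ⟩
            Sum.big (upTo (order g j)) (λ s → C * (sign (par (σ ℕ.+ s)) * R j (y s)))
              ≈⟨ *-sumˡ (upTo (order g j)) C _ ⟨
            C * Sum.big (upTo (order g j)) (λ s → sign (par (σ ℕ.+ s)) * R j (y s))
              ≈⟨ *-congˡ (Family.Twisted.twisted-sum-zero (Start.member st) (Start.ε⇒plus st) ty m-even (proj₁ odd)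
                k-even) ⟩
            C * 0#
              ≈⟨ zeroʳ C ⟩
            0# ∎
            where
            st = startMember hg aw j
            odd = odd-data aw rep hb
            m-even : par (clen g j) ≡ false
            m-even = lem (par (clen g j)) (≡.trans (cong (par (clen g j) xor_) (≡.sym ty)) (proj₂ odd))
              where
              lem : ∀ x → x xor true ≡ true → x ≡ false
              lem false _ = ≡.refl
            σ : ℕ
            σ = Start.σ st
            y : ℕ → SP n
            y s = iterC g j s w
            -- The moves give the sign of `s`, while `twisted-sum-zero` uses that of `σ + s`; the
            -- constant absorbs the difference.
            C : Carrier
            C = sign (sgn w) * sign (par σ)
            split : ∀ s → Φ (y s) ≈ C * sign (par (σ ℕ.+ s))
            split s = begin
              sign (sgn (y s))
                ≡⟨ cong sign (≡.trans (sgn-iterC w j s) (cong (sgn w xor_)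
                (≡.trans (cong (par s ∧_) ty) (∧-identityʳ (par s))))) ⟩
              sign (sgn w xor par s)                                     ≈⟨ sign-xor (sgn w) (par s) ⟩
              sign (sgn w) * sign (par s)
                ≈⟨ *-congˡ (trans (sym (*-identityˡ _)) (trans (*-congʳ (sym (sign-square (par σ)))) (*-assoc _ _ _)))
                ⟩
              sign (sgn w) * (sign (par σ) * (sign (par σ) * sign (par s))) ≈⟨ *-assoc _ _ _ ⟨
              C * (sign (par σ) * sign (par s))
                ≈⟨ *-congˡ (trans (sym (sign-xor (par σ) (par s))) (reflexive (cong sign (≡.sym (par-+ σ s))))) ⟩
              C * sign (par (σ ℕ.+ s))                                   ∎

          module _ {w : SP n} (aw : Adm g w) (rep : isRep w g j ≡ true) (hb : bad w g j ≡ true) (ty : minus g j ≡ false) where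

            private
              odd = odd-data aw rep hb
              st = startMember hg aw j

              w⁻ : SP n
              w⁻ = negC g j true w

              aw⁻ : Adm g w⁻
              aw⁻ = Adm-negC hg j aw true

              m-odd : par (clen g j) ≡ true
              m-odd = ≡.trans (≡.sym (xor-identityʳ _)) (≡.trans (cong (par (clen g j) xor_) (≡.sym ty)) (proj₂ odd))

              constant : ∀ w → Sum.big (upTo (order g j)) (λ s → Φ (iterC g j s w) * R j (iterC g j s w)) ≈ Φ w *
                Sum.big (upTo (order g j)) (λ s → R j (iterC g j s w))
              constant w = trans (Sum.big-cong (upTo (order g j)) (λ s _ → *-congʳ (reflexive (cong sign
                (≡.trans (sgn-iterC w j s) (≡.trans
                  (cong (sgn w xor_) (≡.trans (cong (par s ∧_) ty) (∧-zeroʳ (par s)))) (xor-identityʳ (sgn w))))))))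
                  (sym (*-sumˡ (upTo (order g j)) (Φ w) _))

              mem = Start.member st
              module Fam = Family mem (λ _ → ty)
              module Fam⁻ = Family (Member-cut-neg hg mem) (λ _ → ty)

              -- The sums of `R` for `w` and `w⁻` are compared by way of `L`: the values of ρ are
              -- not directly related, but the `k`-th powers are, since negation only replaces `ε`
              -- by its opposite and `ε` enters with the even exponent `l`.
              L-same : ∀ s → L j (iterC g j s w⁻) ≡ L j (iterC g j s w)
              L-same s = go (Start.d st ∣? k)
                where
                go : Dec (Start.d st ∣ k) → L j (iterC g j s w⁻) ≡ L j (iterC g j s w)
                go (no d∤k) = ≡.trans (cong (λ b → if b then 1# else 0#) (proj₁ (Fam⁻.not-dividing d∤k s)))
                  (cong (λ b → if b then 1# else 0#) (≡.sym (proj₁ (Fam.not-dividing d∤k s))))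
                go (yes (divides l e)) = cong (λ q → if eqPt q (act g (pos j)) then 1# else 0#)
                  (≡.trans (Fam⁻.it-k l e s)
                    (≡.trans (cong (λ b → sg b (it g (l ℕ.* (Start.σ st ℕ.+ s)) (pos j)))
                      (≡.trans (cong (_∧ not (Start.ε st)) l-even) (≡.sym (cong (_∧ Start.ε st) l-even))))
                      (≡.sym (Fam.it-k l e s))))
                  where
                  l-even : par l ≡ false
                  l-even = ≡.trans (≡.sym (∧-identityʳ (par l)))
                    (≡.trans (cong (par l ∧_) (≡.sym (proj₁ odd)))
                    (≡.trans (≡.sym (par-* l (Start.d st))) (≡.trans (cong par (≡.sym e)) k-even)))

            -- On a positive cycle of odd length, moves by `g` keep the sign of `w` and negation
            -- reverses it, so the two equal sums of `R` occur with opposite weights.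
            zero-plus : Sum.big (upTo (order g j)) (λ s → Φ (iterC g j s w⁻) * R j (iterC g j s w⁻)) + Sum.big
              (upTo (order g j)) (λ s → Φ (iterC g j s w) * R j (iterC g j s w)) ≈ 0#
            zero-plus = begin
              Sum.big (upTo (order g j)) (λ s → Φ (iterC g j s w⁻) * R j (iterC g j s w⁻)) + Sum.big
                (upTo (order g j)) (λ s → Φ (iterC g j s w) * R j (iterC g j s w))
                ≈⟨ +-cong (constant w⁻) (constant w) ⟩
              Φ w⁻ * Sum.big (upTo (order g j)) (λ s → R j (iterC g j s w⁻)) + Φ w * Sum.big (upTo (order g j))
                (λ s → R j (iterC g j s w))
                ≈⟨ +-cong (*-congˡ (trans (sym (exchange-s aw⁻ j))
                  (trans (Sum.big-cong (upTo (order g j)) (λ s _ → reflexive (L-same s))) (exchange-s aw j)))) refl ⟩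
              Φ w⁻ * S + Φ w * S
                ≈⟨ distribʳ S _ _ ⟨
              (Φ w⁻ + Φ w) * S
                ≈⟨ *-congʳ (trans (+-congʳ flipped) (-‿inverseˡ (Φ w))) ⟩
              0# * S
                ≈⟨ zeroˡ S ⟩
              0# ∎
              where
              S : Carrier
              S = Sum.big (upTo (order g j)) (λ s → R j (iterC g j s w))
              flipped : Φ w⁻ ≈ - Φ w
              flipped = trans (reflexive (cong sign (sgn-comp w (Cut.cut-Perm hg cutBy-neg j))))
                (trans (sign-xor (sgn w) _)
                (trans (*-congˡ (reflexive (cong sign (≡.trans (sgn-cut-neg hg j) m-odd))))
                  (trans (*-comm _ _) (-1*x≈-x _))))

        exchange° : ∀ {w} → Adm g w → ∀ j → isRep w g j ≡ true →
          Sum.big (moves hg j) (λ i → Φ (τ hg j i w) * R j (τ hg j i w)) ≈ Sum.big (moves hg j)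
            (λ i → Φ (τ hg j i w) * R° j (τ hg j i w))
        exchange° {w} aw j rep = go (bad w g j) ≡.refl
          where
          value : ∀ t → bad w g j ≡ t → ∀ i → R° j (τ hg j i w) ≡ (if t then 0# else R j (τ hg j i w))
          value t e i = cong (λ t → if t then 0# else R j (τ hg j i w)) (≡.trans (bad-τ aw j i j) e)
          go : ∀ t → bad w g j ≡ t → Sum.big (moves hg j) (λ i → Φ (τ hg j i w) * R j (τ hg j i w)) ≈ Sum.big
            (moves hg j) (λ i → Φ (τ hg j i w) * R° j (τ hg j i w))
          go false e = Sum.big-cong (moves hg j) λ i _ → *-congˡ (reflexive (≡.sym (value false e i)))
          go true e = trans (sum-moves hg j (λ i → Φ (τ hg j i w) * R j (τ hg j i w)))
            (trans (by-type (minus g j) ≡.refl)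
            (sym (Sum.big-ε (moves hg j) λ i _ → trans (*-congˡ (reflexive (value true e i))) (zeroʳ _))))
            where
            by-type : ∀ t → minus g j ≡ t → Sum.big (upTo (order g j))
              (λ s → Φ (iterC g j s (negC g j true w)) * R j (iterC g j s (negC g j true w)))
              + Sum.big (upTo (order g j)) (λ s → Φ (iterC g j s w) * R j (iterC g j s w)) ≈ 0#
            by-type false ty = zero-plus aw rep e ty
            by-type true ty = trans (+-cong (zero-minus (Adm-negC hg j aw true)
              (≡.trans (isRep-τ hg aw j (true , 0) j) rep) (≡.trans (bad-τ aw j (true , 0) j) e) ty)
              (zero-minus aw rep e ty)) (+-identityˡ 0#)

      opaque
        signed-sum-zero : par n xor sgn g ≡ true → Sum.big (centralizer g) (λ w → sign (sgn w) * blockProduct R w) ≈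
          0#
        signed-sum-zero total = trans (Hybrid.hybrid hg Φ R R° (λ aw j b ¬blk cb → R-local aw j b ¬blk cb) R°-local
          exchange°)
          (Sum.big-ε (centralizer g) λ w w∈ → let (adm p cm) = ∈-centralizer⁻ w∈ ; (b , rep , hb) = BadBlocks.exists-bad p hg cm total in
            trans (*-congˡ (prod-zero (allFin n) (∈-allFin b)
              (reflexive (≡.trans (cong (λ t → if t then R° b w else 1#) rep)
              (cong (λ t → if t then 0# else R b w) hb))))) (zeroʳ _))

open SignedSums

-- Invariance under conjugation, and products of local conditions.

module Conjugation where
  open import Function using (_∘_)
  open import Data.Bool using (Bool; true; false; _∧_; _xor_; if_then_else_; T?)
  open import Data.Bool.ListAction using (all)
  open import Data.Nat using (zero; suc)
  import Data.Nat as ℕ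
  open import Data.Fin using (Fin)
  open import Data.Product using (_,_; proj₁; proj₂; ∃)
  open import Data.List using (List; _∷_; allFin; filterᵇ)
  open import Data.List.Membership.Propositional.Properties using (∈-allFin)
  import Data.List.Relation.Unary.Unique.Propositional.Properties as UniqueP
  open import Relation.Binary.PropositionalEquality as ≡ using (_≡_; cong)
  open import Relation.Nullary using (contradiction)
  import Relation.Binary.Reasoning.Setoid as SetoidReasoning

  module _ {n : ℕ} where
    open ≡

    record InDn (w : SP n) : Set where
      constructor inDn
      field
        perm : Perm w
        even : sgn w ≡ false

    InDn⇒∈ : ∀ {w} → InDn w → w ∈ Dn n
    InDn⇒∈ (inDn p e) = ∈-Dn⁺ p e

    ∈⇒InDn : ∀ {w} → w ∈ Dn n → InDn w
    ∈⇒InDn w∈ = let (p , e) = ∈-Dn⁻ w∈ in inDn p e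

    opaque
      comp-invʳ : ∀ {t : SP n} → Perm t → comp t (inv t) ≡ idSP
      comp-invʳ {t} ht = SP-ext λ p → trans (act-comp t (inv t) p) (trans (inv-spec ht p) (sym (act-id p)))

      sgn-inv : ∀ {w : SP n} → Perm w → sgn (inv w) ≡ sgn w
      sgn-inv {w} hw = lem (sgn w) (sgn (inv w)) (trans (sym (sgn-comp w (Perm-inv hw)))
        (trans (cong sgn (comp-invʳ hw)) (sgn-id {n = n})))
        where
        lem : ∀ a b → a xor b ≡ false → b ≡ a
        lem true true _ = refl
        lem false false _ = refl

      InDn-id : InDn idSP
      InDn-id = inDn Perm-id (sgn-id {n = n})

      InDn-comp : ∀ {w v} → InDn w → InDn v → InDn (comp w v)
      InDn-comp {w} (inDn p e) (inDn p′ e′) = inDn (Perm-comp p p′) (trans (sgn-comp w p′) (cong₂ _xor_ e e′))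

      InDn-inv : ∀ {w} → InDn w → InDn (inv w)
      InDn-inv (inDn p e) = inDn (Perm-inv p) (trans (sgn-inv p) e)

      inv-inv : ∀ {w : SP n} → Perm w → inv (inv w) ≡ w
      inv-inv {w} hw = SP-ext λ p → Perm-inv hw (trans (inv-spec (Perm-inv hw) p) (sym (inv-specˡ hw p)))

      Perm-powℕ : ∀ {w : SP n} → Perm w → ∀ k → Perm (powℕ w k)
      Perm-powℕ hw zero = Perm-id
      Perm-powℕ hw (suc k) = Perm-comp hw (Perm-powℕ hw k)

      sgn-powℕ : ∀ {w : SP n} → Perm w → ∀ k → sgn (powℕ w k) ≡ par k ∧ sgn w
      sgn-powℕ hw zero = sgn-id {n = n}
      sgn-powℕ {w} hw (suc k) = trans (sgn-comp w (Perm-powℕ hw k))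
        (trans (cong (sgn w xor_) (sgn-powℕ hw k)) (xor-∧-step (par k) (sgn w)))

      powℕ⁻ : ∀ {w v : SP n} {k e} → powℕ w k ≡ powℕ v e → ∀ p → it w k p ≡ it v e p
      powℕ⁻ {w} {v} {k} {e} eq p = trans (sym (powℕ-act w k p)) (trans (cong (λ u → act u p) eq) (powℕ-act v e p))

      powℕ⁺ : ∀ {w v : SP n} {k e} → (∀ p → it w k p ≡ it v e p) → powℕ w k ≡ powℕ v e
      powℕ⁺ {w} {v} {k} {e} h = SP-ext λ p → trans (powℕ-act w k p) (trans (h p) (sym (powℕ-act v e p)))

      powℕ-one : ∀ (g : SP n) → powℕ g 1 ≡ g
      powℕ-one g = SP-ext λ p → powℕ-act g 1 p

      act-conj : ∀ (t x : SP n) p → act (conjBy t x) p ≡ act t (act x (act (inv t) p))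
      act-conj t x p = trans (act-comp t (comp x (inv t)) p) (cong (act t) (act-comp x (inv t) p))

      it-conj : ∀ {t : SP n} → Perm t → ∀ x k p → it (conjBy t x) k (act t p) ≡ act t (it x k p)
      it-conj ht x zero p = refl
      it-conj {t} ht x (suc k) p = trans (cong (act (conjBy t x)) (it-conj ht x k p))
        (trans (act-conj t x _) (cong (act t ∘ act x) (inv-specˡ ht _)))

      Perm-conj : ∀ {t x : SP n} → Perm t → Perm x → Perm (conjBy t x)
      Perm-conj ht hx = Perm-comp ht (Perm-comp hx (Perm-inv ht))

      InDn-conj : ∀ {t x} → InDn t → InDn x → InDn (conjBy t x)
      InDn-conj dt dx = InDn-comp dt (InDn-comp dx (InDn-inv dt))

      conj-comp : ∀ {s t : SP n} → Perm s → Perm t → ∀ x → conjBy s (conjBy t x) ≡ conjBy (comp s t) x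
      conj-comp {s} {t} hs ht x = SP-ext λ p → trans (act-conj s (conjBy t x) p)
        (trans (cong (act s) (act-conj t x _)) (sym
        (trans (act-conj (comp s t) x p) (trans (act-comp s t _) (cong (act s ∘ act t ∘ act x) (Perm-comp hs ht
          (trans (inv-spec (Perm-comp hs ht) p) (sym
            (trans (act-comp s t _) (trans (cong (act s) (inv-spec ht _)) (inv-spec hs p)))))))))))

      conj-id : ∀ (x : SP n) → conjBy idSP x ≡ x
      conj-id x = SP-ext λ p → trans (act-conj idSP x p)
        (trans (act-id _) (cong (act x) (trans (sym (act-id _)) (inv-spec Perm-id p))))

      conj-inv : ∀ {t : SP n} → Perm t → ∀ {x y} → conjBy t x ≡ y → conjBy (inv t) y ≡ x
      conj-inv {t} ht {x} refl = trans (conj-comp (Perm-inv ht) ht x) (trans (cong (λ s → conjBy s x)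
        (SP-ext λ p → trans (act-comp (inv t) t p) (trans (inv-specˡ ht p) (sym (act-id p))))) (conj-id x))

      act-conj⁻ : ∀ {t : SP n} → Perm t → ∀ g q → act t (act (comp (inv t) (comp g t)) q) ≡ act g (act t q)
      act-conj⁻ {t} ht g q = trans (cong (act t)
        (trans (act-comp (inv t) (comp g t) q) (cong (act (inv t)) (act-comp g t q)))) (inv-spec ht _)

      Comm-conj⁺ : ∀ {t x g : SP n} → Perm t → Comm (conjBy t x) g → Comm (comp (inv t) (comp g t)) x
      Comm-conj⁺ {t} {x} {g} ht c p = ht (begin
        act t (act z (act x p))                      ≡⟨ act-conj⁻ ht g (act x p) ⟩
        act g (act t (act x p))                      ≡⟨ cong (act g) (it-conj ht x 1 p) ⟨
        act g (act (conjBy t x) (act t p))           ≡⟨ c (act t p) ⟨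
        act (conjBy t x) (act g (act t p))           ≡⟨ cong (act (conjBy t x)) (act-conj⁻ ht g p) ⟨
        act (conjBy t x) (act t (act z p))           ≡⟨ it-conj ht x 1 (act z p) ⟩
        act t (act x (act z p))                      ∎)
        where
        open ≡-Reasoning
        z : SP n
        z = comp (inv t) (comp g t)

      Comm-conj⁻ : ∀ {t x g : SP n} → Perm t → Comm (comp (inv t) (comp g t)) x → Comm (conjBy t x) g
      Comm-conj⁻ {t} {x} {g} ht c p = begin
        act (conjBy t x) (act g p)                   ≡⟨ cong (λ q → act (conjBy t x) (act g q)) (inv-spec ht p) ⟨
        act (conjBy t x) (act g (act t q))           ≡⟨ cong (act (conjBy t x)) (act-conj⁻ ht g q) ⟨
        act (conjBy t x) (act t (act z q))           ≡⟨ it-conj ht x 1 (act z q) ⟩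
        act t (act x (act z q))                      ≡⟨ cong (act t) (c q) ⟨
        act t (act z (act x q))                      ≡⟨ act-conj⁻ ht g (act x q) ⟩
        act g (act t (act x q))                      ≡⟨ cong (act g) (it-conj ht x 1 q) ⟨
        act g (act (conjBy t x) (act t q))           ≡⟨ cong (λ q → act g (act (conjBy t x) q)) (inv-spec ht p) ⟩
        act g (act (conjBy t x) p)                   ∎
        where
        open ≡-Reasoning
        z : SP n
        z = comp (inv t) (comp g t)
        q : Pt n
        q = act (inv t) p

      conj-Iso : ∀ {t x g : SP n} → Perm t → Iso x (comp (inv t) (comp g t)) (conjBy t x) g
      conj-Iso {t} {x} {g} ht = record { v = act t ; v-inj = ht ; v-sg = act-sg t ; v-w = λ p → sym (it-conj ht x 1 p)
        ; v-g = act-conj⁻ ht g }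

      conj-Iso-surj : ∀ {t x g : SP n} (ht : Perm t) → ∀ i → ∃ λ k → ix (Iso.v (conj-Iso {t} {x} {g} ht) (pos k)) ≡ i
      conj-Iso-surj {t} ht i = ix (act (inv t) (pos i)) , trans (act-ix t refl) (cong ix (inv-spec ht (pos i)))

      -- Both `w^k` and `g^e` commute with the maps `w^a g^y` that carry `b` through its block.
      spread : ∀ {w g : SP n} → Comm w g → ∀ {k e b i} → Blk w g b i → it w k (pos b) ≡ it g e (pos b) →
        it w k (pos i) ≡ it g e (pos i)
      spread {w} {g} c {k} {e} {b} {i} (blk a y r) h = go (ix≡⇒sg {p = pos i} {q = q} (sym r))
        where
        open ≡-Reasoning
        q : Pt n
        q = it w a (it g y (pos b))
        at-q : it w k q ≡ it g e q
        at-q = begin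
          it w k (it w a (it g y (pos b)))  ≡⟨ it-it (Comm-self w) k a _ ⟩
          it w a (it w k (it g y (pos b)))  ≡⟨ cong (it w a) (it-it c k y _) ⟩
          it w a (it g y (it w k (pos b)))  ≡⟨ cong (it w a ∘ it g y) h ⟩
          it w a (it g y (it g e (pos b)))  ≡⟨ cong (it w a) (it-it (Comm-self g) y e _) ⟩
          it w a (it g e (it g y (pos b)))  ≡⟨ it-it c a e _ ⟩
          it g e (it w a (it g y (pos b)))  ∎
        go : (∃ λ s → pos i ≡ sg s q) → it w k (pos i) ≡ it g e (pos i)
        go (s , es) = trans (cong (it w k) es) (trans (it-sg w k s q)
          (trans (cong (sg s) at-q) (trans (sym (it-sg g e s q)) (cong (it g e) (sym es)))))

  module OmegaFacts {c ℓ} (F : Field' c ℓ) (n : ℕ) (α β : ℕ → Field'.Carrier F)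
    (prim : ∀ i → 1 ≤ i → i ≤ n → FieldOps.PrimRoot F i (α i) × FieldOps.PrimRoot F (2 ℕ.* i) (β i)) where
    open FieldLemmas F
    open SetoidReasoning setoid
    open Zeta F n α β prim
    open OmegaProduct F n α β prim

    module _ {x z y g : SP n} (hx : Perm x) (hz : Perm z) (hy : Perm y) (hg : Perm g) (cx : Comm x z) (cy : Comm y g)
      (iso : Iso x z y g) (surj : ∀ i → ∃ λ k → ix (Iso.v iso (pos k)) ≡ i) where
      open Iso iso using (v; v-ix; v-ix-inj; it-v-w; it-v-g; v-sg; transport)
      private
        module X = Blocks hx hz cx
        module Y = Blocks hy hg cy

        image : Fin n → Fin n
        image b = ix (v (pos b))

        image-reach : ∀ a b i → ix (it y a (it g b (pos (image i)))) ≡ ix (v (it x a (it z b (pos i))))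
        image-reach a b i = ≡.trans (it-ix y a (it-ix g b {pos (image i)} {v (pos i)} ≡.refl))
          (cong ix (≡.trans (cong (it y a) (it-v-g b (pos i))) (it-v-w a _)))

        Blk-image : ∀ {i k} → Blk x z i k → Blk y g (image i) (image k)
        Blk-image {i} {k} (blk a b e) = blk a b (≡.trans (image-reach a b i) (v-ix {q = pos k} e))

        Blk-image⁻ : ∀ {i k} → Blk y g (image i) (image k) → Blk x z i k
        Blk-image⁻ {i} {k} (blk a b e) = blk a b (v-ix-inj {q = pos k} (≡.trans (≡.sym (image-reach a b i)) e))

        h : Fin n → Fin n
        h b = blkRep y g (image b)

        rho-h : ∀ b → rho x z b ≡ rho y g (h b)
        rho-h b = ≡.trans (rho-transport hx hy hz hg cx cy (transport b)) (to-rep (Y.blkRep-Blk (image b)))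
          where
          to-rep : ∀ {i k} → Blk y g i k → rho y g i ≡ rho y g k
          to-rep {i} (blk a b ≡.refl) = rho-transport hy hy hg hg cy cy (Iso.transport (Iso-Blk hy hg cy a b) i)

      opaque
        -- `v` matches blocks but not their least elements, so `h` continues to the representative
        -- of the image block; the factor does not change, being constant on blocks.
        Omega-Iso : Omega x z ≈ Omega y g
        Omega-Iso = begin
          Omega x z                                          ≈⟨ Prod.big-filter (isRep x z) (allFin n) (rho x z) ⟨
          Prod.big (filterᵇ (isRep x z) (allFin n)) (rho x z)
            ≈⟨ Prod.big-cong (filterᵇ (isRep x z) (allFin n)) (λ b _ → reflexive (rho-h b)) ⟩
          Prod.big (filterᵇ (isRep x z) (allFin n)) (λ b → rho y g (h b))
            ≈⟨ Prod.big-reindex {xs = filterᵇ (isRep x z) (allFin n)} {ys = filterᵇ (isRep y g) (allFin n)} h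
              (rho y g)
                 (UniqueP.filter⁺ (T? ∘ isRep x z) (UniqueP.allFin⁺ n))
                   (UniqueP.filter⁺ (T? ∘ isRep y g) (UniqueP.allFin⁺ n))
                 (λ {b} _ → ∈-filterᵇ⁺ (isRep y g) (∈-allFin _) (eqFin⁺ (Y.blkRep-idem (image b)))) inj onto ⟨
          Prod.big (filterᵇ (isRep y g) (allFin n)) (rho y g) ≈⟨ Prod.big-filter (isRep y g) (allFin n) (rho y g) ⟩
          Omega y g                                          ∎
          where
          rep : ∀ {b} → b ∈ filterᵇ (isRep x z) (allFin n) → blkRep x z b ≡ b
          rep b∈ = eqFin⁻ (proj₂ (∈-filterᵇ⁻ (isRep x z) {allFin n} b∈))
          inj : ∀ {b b′} → b ∈ filterᵇ (isRep x z) (allFin n) → b′ ∈ filterᵇ (isRep x z) (allFin n) → h b ≡ h b′ →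
            b ≡ b′
          inj b∈ b′∈ e = ≡.trans (≡.sym (rep b∈)) (≡.trans (X.blkRep-≡ (Blk-image⁻ (Y.blkRep-≡⁻ e))) (rep b′∈))
          onto : ∀ {b′} → b′ ∈ filterᵇ (isRep y g) (allFin n) → ∃ λ b → b ∈ filterᵇ (isRep x z) (allFin n) × h b ≡ b′
          onto {b′} b′∈ with surj b′
          ... | i , ei = blkRep x z i , ∈-filterᵇ⁺ (isRep x z) (∈-allFin _) (eqFin⁺ (X.blkRep-idem i)) ,
                ≡.trans (≡.sym (Y.blkRep-≡ (Blk-image (X.blkRep-Blk i))))
                  (≡.trans (cong (blkRep y g) ei) (eqFin⁻ (proj₂ (∈-filterᵇ⁻ (isRep y g) {allFin n} b′∈))))

    module _ {w g : SP n} (hw : Perm w) (hg : Perm g) (cm : Comm w g) (k e : ℕ) (f : Fin n → Carrier) where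
      open Blocks hw hg cm

      private
        test : Fin n → Bool
        test b = eqPt (it w k (pos b)) (it g e (pos b))

        factors : Fin n → Carrier
        factors b = if isRep w g b then (if test b then f b else 0#) else 1#

      opaque
        -- Used with `e = 1` for roots of `g` and with `e = 0` for `w^k = 1`. If the equation fails
        -- anywhere, it fails at the representative of that block by `spread`, and this factor is 0.
        block-product : Prod.big (allFin n) factors ≈
          (if eqSP (powℕ w k) (powℕ g e) then Prod.big (allFin n) (λ b → if isRep w g b then f b else 1#) else 0#)
        block-product = go (eqSP (powℕ w k) (powℕ g e)) ≡.refl
          where
          go : ∀ t → eqSP (powℕ w k) (powℕ g e) ≡ t → Prod.big (allFin n) factors ≈
            (if t then Prod.big (allFin n) (λ b → if isRep w g b then f b else 1#) else 0#)
          go true eq = Prod.big-cong (allFin n) λ b _ → reflexive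
            (cong (λ t → if isRep w g b then (if t then f b else 0#) else 1#)
            (eqPt⁺ {p = it w k (pos b)} {q = it g e (pos b)}
              (powℕ⁻ {w = w} {v = g} {k} {e} (eqSP⁻ {v = powℕ w k} {w = powℕ g e} eq) (pos b))))
          go false eq = by-all (all (λ b → test (blkRep w g b)) (allFin n)) ≡.refl
            where
            zero-at : ∀ b → isRep w g b ≡ true → test b ≡ false → Prod.big (allFin n) factors ≈ 0#
            zero-at b rep tb = prod-zero (allFin n) (∈-allFin b)
              (reflexive (≡.trans (cong (λ r → if r then (if test b then f b else 0#) else 1#) rep)
              (cong (λ t → if t then f b else 0#) tb)))
            failing : ∀ (xs : List (Fin n)) → all (λ b → test (blkRep w g b)) xs ≡ false → ∃ λ b →
              test (blkRep w g b) ≡ false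
            failing (x ∷ xs) h with test (blkRep w g x) in eq
            ... | true = failing xs h
            ... | false = x , eq
            by-all : ∀ t → all (λ b → test (blkRep w g b)) (allFin n) ≡ t → Prod.big (allFin n) factors ≈ 0#
            by-all true h = contradiction eq (true≢false
              (eqSP⁺ {v = powℕ w k} {w = powℕ g e} (powℕ⁺ {w = w} {v = g} {k} {e} λ p → sign-free p)))
              where
              at : ∀ i → it w k (pos i) ≡ it g e (pos i)
              at i = spread {w = w} {g = g} cm {k} {e} (Blk-sym hw hg cm (blkRep-Blk i))
                (eqPt⁻ {p = it w k (pos (blkRep w g i))} {q = it g e (pos (blkRep w g i))}
                (all⁻ (λ b → test (blkRep w g b)) {allFin n} h (∈-allFin i)))
              sign-free : ∀ p → it w k p ≡ it g e p
              sign-free p = ≡.trans (cong (it w k) (pos-ix p))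
                (≡.trans (it-sg w k (proj₁ p) (pos (ix p))) (≡.trans (cong (sg (proj₁ p)) (at (ix p)))
                (≡.trans (≡.sym (it-sg g e (proj₁ p) (pos (ix p)))) (cong (it g e) (≡.sym (pos-ix p))))))
            by-all false h = let (b , tb) = failing (allFin n) h in zero-at (blkRep w g b) (eqFin⁺ (blkRep-idem b)) tb

open Conjugation

-- Class representatives and orbit counting.

module ConjugacyClasses where
  open import Function using (_∘_)
  open import Data.Bool using (Bool; true; false; if_then_else_; T?)
  open import Data.Bool.Properties using (T-≡)
  open import Data.Bool.ListAction using (any)
  open import Data.Nat using (suc; _<_; z≤n; s≤s; _≤ᵇ_)
  import Data.Nat as ℕ
  import Data.Nat.Properties as ℕP
  open import Data.Nat.DivMod using ([m+kn]%n≡m%n; m<n⇒m%n≡m)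
  open import Data.Fin using (toℕ)
  open import Data.Fin.Properties using (toℕ<n; toℕ-injective)
  open import Data.Product using (_,_; proj₁; proj₂; ∃)
  open import Data.Sum using (inj₁; inj₂)
  open import Data.Vec using (Vec; []; _∷_; toList)
  open import Data.List using (List; []; _∷_; foldr; filterᵇ; length)
  open import Data.List.Relation.Unary.Any using (here; there)
  import Data.List.Relation.Unary.Unique.Propositional.Properties as UniqueP
  open import Relation.Binary.PropositionalEquality as ≡ using (_≡_; cong; subst)
  open import Relation.Nullary using (contradiction; ¬_)
  open import Function.Bundles using (module Equivalence)
  import Relation.Binary.Reasoning.Setoid as SetoidReasoning

  encPt<2n : ∀ {n} (p : Pt n) → encPt p < 2 ℕ.* n
  encPt<2n {n} (b , i) = ℕP.<-≤-trans (bound b) (≡.subst (_≤ 2 ℕ.* n) (ℕP.*-suc 2 (toℕ i)) (ℕP.*-monoʳ-≤ 2 (toℕ<n i)))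
    where
    bound : ∀ b → 2 ℕ.* toℕ i ℕ.+ (if b then 1 else 0) < 2 ℕ.+ 2 ℕ.* toℕ i
    bound true = ℕP.≤-reflexive (cong suc (ℕP.+-comm (2 ℕ.* toℕ i) 1))
    bound false = ℕP.≤-trans (ℕP.≤-reflexive (cong suc (ℕP.+-identityʳ _))) (ℕP.n≤1+n _)

  digits-injective : ∀ N {a b x y} → a < N → b < N → a ℕ.+ N ℕ.* x ≡ b ℕ.+ N ℕ.* y → a ≡ b × x ≡ y
  digits-injective N@(suc _) {a} {b} {x} {y} a< b< e = a≡b , ℕP.*-cancelˡ-≡ x y N
    (ℕP.+-cancelˡ-≡ a _ _ (≡.trans e (cong (ℕ._+ N ℕ.* y) (≡.sym a≡b))))
    where
    residue : ∀ a x → a < N → (a ℕ.+ N ℕ.* x) ℕ.% N ≡ a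
    residue a x a< = ≡.trans (cong (λ z → (a ℕ.+ z) ℕ.% N) (ℕP.*-comm N x))
      (≡.trans ([m+kn]%n≡m%n a x N) (m<n⇒m%n≡m a<))
    a≡b : a ≡ b
    a≡b = ≡.trans (≡.sym (residue a x a<)) (≡.trans (cong (ℕ._% N) e) (residue b y b<))

  encPt-injective : ∀ {n} {p q : Pt n} → encPt p ≡ encPt q → p ≡ q
  encPt-injective {p = b , i} {q = c , k} e with digits-injective 2 (bit b) (bit c)
    (≡.trans (ℕP.+-comm _ (2 ℕ.* toℕ i)) (≡.trans e (ℕP.+-comm (2 ℕ.* toℕ k) _)))
    where
    bit : ∀ b → (if b then 1 else 0) < 2
    bit true = s≤s (s≤s z≤n)
    bit false = s≤s z≤n
  ... | eb , ei = ≡.cong₂ _,_ (bits b c eb) (toℕ-injective ei)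
    where
    bits : ∀ b c → (if b then 1 else 0) ≡ (if c then 1 else 0) → b ≡ c
    bits true true _ = ≡.refl
    bits false false _ = ≡.refl

  opaque
    code-injective : ∀ {n} {v w : SP n} → code v ≡ code w → v ≡ w
    code-injective {n} {v} {w} = go v w
      where
      go : ∀ {m} (v w : Vec (Pt n) m) → foldr (λ p acc → encPt p ℕ.+ (2 ℕ.* n) ℕ.* acc) 0 (toList v) ≡ foldr
        (λ p acc → encPt p ℕ.+ (2 ℕ.* n) ℕ.* acc) 0 (toList w) → v ≡ w
      go [] [] _ = ≡.refl
      go (p ∷ v) (q ∷ w) e = let (ep , ev) = digits-injective (2 ℕ.* n) (encPt<2n p) (encPt<2n q) e in ≡.cong₂ _∷_ (encPt-injective ep) (go v w ev)

  argmin : {A : Set} (f : A → ℕ) (xs : List A) {x : A} → x ∈ xs → ∃ λ m → m ∈ xs × (∀ {y} → y ∈ xs → f m ≤ f y)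
  argmin f (x ∷ []) _ = x , here ≡.refl , λ { (here ≡.refl) → ℕP.≤-refl }
  argmin f (x ∷ z ∷ xs) _ with argmin f (z ∷ xs) (here ≡.refl)
  ... | m , m∈ , min with ℕP.≤-total (f x) (f m)
  ... | inj₁ le = x , here ≡.refl , λ { (here ≡.refl) → ℕP.≤-refl ; (there y∈) → ℕP.≤-trans le (min y∈) }
  ... | inj₂ le = m , there m∈ , λ { (here ≡.refl) → le ; (there y∈) → min y∈ }

  module _ {n : ℕ} where

    isClassRep⁻ : ∀ {x : SP n} → isClassRep n x ≡ true → ∀ {t} → InDn t → code x ≤ code (conjBy t x)
    isClassRep⁻ {x} h {t} dt = ℕP.≤ᵇ⇒≤ _ _ (Equivalence.from T-≡
      (all⁻ (λ t → code x ≤ᵇ code (conjBy t x)) h (InDn⇒∈ dt)))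

    opaque
      conjᵇ : SP n → SP n → Bool
      conjᵇ x y = any (λ t → eqSP y (conjBy t x)) (Dn n)

      conjᵇ⁺ : ∀ {x y t} → InDn t → conjBy t x ≡ y → conjᵇ x y ≡ true
      conjᵇ⁺ {x} {y} {t} dt e = any⁺ (λ t → eqSP y (conjBy t x)) {xs = Dn n} {x = t} (InDn⇒∈ dt)
        (eqSP⁺ {v = y} {w = conjBy t x} (≡.sym e))

      conjᵇ⁻ : ∀ {x y} → conjᵇ x y ≡ true → ∃ λ t → InDn t × conjBy t x ≡ y
      conjᵇ⁻ {x} {y} h = let (t , t∈ , e) = any⁻ (λ t → eqSP y (conjBy t x)) (Dn n) h in t , ∈⇒InDn t∈ , ≡.sym (eqSP⁻ {v = y} {w = conjBy t x} e)

    opaque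
      rep-exists : ∀ {y} → InDn y → ∃ λ x → x ∈ classReps n × conjᵇ x y ≡ true
      rep-exists {y} dy with argmin (λ t → code (conjBy t y)) (Dn n) (InDn⇒∈ InDn-id)
      ... | t , t∈ , min = x , ∈-filterᵇ⁺ (isClassRep n) (InDn⇒∈ (InDn-conj dt dy))
        (all⁺ (λ s → code x ≤ᵇ code (conjBy s x)) (Dn n) minimal) ,
          conjᵇ⁺ (InDn-inv dt) (conj-inv (InDn.perm dt) ≡.refl)
        where
        dt : InDn t
        dt = ∈⇒InDn t∈
        x : SP n
        x = conjBy t y
        minimal : ∀ s → s ∈ Dn n → (code x ≤ᵇ code (conjBy s x)) ≡ true
        minimal s s∈ = Equivalence.to T-≡ (ℕP.≤⇒≤ᵇ
          (subst (code x ≤_) (cong code (≡.sym (conj-comp (InDn.perm (∈⇒InDn s∈)) (InDn.perm dt) y)))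
          (min (InDn⇒∈ (InDn-comp (∈⇒InDn s∈) dt)))))

      rep-unique : ∀ {x x′ y} → x ∈ classReps n → x′ ∈ classReps n → conjᵇ x y ≡ true → conjᵇ x′ y ≡ true → x ≡ x′
      rep-unique {x} {x′} {y} x∈ x′∈ c c′ with conjᵇ⁻ {x} {y} c | conjᵇ⁻ {x′} {y} c′
      ... | t , dt , e | t′ , dt′ , e′ = code-injective {v = x} {w = x′}
        (ℕP.≤-antisym (below x x′ t t′ x∈ dt dt′ e e′) (below x′ x t′ t x′∈ dt′ dt e′ e))
        where
        below : ∀ x x′ t t′ → x ∈ classReps n → InDn t → InDn t′ → conjBy t x ≡ y → conjBy t′ x′ ≡ y →
          code x ≤ code x′
        below x x′ t t′ x∈ dt dt′ e e′ = subst (λ z → code x ≤ code z) moved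
          (isClassRep⁻ {x} (proj₂ (∈-filterᵇ⁻ (isClassRep n) {Dn n} {x} x∈)) {comp (inv t′) t}
            (InDn-comp {w = inv t′} {v = t} (InDn-inv {w = t′} dt′) dt))
          where
          moved : conjBy (comp (inv t′) t) x ≡ x′
          moved = ≡.trans (≡.sym (conj-comp {s = inv t′} {t = t} (InDn.perm (InDn-inv {w = t′} dt′)) (InDn.perm dt)
            x))
            (≡.trans (cong (conjBy (inv t′)) e) (conj-inv {t = t′} (InDn.perm dt′) {x = x′} {y = y} e′))

    ∈-centD⁺ : ∀ {x z : SP n} → InDn z → Comm z x → z ∈ centD n x
    ∈-centD⁺ {x} {z} dz c = ∈-filterᵇ⁺ (commᵇ x) (InDn⇒∈ dz) (commᵇ⁺ {g = x} {w = z} c)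

    ∈-centD⁻ : ∀ {x z : SP n} → z ∈ centD n x → InDn z × Comm z x
    ∈-centD⁻ {x} {z} z∈ = let (d , c) = ∈-filterᵇ⁻ (commᵇ x) {Dn n} z∈ in ∈⇒InDn d , commᵇ⁻ {g = x} {w = z} c

  module OrbitSums {c ℓ} (F : Field' c ℓ) (char0 : FieldOps.CharZero F) (n : ℕ) where
    open FieldLemmas F
    open Averaging F char0 {n}
    open SetoidReasoning setoid

    module _ (H : SP n → Carrier) where

      private
        |Z| : SP n → Carrier
        |Z| x = fromℕ (length (centD n x))

        |Z|≉0 : ∀ x → ¬ (|Z| x ≈ 0#)
        |Z|≉0 x = fromℕ≉0 (nonempty (∈-centD⁺ {x = x} InDn-id λ p → ≡.trans (act-id _)
          (cong (act x) (≡.sym (act-id p)))))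
          where
          nonempty : ∀ {xs : List (SP n)} {z} → z ∈ xs → 0 < length xs
          nonempty (here _) = s≤s z≤n
          nonempty (there _) = s≤s z≤n

        -- The `t` conjugating `x` into `y` are either none at all or a coset `t₀ Z(x)`, with as
        -- many elements as the centralizer.
        transporter : ∀ {x} → InDn x → ∀ y → Sum.big (Dn n) (λ t → if eqSP y (conjBy t x) then H (conjBy t x) else 0#)
          ≈ |Z| x * (if conjᵇ x y then H y else 0#)
        transporter {x} dx y = trans (sym (Sum.big-filter (λ t → eqSP y (conjBy t x)) (Dn n) (λ t → H (conjBy t x))))
          (go (conjᵇ x y) ≡.refl)
          where
          ts : List (SP n)
          ts = filterᵇ (λ t → eqSP y (conjBy t x)) (Dn n)
          at : ∀ {t} → t ∈ ts → InDn t × conjBy t x ≡ y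
          at {t} t∈ = let (d , e) = ∈-filterᵇ⁻ (λ t → eqSP y (conjBy t x)) {Dn n} t∈ in ∈⇒InDn d , ≡.sym (eqSP⁻ {v = y} {w = conjBy t x} e)
          into : ∀ {t} → InDn t → conjBy t x ≡ y → t ∈ ts
          into {t} dt e = ∈-filterᵇ⁺ (λ t → eqSP y (conjBy t x)) (InDn⇒∈ dt)
            (eqSP⁺ {v = y} {w = conjBy t x} (≡.sym e))
          go : ∀ b → conjᵇ x y ≡ b → Sum.big ts (λ t → H (conjBy t x)) ≈ |Z| x * (if b then H y else 0#)
          go false nc = trans (Sum.big-ε ts λ t t∈ → contradiction nc (true≢false (let (dt , e) = at t∈ in conjᵇ⁺ {x = x} {y = y} dt e))) (sym (zeroʳ _))
          go true cj with conjᵇ⁻ {x = x} {y = y} cj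
          ... | t₀ , d₀ , e₀ = begin
            Sum.big ts (λ t → H (conjBy t x))           ≈⟨ Sum.big-cong ts
              (λ t t∈ → reflexive (cong H (proj₂ (at t∈)))) ⟩
            Sum.big ts (λ _ → H y)                      ≈⟨ Sum.big-reindex {xs = centD n x} {ys = ts} (comp t₀)
              (λ _ → H y) (UniqueP.filter⁺ (T? ∘ commᵇ x) {xs = Dn n} Dn-unique)
                                                             (UniqueP.filter⁺ (T? ∘ λ t → eqSP y (conjBy t x))
                                                               {xs = Dn n} Dn-unique) forward (λ _ _ → cancel)
                                                               backward ⟩
            Sum.big (centD n x) (λ _ → H y)             ≈⟨ sum-const (centD n x) (H y) ⟩
            |Z| x * H y                                 ∎
            where
            p₀ : Perm t₀
            p₀ = InDn.perm d₀
            central : ∀ {z} → Comm z x → Perm z → conjBy z x ≡ x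
            central {z} c pz = SP-ext λ p → ≡.trans (act-conj z x p) (≡.trans (c _) (cong (act x) (inv-spec pz p)))
            forward : ∀ {z} → z ∈ centD n x → comp t₀ z ∈ ts
            forward {z} z∈ = let (dz , c) = ∈-centD⁻ {x = x} z∈ in into (InDn-comp d₀ dz)
              (≡.trans (≡.sym (conj-comp p₀ (InDn.perm dz) x))
                (≡.trans (cong (conjBy t₀) (central c (InDn.perm dz))) e₀))
            cancel : ∀ {z z′} → comp t₀ z ≡ comp t₀ z′ → z ≡ z′
            cancel {z} {z′} e = SP-ext λ p → p₀ (≡.trans (≡.sym (act-comp t₀ z p))
              (≡.trans (cong (λ v → act v p) e) (act-comp t₀ z′ p)))
            backward : ∀ {t} → t ∈ ts → ∃ λ z → z ∈ centD n x × comp t₀ z ≡ t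
            backward {t} t∈ = z , ∈-centD⁺ {x = x} dz commutes , SP-ext λ p →
              ≡.trans (act-comp t₀ z p) (≡.trans (cong (act t₀) (act-comp (inv t₀) t p)) (inv-spec p₀ _))
              where
              dt : InDn t
              dt = proj₁ (at t∈)
              z : SP n
              z = comp (inv t₀) t
              dz : InDn z
              dz = InDn-comp (InDn-inv d₀) dt
              fixes : conjBy z x ≡ x
              fixes = ≡.trans (≡.sym (conj-comp (InDn.perm (InDn-inv d₀)) (InDn.perm dt) x))
                (≡.trans (cong (conjBy (inv t₀)) (proj₂ (at t∈))) (conj-inv p₀ e₀))
              commutes : Comm z x
              commutes p = ≡.trans (≡.sym (it-conj (InDn.perm dz) x 1 p)) (cong (λ v → act v (act z p)) fixes)

        class-sum : ∀ {x} → InDn x → (|Z| x) ⁻¹ * Sum.big (Dn n) (λ t → H (conjBy t x)) ≈ Sum.big (Dn n)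
          (λ y → if conjᵇ x y then H y else 0#)
        class-sum {x} dx = begin
          (|Z| x) ⁻¹ * Sum.big (Dn n) (λ t → H (conjBy t x))
            ≈⟨ *-congˡ (Sum.big-fibre {xs = Dn n} {ys = Dn n} (λ y t → eqSP y (conjBy t x)) (λ t → conjBy t x)
              (λ t → H (conjBy t x)) Dn-unique
                 (λ t∈ → InDn⇒∈ (InDn-conj (∈⇒InDn t∈) dx)) (λ {t} _ → eqSP⁺ {v = conjBy t x} {w = conjBy t x} ≡.refl)
                   (λ {t} {y} _ _ → eqSP⁻ {v = y} {w = conjBy t x})) ⟩
          (|Z| x) ⁻¹ * Sum.big (Dn n) (λ y → Sum.big (Dn n)
            (λ t → if eqSP y (conjBy t x) then H (conjBy t x) else 0#))
            ≈⟨ *-congˡ (trans (Sum.big-cong (Dn n) (λ y _ → transporter dx y)) (sym (*-sumˡ (Dn n) (|Z| x) _))) ⟩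
          (|Z| x) ⁻¹ * (|Z| x * S)
            ≈⟨ *-assoc _ _ _ ⟨
          (|Z| x) ⁻¹ * |Z| x * S
            ≈⟨ *-congʳ (trans (*-comm _ _) (⁻¹-inverse _ (|Z|≉0 x))) ⟩
          1# * S
            ≈⟨ *-identityˡ S ⟩
          S ∎
          where
          S : Carrier
          S = Sum.big (Dn n) (λ y → if conjᵇ x y then H y else 0#)

      opaque
        -- The centralizer order in front of an induced character cancels the number of ways in
        -- which each `y` is reached from its representative, and each `y` has exactly one
        -- representative.
        sum-over-classes : Sum.big (classReps n) (λ x → (fromℕ (length (centD n x))) ⁻¹ * Sum.big (Dn n)
          (λ t → H (conjBy t x))) ≈ Sum.big (Dn n) H
        sum-over-classes = begin
          Sum.big (classReps n) (λ x → (|Z| x) ⁻¹ * Sum.big (Dn n) (λ t → H (conjBy t x)))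
            ≈⟨ Sum.big-cong (classReps n) (λ x x∈ → class-sum (∈⇒InDn (proj₁ (∈-filterᵇ⁻ (isClassRep n) {Dn n} x∈))))
              ⟩
          Sum.big (classReps n) (λ x → Sum.big (Dn n) (λ y → if conjᵇ x y then H y else 0#))
            ≈⟨ Sum.big-swap (classReps n) (Dn n) _ ⟩
          Sum.big (Dn n) (λ y → Sum.big (classReps n) (λ x → if conjᵇ x y then H y else 0#))
            ≈⟨ Sum.big-cong (Dn n) (λ y y∈ → let (x , x∈ , cx) = rep-exists (∈⇒InDn y∈) in
                 Sum.big-select {xs = classReps n} {a = x} (λ x → conjᵇ x y) (λ _ → H y)
                   (UniqueP.filter⁺ (T? ∘ isClassRep n) {xs = Dn n} Dn-unique) x∈ cx
                   (λ x′∈ cx′ → rep-unique {y = y} x′∈ x∈ cx′ cx)) ⟩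
          Sum.big (Dn n) H ∎

open ConjugacyClasses

-- From the centralizer in B_n to the theorem for D_n.

module Conclusion where
  open import Data.Bool using (Bool; true; false; not; _∧_; _xor_; if_then_else_)
  open import Data.Bool.Properties using (∧-identityʳ; xor-identityʳ)
  open import Data.Nat using (zero; suc; _≡ᵇ_; _%_)
  import Data.Nat as ℕ
  open import Data.Integer using (+_; -[1+_]; ∣_∣)
  open import Data.Fin using (Fin)
  open import Data.Product using (_,_; proj₁; proj₂)
  open import Data.Sum using (inj₁; inj₂)
  import Data.Sum as Sum⊎
  open import Data.List using (allFin; filterᵇ; length)
  open import Data.List.Properties using (length-tabulate)
  open import Relation.Binary.PropositionalEquality as ≡ using (_≡_; cong; subst)
  open import Relation.Nullary using (contradiction)
  import Relation.Binary.Reasoning.Setoid as SetoidReasoning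

  module _ {n : ℕ} where

    opaque
      it-inv : ∀ {w : SP n} → Perm w → ∀ k p → it (inv w) k (it w k p) ≡ p
      it-inv hw zero p = ≡.refl
      it-inv {w} hw (suc k) p = ≡.trans (it-sucʳ (inv w) k (act w (it w k p)))
        (≡.trans (cong (it (inv w) k) (inv-specˡ hw (it w k p))) (it-inv hw k p))

    powTrivial : ℕ → SP n → Bool
    powTrivial k w = eqSP (powℕ w k) idSP

    opaque
      powTrivial⁻ : ∀ {k w} → powTrivial k w ≡ true → ∀ p → it w k p ≡ p
      powTrivial⁻ {k} {w} h p = powℕ⁻ {w = w} {v = w} {k} {0} (eqSP⁻ {v = powℕ w k} {w = idSP} h) p

      powTrivial⁺ : ∀ {k w} → (∀ p → it w k p ≡ p) → powTrivial k w ≡ true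
      powTrivial⁺ {k} {w} h = eqSP⁺ {v = powℕ w k} {w = idSP} (powℕ⁺ {w = w} {v = w} {k} {0} h)

      powTrivial-inv : ∀ {w : SP n} → Perm w → ∀ k → powTrivial k (inv w) ≡ powTrivial k w
      powTrivial-inv {w} hw k = bool-ext
        (λ h → powTrivial⁺ {k} {w} λ p → ≡.trans (≡.sym (powTrivial⁻ {k} {inv w} h (it w k p))) (it-inv hw k p))
        (λ h → powTrivial⁺ {k} {inv w} λ p → ≡.trans (cong (it (inv w) k) (≡.sym (powTrivial⁻ {k} {w} h p)))
          (it-inv hw k p))

      powTrivial-ℤ : ∀ {w : SP n} → Perm w → ∀ k → eqSP (powℤ w k) idSP ≡ powTrivial ∣ k ∣ w
      powTrivial-ℤ hw (+ m) = ≡.refl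
      powTrivial-ℤ hw -[1+ m ] = powTrivial-inv hw (suc m)

      powTrivial-conj : ∀ {t x : SP n} → Perm t → ∀ k → powTrivial k (conjBy t x) ≡ powTrivial k x
      powTrivial-conj {t} {x} ht k = bool-ext
        (λ h → powTrivial⁺ {k} {x} λ p → ht (≡.trans (≡.sym (it-conj ht x k p))
          (powTrivial⁻ {k} {conjBy t x} h (act t p))))
        (λ h → powTrivial⁺ {k} {conjBy t x} λ p → ≡.trans (cong (it (conjBy t x) k) (≡.sym (inv-spec ht p)))
          (≡.trans (it-conj ht x k _) (≡.trans (cong (act t) (powTrivial⁻ {k} {x} h _)) (inv-spec ht p))))

      classPowTrivial-≡ : ∀ {x : SP n} → InDn x → ∀ k → classPowTrivial n k x ≡ powTrivial ∣ k ∣ x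
      classPowTrivial-≡ {x} dx k = bool-ext
        (λ h → ≡.trans (≡.sym (at InDn-id)) (all⁻ (λ t → eqSP (powℤ (conjBy t x) k) idSP) {Dn n} h (InDn⇒∈ InDn-id)))
        (λ h → all⁺ (λ t → eqSP (powℤ (conjBy t x) k) idSP) (Dn n) λ t t∈ → ≡.trans (at (∈⇒InDn t∈)) h)
        where
        at : ∀ {t} → InDn t → eqSP (powℤ (conjBy t x) k) idSP ≡ powTrivial ∣ k ∣ x
        at {t} dt = ≡.trans (powTrivial-ℤ (Perm-conj (InDn.perm dt) (InDn.perm dx)) k)
          (powTrivial-conj {t} {x} (InDn.perm dt) ∣ k ∣)

      -- Turns the condition in the induced character, on conjugates of `g`, into one on the
      -- conjugate `y = t x t⁻¹`, so that the sum can be taken over `y` with `g` fixed.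
      memb-centD : ∀ {t x g : SP n} → InDn t → InDn g → memb (comp (inv t) (comp g t)) (centD n x) ≡ commᵇ g
        (conjBy t x)
      memb-centD {t} {x} {g} dt dg = bool-ext
        (λ h → let (z′ , z∈ , e) = any⁻ (eqSP z) (centD n x) h in commᵇ⁺ {g = g} {w = conjBy t x} (Comm-conj⁻ {t = t} {x} {g} (InDn.perm dt)
          (subst (λ u → Comm u x) (≡.sym (eqSP⁻ {v = z} {w = z′} e)) (proj₂ (∈-centD⁻ {x = x} z∈)))))
        (λ h → any⁺ (eqSP z) {xs = centD n x} {x = z} (∈-centD⁺ {x = x} (InDn-comp (InDn-inv dt) (InDn-comp dg dt))
          (Comm-conj⁺ {t = t} {x} {g} (InDn.perm dt) (commᵇ⁻ {g = g} {w = conjBy t x} h)))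
            (eqSP⁺ {v = z} {w = z} ≡.refl))
        where
        z : SP n
        z = comp (inv t) (comp g t)

      root-comm : ∀ {g w : SP n} k → powℕ w k ≡ g → Comm w g
      root-comm {g} {w} k ≡.refl p = ≡.trans (cong (act w) (powℕ-act w k p))
        (≡.trans (≡.sym (it-app (Comm-self w) k p)) (≡.sym (powℕ-act w k (act w p))))

      it-neg : ∀ {w : SP n} k p → it (comp w negSP) k p ≡ sg (par k) (it w k p)
      it-neg zero p = ≡.refl
      it-neg {w} (suc k) p = ≡.trans (act-comp w negSP _)
        (≡.trans (cong (act w) (≡.trans (act-neg _) (≡.trans (cong (sg true) (it-neg k p))
        (sg-sg true (par k) (it w k p))))) (act-sg w (not (par k)) (it w k p)))

      sgn-neg : sgn (negSP {n}) ≡ par n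
      sgn-neg = ≡.trans (sgn-def negSP) (≡.trans (Xor.big-cong (allFin n) (λ i _ → cong proj₁ (act-neg (pos i))))
        (≡.trans (xor-const (allFin n) true) (≡.trans (∧-identityʳ (par (length (allFin n))))
        (cong par (length-tabulate {n = n} (λ (i : Fin n) → i))))))

  odd⇒par : ∀ {a} → a % 2 ≡ 1 → par a ≡ true
  odd⇒par {a} e = ≡.trans (par-%2 a) (cong (_≡ᵇ 1) e)

  module Final {c ℓ} (F : Field' c ℓ) (char0 : FieldOps.CharZero F) (n : ℕ) (α β : ℕ → Field'.Carrier F)
    (prim : ∀ i → 1 ≤ i → i ≤ n → FieldOps.PrimRoot F i (α i) × FieldOps.PrimRoot F (2 ℕ.* i) (β i))
    {g : SP n} (dg : InDn g) (k : ℤ) where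
    open FieldLemmas F
    open SetoidReasoning setoid
    open Zeta F n α β prim
    open OmegaProduct F n α β prim
    open OmegaFacts F n α β prim
    open Averaging F char0 {n}
    open Chars F α β using (omega; psi; rhs)

    private
      κ : ℕ
      κ = ∣ k ∣

      hg : Perm g
      hg = InDn.perm dg

      module CS = CentralizerSums F char0 n α β prim hg κ
      module LS = LocalSums F n α β prim hg κ

      if-cong : ∀ b {x y z : Carrier} → (b ≡ true → x ≈ y) → (if b then x else z) ≈ (if b then y else z)
      if-cong true h = h ≡.refl
      if-cong false h = refl

    isRoot : SP n → Bool
    isRoot w = eqSP (powℕ w κ) g

    A B : SP n → Carrier
    A w = if isRoot w then 1# else 0#
    B w = if powTrivial κ w then Omega w g else 0#

    private
      productL : ∀ {w} → Adm g w → Prod.big (allFin n) (λ b → atRep hg LS.L b w) ≈ A w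
      productL {w} (adm p cm) = trans (block-product p hg cm κ 1 (λ _ → 1#))
        (trans (if-cong (eqSP (powℕ w κ) (powℕ g 1)) (λ _ → Prod.big-ε (allFin n) (λ b _ → same (isRep w g b))))
        (reflexive (cong (λ v → if eqSP (powℕ w κ) v then 1# else 0#) (powℕ-one g))))
        where
        same : ∀ b → (if b then 1# else 1#) ≈ 1#
        same true = refl
        same false = refl

      productR : ∀ {w} → Adm g w → Prod.big (allFin n) (λ b → atRep hg LS.R b w) ≈ B w
      productR {w} (adm p cm) = block-product p hg cm κ 0 (rho w g)

      sum-A≈sum-B : Sum.big (centralizer g) A ≈ Sum.big (centralizer g) B
      sum-A≈sum-B = trans (Sum.big-cong (centralizer g) (λ w w∈ → sym (productL (∈-centralizer⁻ w∈))))
        (trans CS.sum-roots≈sum-trivial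
        (Sum.big-cong (centralizer g) (λ w w∈ → productR (∈-centralizer⁻ w∈))))

      isRoot⇒ : ∀ {w} → isRoot w ≡ true → powℕ w κ ≡ g
      isRoot⇒ {w} = eqSP⁻ {v = powℕ w κ} {w = g}

      even-part : (SP n → Carrier) → SP n → Carrier
      even-part f w = if not (sgn w) then f w else 0#

      -- The restriction to D_n becomes a weight on the centralizer in B_n, because the averaging
      -- moves may leave D_n.
      Dn-sum : ∀ f → Sum.big (Dn n) (λ w → if commᵇ g w then f w else 0#) ≈ Sum.big (centralizer g) (even-part f)
      Dn-sum f = begin
        Sum.big (Dn n) (λ w → if commᵇ g w then f w else 0#)
          ≈⟨ Sum.big-filter (λ w → negCount w % 2 ≡ᵇ 0) (Bn n) _ ⟩
        Sum.big (Bn n) (λ w → if negCount w % 2 ≡ᵇ 0 then (if commᵇ g w then f w else 0#) else 0#)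
          ≈⟨ Sum.big-cong (Bn n) (λ w _ → trans (reflexive
            (cong (λ b → if b then (if commᵇ g w then f w else 0#) else 0#) (negCount-sgn w)))
            (swap-if (not (sgn w)) (commᵇ g w))) ⟩
        Sum.big (Bn n) (λ w → if commᵇ g w then even-part f w else 0#)
          ≈⟨ Sum.big-filter (commᵇ g) (Bn n) (even-part f) ⟨
        Sum.big (filterᵇ (commᵇ g) (Bn n)) (even-part f)
          ≡⟨ cong (λ l → Sum.big l (even-part f)) (≡.sym (centralizer-def g)) ⟩
        Sum.big (centralizer g) (even-part f) ∎
        where
        swap-if : ∀ a b {x : Carrier} → (if a then (if b then x else 0#) else 0#) ≈
          (if b then (if a then x else 0#) else 0#)
        swap-if true true = refl
        swap-if true false = refl
        swap-if false true = refl
        swap-if false false = refl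

      module Odd (odd : par κ ≡ true) where

        -- For odd `k` an element has the same sign as its `k`-th power. As `g` and the identity are
        -- even, both sums are supported in D_n.
        sgn-pow : ∀ {w : SP n} → Perm w → sgn (powℕ w κ) ≡ sgn w
        sgn-pow {w} p = ≡.trans (sgn-powℕ p κ) (cong (_∧ sgn w) odd)

        drop : ∀ (f : SP n → Carrier) (t : SP n → Bool) (v : SP n → Carrier) →
          (∀ w → f w ≡ (if t w then v w else 0#)) →
          (∀ {w} → Perm w → t w ≡ true → sgn w ≡ false) → Sum.big (centralizer g) (even-part f) ≈ Sum.big
            (centralizer g) f
        drop f t v ft supp = Sum.big-cong (centralizer g) λ w w∈ →
          go w (sgn w) ≡.refl (t w) ≡.refl (Adm.perm (∈-centralizer⁻ w∈))
          where
          go : ∀ w s → sgn w ≡ s → ∀ b → t w ≡ b → Perm w → even-part f w ≈ f w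
          go w false es b eb p = reflexive (cong (λ s → if not s then f w else 0#) es)
          go w true es true eb p = contradiction (supp p eb) (true≢false es)
          go w true es false eb p = trans (reflexive (cong (λ s → if not s then f w else 0#) es))
            (sym (reflexive (≡.trans (ft w) (cong (λ b → if b then v w else 0#) eb))))

        equal : Sum.big (centralizer g) (even-part A) ≈ Sum.big (centralizer g) (even-part B)
        equal = trans (drop A isRoot (λ _ → 1#) (λ _ → ≡.refl)
          (λ {w} p e → ≡.trans (≡.sym (sgn-pow p)) (≡.trans (cong sgn (isRoot⇒ {w} e)) (InDn.even dg))))
          (trans sum-A≈sum-B (sym (drop B (powTrivial κ) (λ w → Omega w g) (λ _ → ≡.refl)
            (λ {w} p e → ≡.trans (≡.sym (sgn-pow p)) (≡.trans (cong sgn (eqSP⁻ {v = powℕ w κ} {w = idSP} e))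
            (sgn-id {n = n}))))))

      -- Half of `1 + sign` is the indicator of D_n; the 2 stays on the left and is cancelled later
      -- by characteristic zero.
      double-even : ∀ f → fromℕ 2 * Sum.big (centralizer g) (even-part f) ≈ Sum.big (centralizer g) f + Sum.big
        (centralizer g) (λ w → sign (sgn w) * f w)
      double-even f = trans (*-sumˡ (centralizer g) (fromℕ 2) _)
        (trans (Sum.big-cong (centralizer g) (λ w _ → go (sgn w) (f w)))
        (Sum.big-∙ (centralizer g) f (λ w → sign (sgn w) * f w)))
        where
        go : ∀ s x → fromℕ 2 * (if not s then x else 0#) ≈ x + sign s * x
        go true x = trans (zeroʳ _) (sym (trans (+-congˡ (-1*x≈-x x)) (-‿inverseʳ x)))
        go false x = trans (distribʳ x _ _) (+-cong (*-identityˡ x) (*-congʳ (+-identityʳ 1#)))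

      module Even (even : par κ ≡ false) (n-odd : par n ≡ true) where

        -- Multiplication by -1 keeps `k`-th powers, as `k` is even, and reverses the sign, as `n`
        -- is odd. So the sum equals its negative, and 2 can be cancelled.
        signed-A : Sum.big (centralizer g) (λ w → sign (sgn w) * A w) ≈ 0#
        signed-A = *-cancelˡ (char0 1) (begin
          fromℕ 2 * S       ≈⟨ distribʳ S _ _ ⟩
          1# * S + fromℕ 1 * S ≈⟨ +-cong (*-identityˡ S) (trans (*-congʳ (+-identityʳ 1#)) (*-identityˡ S)) ⟩
          S + S             ≈⟨ +-congˡ negated ⟩
          S + - S           ≈⟨ -‿inverseʳ S ⟩
          0#                ≈⟨ zeroʳ _ ⟨
          fromℕ 2 * 0#      ∎)
          where
          S : Carrier
          S = Sum.big (centralizer g) (λ w → sign (sgn w) * A w)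
          flip : ∀ w → sign (sgn (comp w negSP)) * A (comp w negSP) ≈ - 1# * (sign (sgn w) * A w)
          flip w = trans (*-cong (trans (reflexive
            (cong sign (≡.trans (sgn-comp w (CutBy.u-perm (cutBy-neg {g = g})))
            (cong (sgn w xor_) (≡.trans sgn-neg n-odd))))) (trans (sign-xor (sgn w) true) (*-comm _ _)))
            (reflexive (cong (λ v → if eqSP v g then 1# else 0#)
              (powℕ⁺ {w = comp w negSP} {v = w} {κ} {κ} λ p → ≡.trans (it-neg κ p)
              (cong (λ b → sg b (it w κ p)) even))))) (*-assoc _ _ _)
          negated : S ≈ - S
          negated = trans (sum-translate hg (adm (CutBy.u-perm (cutBy-neg {g = g}))
            (Comm-sym {w = g} {v = negSP} (CutBy.u-comm (cutBy-neg {g = g}) (Comm-self g)))) _)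
            (trans (Sum.big-cong (centralizer g) (λ w _ → flip w))
              (trans (sym (*-sumˡ (centralizer g) (- 1#) _)) (-1*x≈-x S)))

        signed-B : Sum.big (centralizer g) (λ w → sign (sgn w) * B w) ≈ 0#
        signed-B = trans (Sum.big-cong (centralizer g) (λ w w∈ → *-congˡ (sym (productR (∈-centralizer⁻ w∈)))))
          (CS.signed-sum-zero even (≡.trans (cong (par n xor_) (InDn.even dg))
            (≡.trans (xor-identityʳ (par n)) n-odd)))

        equal : Sum.big (centralizer g) (even-part A) ≈ Sum.big (centralizer g) (even-part B)
        equal = *-cancelˡ (char0 1) (trans (double-even A)
          (trans (+-cong sum-A≈sum-B (trans signed-A (sym signed-B))) (sym (double-even B))))

      even-sums : par n ≡ true ⊎ par κ ≡ true → Sum.big (centralizer g) (even-part A) ≈ Sum.big (centralizer g)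
        (even-part B)
      even-sums h = go (par κ) ≡.refl h
        where
        go : ∀ b → par κ ≡ b → par n ≡ true ⊎ par κ ≡ true →
          Sum.big (centralizer g) (even-part A) ≈ Sum.big (centralizer g) (even-part B)
        go true odd _ = Odd.equal odd
        go false even (inj₁ n-odd) = Even.equal even n-odd
        go false even (inj₂ odd) = contradiction even (true≢false odd)

    H : SP n → Carrier
    H y = if powTrivial κ y then (if commᵇ g y then Omega y g else 0#) else 0#

    opaque
      roots≈characters : par n ≡ true ⊎ par κ ≡ true → Sum.big (Dn n) A ≈ Sum.big (Dn n) H
      roots≈characters h = begin
        Sum.big (Dn n) A
          ≈⟨ Sum.big-cong (Dn n) (λ w _ → root-part w (isRoot w) ≡.refl (commᵇ g w) ≡.refl) ⟩
        Sum.big (Dn n) (λ w → if commᵇ g w then A w else 0#)    ≈⟨ Dn-sum A ⟩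
        Sum.big (centralizer g) (even-part A)                   ≈⟨ even-sums h ⟩
        Sum.big (centralizer g) (even-part B)                   ≈⟨ Dn-sum B ⟨
        Sum.big (Dn n) (λ w → if commᵇ g w then B w else 0#)
          ≈⟨ Sum.big-cong (Dn n) (λ w _ → swap (powTrivial κ w) (commᵇ g w)) ⟩
        Sum.big (Dn n) H                                        ∎
        where
        -- A root of `g` commutes with `g`, so passing to the centralizer loses no roots.
        root-part : ∀ w r → isRoot w ≡ r → ∀ b → commᵇ g w ≡ b → A w ≈ (if commᵇ g w then A w else 0#)
        root-part w r er true eb = reflexive (≡.sym (cong (λ b → if b then A w else 0#) eb))
        root-part w true er false eb = contradiction eb
          (true≢false (commᵇ⁺ {g = g} {w = w} (root-comm κ (isRoot⇒ {w} er))))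
        root-part w false er false eb = trans (reflexive (cong (λ b → if b then 1# else 0#) er))
          (reflexive (≡.sym (cong (λ b → if b then A w else 0#) eb)))
        swap : ∀ a b {x : Carrier} → (if b then (if a then x else 0#) else 0#) ≈
          (if a then (if b then x else 0#) else 0#)
        swap true true = refl
        swap true false = refl
        swap false true = refl
        swap false false = refl

      -- The condition on `k`-th powers is invariant under conjugation, so it can be moved from the
      -- class inside the sum over conjugates; there ω of `x` at `t⁻¹ g t` equals ω of `t x t⁻¹` at
      -- `g`.
      rhs≈sum : rhs n k g ≈ Sum.big (Dn n) H
      rhs≈sum = begin
        Sum.big (filterᵇ (classPowTrivial n k) (classReps n)) (λ x → psi n x g)
          ≈⟨ Sum.big-filter (classPowTrivial n k) (classReps n) (λ x → psi n x g) ⟩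
        Sum.big (classReps n) (λ x → if classPowTrivial n k x then psi n x g else 0#)
          ≈⟨ Sum.big-cong (classReps n) (λ x x∈ → term (∈⇒InDn (proj₁ (∈-filterᵇ⁻ (isClassRep n) {Dn n} x∈)))) ⟩
        Sum.big (classReps n) (λ x → (fromℕ (length (centD n x))) ⁻¹ * Sum.big (Dn n) (λ t → H (conjBy t x)))
          ≈⟨ OrbitSums.sum-over-classes F char0 n H ⟩
        Sum.big (Dn n) H ∎
        where
        C : SP n → SP n → Carrier
        C t x = if commᵇ g (conjBy t x) then Omega (conjBy t x) g else 0#
        summand : ∀ {t x} → InDn t → InDn x → (let y = comp (inv t) (comp g t) in if memb y (centD n x) then omega x y else 0#) ≈ C t x
        summand {t} {x} dt dx = trans (reflexive
          (cong (λ b → if b then omega x z else 0#) (memb-centD {t = t} {x} {g} dt dg)))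
          (if-cong (commᵇ g (conjBy t x)) λ c → trans (omega≈Omega hx hz (Comm-sym {w = z} {v = x} (cz c)))
            (Omega-Iso hx hz (Perm-conj ht hx) hg (Comm-sym {w = z} {v = x} (cz c))
              (commᵇ⁻ {g = g} {w = conjBy t x} c) (conj-Iso ht) (conj-Iso-surj {x = x} {g} ht)))
          where
          z : SP n
          z = comp (inv t) (comp g t)
          ht : Perm t
          ht = InDn.perm dt
          hx : Perm x
          hx = InDn.perm dx
          hz : Perm z
          hz = InDn.perm (InDn-comp (InDn-inv dt) (InDn-comp dg dt))
          cz : commᵇ g (conjBy t x) ≡ true → Comm z x
          cz c = Comm-conj⁺ {t = t} {x} {g} ht (commᵇ⁻ {g = g} {w = conjBy t x} c)
        H-conj : ∀ {t x} → InDn t → InDn x → H (conjBy t x) ≡ (if classPowTrivial n k x then C t x else 0#)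
        H-conj {t} {x} dt dx = cong (λ b → if b then C t x else 0#)
          (≡.trans (powTrivial-conj {t = t} {x} (InDn.perm dt) κ)
          (≡.sym (classPowTrivial-≡ dx k)))
        term : ∀ {x} → InDn x → (if classPowTrivial n k x then psi n x g else 0#) ≈ (fromℕ (length (centD n x))) ⁻¹ *
          Sum.big (Dn n) (λ t → H (conjBy t x))
        term {x} dx = trans (go (classPowTrivial n k x))
          (*-congˡ (Sum.big-cong (Dn n) λ t t∈ → reflexive (≡.sym (H-conj (∈⇒InDn t∈) dx))))
          where
          go : ∀ b → (if b then psi n x g else 0#) ≈ (fromℕ (length (centD n x))) ⁻¹ * Sum.big (Dn n)
            (λ t → if b then C t x else 0#)
          go true = *-congˡ (Sum.big-cong (Dn n) λ t t∈ → summand (∈⇒InDn t∈) dx)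
          go false = sym (trans (*-congˡ (Sum.big-ε (Dn n) (λ _ _ → refl))) (zeroʳ _))

      roots≈sum : fromℕ (rootsD n k g) ≈ Sum.big (Dn n) A
      roots≈sum = trans (trans (fromℕ-length (filterᵇ (λ h → eqSP (powℤ h k) g) (Dn n)))
        (Sum.big-filter (λ h → eqSP (powℤ h k) g) (Dn n) (λ _ → 1#))) (go k)
        where
        go : ∀ k → Sum.big (Dn n) (λ h → if eqSP (powℤ h k) g then 1# else 0#) ≈ Sum.big (Dn n)
          (λ h → if eqSP (powℕ h ∣ k ∣) g then 1# else 0#)
        go (+ m) = refl
        -- For negative `k` the roots are the inverses of the roots for the absolute value of `k`,
        -- and inversion permutes D_n.
        go -[1+ m ] = sym (Sum.big-reindex {xs = Dn n} {ys = Dn n} inv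
          (λ h → if eqSP (powℕ h (suc m)) g then 1# else 0#) Dn-unique Dn-unique
          (λ h∈ → InDn⇒∈ (InDn-inv (∈⇒InDn h∈)))
          (λ {x} {y} x∈ y∈ e → ≡.trans (≡.sym (inv-inv (InDn.perm (∈⇒InDn x∈))))
            (≡.trans (cong inv e) (inv-inv (InDn.perm (∈⇒InDn y∈)))))
          (λ {y} y∈ → inv y , InDn⇒∈ (InDn-inv (∈⇒InDn y∈)) , inv-inv (InDn.perm (∈⇒InDn y∈))))

    roots≈rhs : OddN n ⊎ OddZ k → fromℕ (rootsD n k g) ≈ rhs n k g
    roots≈rhs parity = trans roots≈sum (trans (roots≈characters (Sum⊎.map (odd⇒par {n}) (odd⇒par {∣ k ∣}) parity))
      (sym rhs≈sum))

open Conclusion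

theorem1p7 : ∀ {c ℓ : Level} (K : Field' c ℓ) → FieldOps.CharZero K →
    (n : ℕ) → 2 ≤ n → (k : ℤ) → OddN n ⊎ OddZ k →
    (α β : ℕ → Field'.Carrier K) →
    (∀ i → 1 ≤ i → i ≤ n → FieldOps.PrimRoot K i (α i) × FieldOps.PrimRoot K (2 Data.Nat.* i) (β i)) →
    ∀ g → g ∈ Dn n →
    Field'._≈_ K (FieldOps.fromℕ K (rootsD n k g)) (Chars.rhs K α β n k g)
theorem1p7 K char0 n _ k parity α β prim g g∈ = Final.roots≈rhs K char0 n α β prim (∈⇒InDn g∈) k parity
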